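{- Let $k \geq 1$ be an integer and let $H$ be a graph that is the disjoint union of $k$ vertex-disjoint cycles (of arbitrary lengths). Then every finite graph $G$ that does not contain $H$ as a minor has treewidth at most \[ 6|V(H)| + 10k\log k + 10k\log\log k + 40k, \] i.e. $f(H) \leq 6|V(H)| + 10k\log k + 10k\log\log k + 40k$. Here all logarithms are base $2$, and for $k=1$ the term $10k\log\log k$ is interpreted as $0$.
   Context: For a graph $H$, $f(H)$ denotes the minimum nonnegative integer such that every graph excluding $H$ as a minor has treewidth at most $f(H)$. A cycle has length at least $3$. All graphs are finite and simple. -}

module Defs where

open import Data.Nat using (ℕ; zero; suc; _+_; _*_; _^_; _≤_)
open import Data.Fin using (Fin; zero; suc; inject₁; fromℕ)
open import Data.Fin.Subset using (Subset; _∈_; ∣_∣)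
open import Data.Bool using (Bool; true; false)
open import Data.Maybe using (Maybe; just)
open import Data.Product using (Σ; ∃; ∃-syntax; _×_; _,_)
open import Data.Unit using (⊤)
open import Relation.Nullary using (¬_)
open import Relation.Binary.PropositionalEquality using (_≡_)
open import Function using (_⇔_)

record Graph : Set where
  field
    n      : ℕ
    adj    : Fin n → Fin n → Bool
    sym    : ∀ u v → adj u v ≡ adj v u
    irrefl : ∀ v → adj v v ≡ false
open Graph public

data Reach (G : Graph) (P : Fin (n G) → Set) : Fin (n G) → Fin (n G) → Set where
  here : ∀ {u} → P u → Reach G P u u
  step : ∀ {u w v} → Reach G P u w → adj G w v ≡ true → P v → Reach G P u v

Connected : Graph → Set
Connected G = ∀ u v → Reach G (λ _ → ⊤) u v

record Cycle (G : Graph) : Set where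
  field
    m      : ℕ
    len≥3  : 2 ≤ m
    vtx    : Fin (suc m) → Fin (n G)
    inj    : ∀ i j → vtx i ≡ vtx j → i ≡ j
    consec : ∀ (i : Fin m) → adj G (vtx (inject₁ i)) (vtx (suc i)) ≡ true
    close  : adj G (vtx (fromℕ m)) (vtx zero) ≡ true
open Cycle public

data CycleEdge {G : Graph} (C : Cycle G) : Fin (n G) → Fin (n G) → Set where
  fwd  : ∀ (i : Fin (m C)) → CycleEdge C (vtx C (inject₁ i)) (vtx C (suc i))
  bwd  : ∀ (i : Fin (m C)) → CycleEdge C (vtx C (suc i)) (vtx C (inject₁ i))
  clf  : CycleEdge C (vtx C (fromℕ (m C))) (vtx C zero)
  clb  : CycleEdge C (vtx C zero) (vtx C (fromℕ (m C)))

IsDisjointUnionOfCycles : ℕ → Graph → Set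
IsDisjointUnionOfCycles k H =
  Σ (Fin k → Cycle H) λ cyc →
      (∀ v → ∃[ i ] ∃[ j ] vtx (cyc i) j ≡ v)
    × (∀ i i' j j' → vtx (cyc i) j ≡ vtx (cyc i') j' → i ≡ i')
    × (∀ u v → (adj H u v ≡ true) ⇔ (∃[ i ] CycleEdge (cyc i) u v))

-- Minors, via minor models (branch sets). β v = just h means vertex v of G
-- lies in the branch set of vertex h of H; branch sets are thus disjoint.

record MinorModel (H G : Graph) : Set where
  field
    β         : Fin (n G) → Maybe (Fin (n H))
    nonempty  : ∀ h → ∃[ v ] β v ≡ just h
    connected : ∀ h u v → β u ≡ just h → β v ≡ just h →
                Reach G (λ w → β w ≡ just h) u v
    edges     : ∀ x y → adj H x y ≡ true →
                ∃[ u ] ∃[ v ] (β u ≡ just x × β v ≡ just y × adj G u v ≡ true)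

_≼_ : Graph → Graph → Set
H ≼ G = MinorModel H G

IsTree : Graph → Set
IsTree T = (1 ≤ n T) × Connected T × ¬ Cycle T

record TreeDecomposition (G : Graph) : Set where
  field
    T      : Graph
    isTree : IsTree T
    bag    : Fin (n T) → Subset (n G)
    cover  : ∀ v → ∃[ t ] v ∈ bag t
    edgeIn : ∀ u v → adj G u v ≡ true → ∃[ t ] (u ∈ bag t × v ∈ bag t)
    interp : ∀ v s t → v ∈ bag s → v ∈ bag t → Reach T (λ r → v ∈ bag r) s t
open TreeDecomposition public

TreewidthAtMost : Graph → ℕ → Set
TreewidthAtMost G w = Σ (TreeDecomposition G) λ D → ∀ t → ∣ bag D t ∣ ≤ suc w

-- The bound 6N + 10k log k + 10k log log k + 40k (log base 2; the
-- log log term is 0 for k = 1), for integers w.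
--
-- For k ≥ 2: 10k log k + 10k log log k = 10k log₂(k · log₂ k), and for a
-- natural number x,  x ≤ 10k log₂(k log₂ k)  iff  2^x ≤ (k log₂ k)^(10k)
-- iff  for every rational p/q (q ≥ 1) with log₂ k ≤ p/q (i.e. k^q ≤ 2^p),
-- 2^x · q^(10k) ≤ (k p)^(10k).
LeTenKLogKLogK : ℕ → ℕ → Set
LeTenKLogKLogK k x =
  ∀ p q → 1 ≤ q → k ^ q ≤ 2 ^ p → 2 ^ x * q ^ (10 * k) ≤ (k * p) ^ (10 * k)

WithinBound : ℕ → ℕ → ℕ → Set
WithinBound N zero w = ⊤   -- k = 0 excluded by hypothesis
WithinBound N (suc zero) w = w ≤ 6 * N + 40
WithinBound N k@(suc (suc _)) w =
  Σ ℕ λ x → (w ≤ 6 * N + 40 * k + x) × LeTenKLogKLogK k x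

module Submission where

-- Process the cycle lengths of H in decreasing order. If G has a cycle whose length lies in [ℓ, 2ℓ), where ℓ is the
-- largest remaining length, delete it; this costs fewer than 2ℓ vertices. Otherwise call two edges similar when they lie on
-- a common cycle shorter than ℓ: by the gap this is an equivalence relation, and a cycle of mutually similar
-- edges is shorter than ℓ. Following Simonovits and Mousset, Noever, Škorić and Weissenberger, start from a
-- maximal family of disjoint cycles of length at least ℓ and add ears, keeping the graph F subcubic and without cycles
-- shorter than ℓ. If F gets many ears it contains k disjoint long cycles. If it gets stuck, all long cycles are hit by the
-- branch vertices, one vertex between dissimilar edges for each path of F between branch vertices, and one vertex
-- for each long cycle that meets F only once. Once the hitting set Y is deleted, all cycles are shorter than ℓ, and a
-- depth-first search tree gives a tree decomposition with bags of size |Y| + ℓ − 1.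

open import Defs hiding (sym)
open import Data.Bool.Base using (Bool; true; false)
import Data.Bool.Properties as Bool
open import Data.Empty using (⊥; ⊥-elim)
open import Data.Fin.Base as Fin using (Fin; zero; suc; inject₁; fromℕ)
import Data.Fin.Properties as Fin
import Data.Fin.Relation.Unary.Top as Top
open import Data.Fin.Subset using (Subset; ∣_∣) renaming (_∈_ to _∈ₛ_; ⊥ to ⊥ₛ)
import Data.Fin.Subset.Properties as Subset
open import Data.List.Base
  using (List; []; _∷_; _++_; [_]; length; reverse; filter; map; allFin; take; tabulate)
import Data.List.Membership.DecPropositional as DecMem
open import Data.List.Membership.Propositional using (_∈_; _∉_; find; lose)
open import Data.List.Membership.Propositional.Properties
  using (∈-++⁺ˡ; ∈-++⁺ʳ; ∈-++⁻; ∈-filter⁺; ∈-filter⁻; ∈-allFin; ∈-∃++; ∈-map⁻; ∈-tabulate⁻)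
import Data.List.Properties as List
open import Data.List.Relation.Binary.Permutation.Propositional
  using (_↭_; refl; prep; swap; ↭-sym; ↭-refl; ↭-trans; ↭-reflexive)
import Data.List.Relation.Binary.Permutation.Propositional.Properties as Perm
open import Data.List.Relation.Binary.Subset.Propositional using (_⊆_)
open import Data.List.Relation.Unary.All as All using (All; []; _∷_)
import Data.List.Relation.Unary.All.Properties as All
open import Data.List.Relation.Unary.AllPairs using (AllPairs; []; _∷_)
import Data.List.Relation.Unary.AllPairs.Properties as AllPairs
open import Data.List.Relation.Unary.Any as Any using (Any; here; there)
open import Data.List.Relation.Unary.Unique.DecPropositional using (unique?)
open import Data.List.Relation.Unary.Unique.Propositional using (Unique)
import Data.List.Relation.Unary.Unique.Propositional.Properties as Unique
open import Data.Maybe.Base using (Maybe; just; nothing)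
open import Data.Nat using (ℕ; zero; suc; _+_; _*_; _^_; _∸_; _≤_; _<_; z≤n; s≤s)
open import Data.Nat.ListAction using (sum)
open import Data.Nat.ListAction.Properties using (sum-↭)
import Data.Nat.Properties as ℕ
open import Data.Nat.Solver using (module +-*-Solver)
open import Data.Product using (Σ; ∃; ∃₂; ∃-syntax; _×_; _,_; proj₁; proj₂)
open import Data.Product.Properties using (≡-dec)
open import Data.Sum using (_⊎_; inj₁; inj₂; [_,_]′)
import Data.Sum as Sum
open import Data.Unit using (⊤; tt)
open import Data.Vec.Base as Vec using (_[_]≔_)
import Data.Vec.Properties as Vec
open import Function using (_∘_; id; case_of_; _⇔_; Equivalence)
open import Relation.Binary.PropositionalEquality
  using (_≡_; _≢_; refl; sym; trans; cong; cong₂; subst; subst₂; ≢-sym; module ≡-Reasoning)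
open import Relation.Nullary using (¬_; Dec; yes; no; does)
open import Relation.Nullary.Decidable using (_×-dec_; _⊎-dec_; ¬?; map′; decidable-stable; toWitness)
open import Relation.Unary using (Decidable)

-- A set meeting all cycles of length at least `ℓ` must in general grow with `ℓ`: the complete graph
-- on kℓ - 1 vertices has no k disjoint ones, and (k - 1)ℓ vertices are needed to hit them. Only the
-- gap makes a hitting set of O(k log k) vertices possible, independently of `ℓ`. Each deletion on
-- the way to a gap is charged to one cycle of H, so these costs add up to at most twice the order
-- of H. Decreasing order fits this: a packing of cycles as long as the longest remaining one serves
-- all remaining lengths, since longer cycles contract to shorter ones. For k + 1 cycles, F is grown
-- until it has 2kr + 1 ears, with r about log k + log log k + 5. A subcubic graph with more edges
-- than vertices and fewer than 2^r branch vertices has a cycle through at most 2r of them, so 2kr +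
-- 1 ears yield k + 1 disjoint cycles. But the ears themselves create 4kr + 2 branch vertices, and
-- asking that this be below 2^r brings in the term log log k. If F is stuck earlier, each ear costs
-- five vertices of the hitting set, whence the factor 10.

private
  variable
    A : Set
    N : ℕ

-- Lists without repetition, bounded search, undirected edges

Unique-resp-↭ : {xs ys : List A} → xs ↭ ys → Unique xs → Unique ys
Unique-resp-↭ refl u = u
Unique-resp-↭ (prep x p) (a ∷ u) = Perm.All-resp-↭ p a ∷ Unique-resp-↭ p u
Unique-resp-↭ (swap x y p) ((x≢y ∷ a) ∷ (b ∷ u)) =
  (≢-sym x≢y ∷ Perm.All-resp-↭ p b) ∷ (Perm.All-resp-↭ p a ∷ Unique-resp-↭ p u)
Unique-resp-↭ (_↭_.trans p q) u = Unique-resp-↭ q (Unique-resp-↭ p u)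

∉⇒All≢ : {x : A} {xs : List A} → x ∉ xs → All (x ≢_) xs
∉⇒All≢ = All.¬Any⇒All¬ _

All≢⇒∉ : {x : A} {xs : List A} → All (x ≢_) xs → x ∉ xs
All≢⇒∉ = All.All¬⇒¬Any

cons-unique : {x : A} {xs : List A} → x ∉ xs → Unique xs → Unique (x ∷ xs)
cons-unique x∉ u = ∉⇒All≢ x∉ ∷ u

head∉ : {x : A} {xs : List A} → Unique (x ∷ xs) → x ∉ xs
head∉ (a ∷ _) = All≢⇒∉ a

tail-unique : {x : A} {xs : List A} → Unique (x ∷ xs) → Unique xs
tail-unique (_ ∷ u) = u

unique-++⁻ˡ : ∀ (xs : List A) {ys} → Unique (xs ++ ys) → Unique xs
unique-++⁻ˡ [] u = []
unique-++⁻ˡ (x ∷ xs) (a ∷ u) = All.++⁻ˡ xs a ∷ unique-++⁻ˡ xs u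

unique-++⁻ʳ : ∀ (xs : List A) {ys} → Unique (xs ++ ys) → Unique ys
unique-++⁻ʳ [] u = u
unique-++⁻ʳ (x ∷ xs) (_ ∷ u) = unique-++⁻ʳ xs u

unique-++-disjoint : ∀ (xs : List A) {ys v} → Unique (xs ++ ys) → v ∈ xs → v ∉ ys
unique-++-disjoint (x ∷ xs) (a ∷ u) (here refl) v∈ys = All≢⇒∉ (All.++⁻ʳ xs a) v∈ys
unique-++-disjoint (x ∷ xs) (_ ∷ u) (there v∈xs) v∈ys = unique-++-disjoint xs u v∈xs v∈ys

unique-++⁺ : {xs ys : List A} → Unique xs → Unique ys → (∀ {v} → v ∈ xs → v ∉ ys) → Unique (xs ++ ys)
unique-++⁺ u v d = Unique.++⁺ u v (λ (p , q) → d p q)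

unique-⊆-length : {xs ys : List A} → Unique xs → xs ⊆ ys → length xs ≤ length ys
unique-⊆-length {xs = []} u s = z≤n
unique-⊆-length {xs = x ∷ xs} (a ∷ u) s with ∈-∃++ (s (here refl))
... | as , bs , refl = ℕ.≤-trans (s≤s (unique-⊆-length u sub)) (ℕ.≤-reflexive (sym (Perm.↭-length (Perm.shift x as bs))))
  where
  sub : xs ⊆ as ++ bs
  sub {v} v∈ with Perm.∈-resp-↭ (Perm.shift x as bs) (s (there v∈))
  ... | here refl = ⊥-elim (All≢⇒∉ a v∈)
  ... | there q = q

_∈?_ : (x : Fin N) (xs : List (Fin N)) → Dec (x ∈ xs)
_∈?_ = DecMem._∈?_ Fin._≟_

-- Simple walks and cycles list at most `N` vertices, so their existence is decided by a search up
-- to that length. This is how the proof gets its case distinctions constructively, and why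
-- definitions such as `OnShort` carry a bound `length ys ≤ N`.
∃-list? : {P : List (Fin N) → Set} → Decidable P → ∀ m → Dec (∃ λ l → length l ≤ m × P l)
∃-list? {P = P} P? zero = map′ (λ p → [] , z≤n , p) (λ { ([] , _ , p) → p }) (P? [])
∃-list? {P = P} P? (suc m) =
  map′ (λ { (inj₁ p) → [] , z≤n , p ; (inj₂ (x , l , h , p)) → x ∷ l , s≤s h , p })
       (λ { ([] , _ , p) → inj₁ p ; (x ∷ l , s≤s h , p) → inj₂ (x , l , h , p) })
       (P? [] ⊎-dec Fin.any? (λ x → ∃-list? (λ l → P? (x ∷ l)) m))

unique-length≤ : {xs : List (Fin N)} → Unique xs → length xs ≤ N
unique-length≤ {N} {xs} u = subst (length xs ≤_) (List.length-tabulate {n = N} id) (unique-⊆-length u (λ {v} _ → ∈-allFin v))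

-- An undirected edge is stored as the pair of its ends in increasing order.
orient : {P : Set} → Dec P → Fin N → Fin N → Fin N × Fin N
orient (yes _) u v = u , v
orient (no _) u v = v , u

edge : Fin N → Fin N → Fin N × Fin N
edge u v = orient (u Fin.≤? v) u v

edge-comm : (u v : Fin N) → edge u v ≡ edge v u
edge-comm u v = helper (u Fin.≤? v) (v Fin.≤? u)
  where
  helper : (d : Dec (u Fin.≤ v)) (d′ : Dec (v Fin.≤ u)) → orient d u v ≡ orient d′ v u
  helper (yes p) (yes q) = cong₂ _,_ (Fin.≤-antisym p q) (Fin.≤-antisym q p)
  helper (yes p) (no q) = refl
  helper (no p) (yes q) = refl
  helper (no p) (no q) = ⊥-elim ([ p , q ]′ (Fin.≤-total u v))

edge-cases : (u v : Fin N) → edge u v ≡ (u , v) ⊎ edge u v ≡ (v , u)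
edge-cases u v = helper (u Fin.≤? v)
  where
  helper : (d : Dec (u Fin.≤ v)) → orient d u v ≡ (u , v) ⊎ orient d u v ≡ (v , u)
  helper (yes _) = inj₁ refl
  helper (no _) = inj₂ refl

edge-inj : {u v x y : Fin N} → edge u v ≡ edge x y → (u ≡ x × v ≡ y) ⊎ (u ≡ y × v ≡ x)
edge-inj {u = u} {v} {x} {y} eq with edge-cases u v | edge-cases x y
... | inj₁ p | inj₁ q with refl ← trans (sym p) (trans eq q) = inj₁ (refl , refl)
... | inj₁ p | inj₂ q with refl ← trans (sym p) (trans eq q) = inj₂ (refl , refl)
... | inj₂ p | inj₁ q with refl ← trans (sym p) (trans eq q) = inj₂ (refl , refl)
... | inj₂ p | inj₂ q with refl ← trans (sym p) (trans eq q) = inj₁ (refl , refl)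

edge-injʳ : {u v w : Fin N} → edge u v ≡ edge u w → v ≡ w
edge-injʳ eq with edge-inj eq
... | inj₁ (_ , p) = p
... | inj₂ (p , q) = trans q p

_≟ₑ_ : (e f : Fin N × Fin N) → Dec (e ≡ f)
_≟ₑ_ = ≡-dec Fin._≟_ Fin._≟_

_∈ₑ?_ : (e : Fin N × Fin N) (es : List (Fin N × Fin N)) → Dec (e ∈ es)
_∈ₑ?_ = DecMem._∈?_ _≟ₑ_

Inc : Fin N → Fin N × Fin N → Set
Inc w e = w ≡ proj₁ e ⊎ w ≡ proj₂ e

Inc? : (w : Fin N) (e : Fin N × Fin N) → Dec (Inc w e)
Inc? w e = (w Fin.≟ proj₁ e) ⊎-dec (w Fin.≟ proj₂ e)

inc-edge⁻ : {w u v : Fin N} → Inc w (edge u v) → w ≡ u ⊎ w ≡ v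
inc-edge⁻ {w = w} {u} {v} i with edge-cases u v
... | inj₁ p = subst (Inc w) p i
... | inj₂ p = Sum.swap (subst (Inc w) p i)

inc-edgeˡ : {u v : Fin N} → Inc u (edge u v)
inc-edgeˡ {u = u} {v} with edge-cases u v
... | inj₁ p = subst (Inc u) (sym p) (inj₁ refl)
... | inj₂ p = subst (Inc u) (sym p) (inj₂ refl)

inc-edgeʳ : {u v : Fin N} → Inc v (edge u v)
inc-edgeʳ {u = u} {v} = subst (Inc v) (edge-comm v u) inc-edgeˡ

-- Walks and cycles as vertex lists

edges : Fin N → List (Fin N) → List (Fin N × Fin N)
edges x [] = []
edges x (y ∷ ys) = edge x y ∷ edges y ys

length-edges : (x : Fin N) (ys : List (Fin N)) → length (edges x ys) ≡ length ys
length-edges x [] = refl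
length-edges x (y ∷ ys) = cong suc (length-edges y ys)

front : A → List A → List A
front x [] = []
front x (y ∷ ys) = x ∷ front y ys

length-front : (x : A) (ys : List A) → length (front x ys) ≡ length ys
length-front x [] = refl
length-front x (y ∷ ys) = cong suc (length-front y ys)

-- [Chain R x ys z]: ys lists the vertices after x of a walk from x to z, so length ys is its number of steps.
data Chain (R : Fin N → Fin N → Set) : Fin N → List (Fin N) → Fin N → Set where
  []  : ∀ {x} → Chain R x [] x
  _∷_ : ∀ {x y ys z} → R x y → Chain R y ys z → Chain R x (y ∷ ys) z

-- Reversal under the convention of `Chain`: the result leaves out the new starting vertex, which is
-- the old end, and finishes with `x`.
rev : Fin N → List (Fin N) → List (Fin N)
rev x ys = reverse (front x ys)

rev-cons : (x y : Fin N) (ys : List (Fin N)) → rev x (y ∷ ys) ≡ rev y ys ++ [ x ]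
rev-cons x y ys = List.unfold-reverse x (front y ys)

rev↭front : (x : Fin N) (ys : List (Fin N)) → rev x ys ↭ front x ys
rev↭front x ys = Perm.↭-reverse (front x ys)

length-rev : (x : Fin N) (ys : List (Fin N)) → length (rev x ys) ≡ length ys
length-rev x ys = trans (List.length-reverse (front x ys)) (length-front x ys)

inc-edges : {x w : Fin N} {ys : List (Fin N)} {e : Fin N × Fin N} → e ∈ edges x ys → Inc w e → w ∈ x ∷ ys
inc-edges {x = x} {ys = y ∷ ys} (here refl) i with inc-edge⁻ {u = x} {y} i
... | inj₁ refl = here refl
... | inj₂ refl = there (here refl)
inc-edges {x = x} {ys = y ∷ ys} (there m) i = there (inc-edges m i)

module _ {R : Fin N → Fin N → Set} where

  chain? : (∀ u v → Dec (R u v)) → ∀ x ys z → Dec (Chain R x ys z)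
  chain? R? x [] z with x Fin.≟ z
  ... | yes refl = yes []
  ... | no x≢z = no λ { [] → x≢z refl }
  chain? R? x (y ∷ ys) z =
    map′ (λ (r , c) → r ∷ c) (λ { (r ∷ c) → r , c }) (R? x y ×-dec chain? R? y ys z)

  _++ᶜ_ : ∀ {x xs y ys z} → Chain R x xs y → Chain R y ys z → Chain R x (xs ++ ys) z
  [] ++ᶜ d = d
  (r ∷ c) ++ᶜ d = r ∷ (c ++ᶜ d)

  end∈ : ∀ {x ys z} → Chain R x ys z → z ∈ x ∷ ys
  end∈ [] = here refl
  end∈ (_ ∷ c) = there (end∈ c)

  end∈′ : ∀ {x ys z} → Chain R x ys z → x ≢ z → z ∈ ys
  end∈′ c x≢z with end∈ c
  ... | here p = ⊥-elim (x≢z (sym p))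
  ... | there p = p

  closed-end∈ : ∀ {x ys z} → Chain R x ys z → 1 ≤ length ys → z ∈ ys
  closed-end∈ (_ ∷ c) _ = end∈ c

  front-end : ∀ {x ys z} → Chain R x ys z → front x ys ++ [ z ] ≡ x ∷ ys
  front-end [] = refl
  front-end (_ ∷ c) = cong (_ ∷_) (front-end c)

  front-++ : ∀ {x xs y} ys → Chain R x xs y → front x (xs ++ ys) ≡ front x xs ++ front y ys
  front-++ ys [] = refl
  front-++ ys (_ ∷ c) = cong (_ ∷_) (front-++ ys c)

  edges-++ : ∀ {x xs y} ys → Chain R x xs y → edges x (xs ++ ys) ≡ edges x xs ++ edges y ys
  edges-++ ys [] = refl
  edges-++ ys (_ ∷ c) = cong (_ ∷_) (edges-++ ys c)

  snoc : ∀ {x xs y z} → Chain R x xs y → R y z → Chain R x (xs ++ [ z ]) z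
  snoc c r = c ++ᶜ (r ∷ [])

  chain-rev : (∀ {u v} → R u v → R v u) → ∀ {x ys z} → Chain R x ys z → Chain R z (rev x ys) x
  chain-rev s [] = []
  chain-rev s {x} {y ∷ ys} {z} (r ∷ c) =
    subst (λ l → Chain R z l x) (sym (rev-cons x y ys)) (snoc (chain-rev s c) (s r))

  rev-edges↭ : (∀ {u v} → R u v → R v u) → ∀ {x ys z} → Chain R x ys z → edges z (rev x ys) ↭ edges x ys
  rev-edges↭ s [] = ↭-refl
  rev-edges↭ s {x} {y ∷ ys} {z} (r ∷ c) =
    ↭-trans (↭-reflexive (trans (cong (edges z) (rev-cons x y ys)) (edges-++ [ x ] (chain-rev s c))))
    (↭-trans (Perm.++-comm (edges z (rev y ys)) [ edge y x ])
    (↭-trans (↭-reflexive (cong (_∷ edges z (rev y ys)) (edge-comm y x)))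
             (prep _ (rev-edges↭ s c))))

  front⊆ : ∀ {x ys z} → Chain R x ys z → front x ys ⊆ x ∷ ys
  front⊆ c m = subst (_ ∈_) (front-end c) (∈-++⁺ˡ m)

  front-unique : ∀ {x ys z} → Chain R x ys z → Unique (x ∷ ys) → Unique (front x ys)
  front-unique {x} {ys} c u = unique-++⁻ˡ (front x ys) (subst Unique (sym (front-end c)) u)

  end∉front : ∀ {x ys z} → Chain R x ys z → Unique (x ∷ ys) → z ∉ front x ys
  end∉front {x} {ys} {z} c u m =
    unique-++-disjoint (front x ys) (subst Unique (sym (front-end c)) u) m (here refl)

  rev-unique : ∀ {x ys z} → Chain R x ys z → Unique (x ∷ ys) → Unique (z ∷ rev x ys)
  rev-unique {x} {ys} {z} c u =
    Unique-resp-↭ (↭-trans (↭-reflexive (sym (front-end c)))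
      (↭-trans (Perm.++-comm (front x ys) [ z ]) (prep z (↭-sym (rev↭front x ys))))) u

  rev-∈ : ∀ {x ys z w} → Chain R x ys z → w ∈ z ∷ rev x ys → w ∈ x ∷ ys
  rev-∈ {x} {ys} {z} c m =
    Perm.∈-resp-↭ (↭-trans (prep z (rev↭front x ys)) (↭-trans (Perm.++-comm [ z ] (front x ys)) (↭-reflexive (front-end c)))) m

  edge∈⇒R : (∀ {u v} → R u v → R v u) → ∀ {x ys z u v} → Chain R x ys z → edge u v ∈ edges x ys → R u v
  edge∈⇒R s (r ∷ c) (here eq) with edge-inj eq
  ... | inj₁ (refl , refl) = r
  ... | inj₂ (refl , refl) = s r
  edge∈⇒R s (r ∷ c) (there m) = edge∈⇒R s c m

  ∈⇒inc : ∀ {x ys z w} → Chain R x ys z → 1 ≤ length ys → w ∈ x ∷ ys → ∃ λ e → e ∈ edges x ys × Inc w e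
  ∈⇒inc {x} {y ∷ ys} c _ (here refl) = edge x y , here refl , inc-edgeˡ
  ∈⇒inc {x} {y ∷ ys} c _ (there (here refl)) = edge x y , here refl , inc-edgeʳ {u = x}
  ∈⇒inc {x} {y ∷ _ ∷ ys} (_ ∷ c) _ (there (there m)) with ∈⇒inc c (s≤s z≤n) (there m)
  ... | e , p , q = e , there p , q

  chain-map : {R′ : Fin N → Fin N → Set} → ∀ {x ys z} → Chain R x ys z →
              (∀ {u v} → R u v → edge u v ∈ edges x ys → R′ u v) → Chain R′ x ys z
  chain-map [] f = []
  chain-map (r ∷ c) f = f r (here refl) ∷ chain-map c (λ r m → f r (there m))

  record Split (x : Fin N) (ys : List (Fin N)) (z : Fin N) : Set where
    constructor split
    field
      mid : Fin N
      pre post : List (Fin N)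
      eq : ys ≡ pre ++ post
      c₁ : Chain R x pre mid
      c₂ : Chain R mid post z

  consˢ : ∀ {x y ys z} → R x y → Split y ys z → Split x (y ∷ ys) z
  consˢ {y = y} r (split m p q e c d) = split m (y ∷ p) q (cong (y ∷_) e) (r ∷ c) d

  split∈ : ∀ {x ys z w} → Chain R x ys z → w ∈ x ∷ ys → ∃₂ λ pre post → ys ≡ pre ++ post × Chain R x pre w × Chain R w post z
  split∈ c (here refl) = [] , _ , refl , [] , c
  split∈ (r ∷ c) (there m) with split∈ c m
  ... | p , q , refl , c₁ , c₂ = _ ∷ p , q , refl , r ∷ c₁ , c₂

  module _ {P : Fin N → Set} (P? : Decidable P) where

    firstHit : ∀ {x ys z} → Chain R x ys z → Any P (x ∷ ys) →
               Σ (Split x ys z) λ s → P (Split.mid s) × All (¬_ ∘ P) (front x (Split.pre s))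
    firstHit {x} c a with P? x
    ... | yes p = split x [] _ refl [] c , p , []
    firstHit c (here p) | no ¬p = ⊥-elim (¬p p)
    firstHit (r ∷ c) (there a) | no ¬p with firstHit c a
    ... | s , q , al = consˢ r s , q , ¬p ∷ al

    lastHit : ∀ {x ys z} → Chain R x ys z → Any P (x ∷ ys) →
              Σ (Split x ys z) λ s → P (Split.mid s) × All (¬_ ∘ P) (Split.post s)
    lastHit {x} {ys} c a with Any.any? P? ys
    lastHit (r ∷ c) a | yes b with lastHit c b
    ... | s , q , al = consˢ r s , q , al
    lastHit c (there b) | no ¬b = ⊥-elim (¬b b)
    lastHit {x} c (here p) | no ¬b = split x [] _ refl [] c , p , All.¬Any⇒All¬ _ ¬b

  simplify : ∀ {x ys z} → Chain R x ys z → ∃ λ ys′ → Chain R x ys′ z × Unique (x ∷ ys′) × ys′ ⊆ ys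
  simplify [] = [] , [] , [] ∷ [] , id
  simplify {x} {y ∷ ys} (r ∷ c) with simplify c
  ... | ys′ , c′ , u′ , s with x ∈? (y ∷ ys′)
  ... | no x∉ = y ∷ ys′ , r ∷ c′ , cons-unique x∉ u′ , λ { (here p) → here p ; (there m) → there (s m) }
  ... | yes x∈ with split∈ c′ x∈
  ... | p , q , refl , d₁ , d₂ = q , d₂ , Unq , λ m → there (s (∈-++⁺ʳ p m))
    where
    Unq : Unique (x ∷ q)
    Unq = unique-++⁻ʳ (front y p) (subst Unique eq′ u′)
      where
      eq′ : y ∷ p ++ q ≡ front y p ++ x ∷ q
      eq′ = trans (cong (_++ q) (sym (front-end d₁))) (List.++-assoc (front y p) [ x ] q)

-- The base `a` is not put in front but is the last entry of `ys`, so `ys` has every vertex once and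
-- its length counts vertices and edges alike.
record IsCycle {N} (R : Fin N → Fin N → Set) (a : Fin N) (ys : List (Fin N)) : Set where
  constructor cycle
  field
    chain  : Chain R a ys a
    unique : Unique ys
    long   : 3 ≤ length ys

open IsCycle public

length-++-comm : ∀ (p q : List A) → length (p ++ q) ≡ length (q ++ p)
length-++-comm p q = Perm.↭-length (Perm.++-comm p q)

module _ {R : Fin N → Fin N → Set} where

  isCycle? : (∀ u v → Dec (R u v)) → ∀ a ys → Dec (IsCycle R a ys)
  isCycle? R? a ys =
    map′ (λ (c , u , l) → cycle c u l) (λ (cycle c u l) → c , u , l)
         (chain? R? a ys a ×-dec (unique? Fin._≟_ ys ×-dec (3 ℕ.≤? length ys)))

  base∈ : ∀ {a ys} → IsCycle R a ys → a ∈ ys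
  base∈ C = closed-end∈ (chain C) (ℕ.≤-trans (s≤s z≤n) (long C))

  cycle-∈ : ∀ {a ys w} → IsCycle R a ys → w ∈ a ∷ ys → w ∈ ys
  cycle-∈ C (here refl) = base∈ C
  cycle-∈ C (there m) = m

  rotate : ∀ {a b p q} → Chain R a p b → Chain R b q a → IsCycle R a (p ++ q) → IsCycle R b (q ++ p)
  rotate {p = p} {q} c d C =
    cycle (d ++ᶜ c) (Unique-resp-↭ (Perm.++-comm p q) (unique C)) (subst (3 ≤_) (length-++-comm p q) (long C))

  rotate-edges : ∀ {a b p q} → Chain R a p b → Chain R b q a → edges b (q ++ p) ↭ edges a (p ++ q)
  rotate-edges {a} {b} {p} {q} c d =
    ↭-trans (↭-reflexive (edges-++ p d))
      (↭-trans (Perm.++-comm (edges b q) (edges a p)) (↭-reflexive (sym (edges-++ q c))))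

  rotateTo : ∀ {a ys w} → IsCycle R a ys → w ∈ ys →
             ∃ λ zs → IsCycle R w zs × zs ↭ ys × edges w zs ↭ edges a ys
  rotateTo C w∈ with split∈ (chain C) (there w∈)
  ... | p , q , refl , c , d = q ++ p , rotate c d C , Perm.++-comm q p , rotate-edges c d

  cycle-map : {R′ : Fin N → Fin N → Set} → ∀ {a ys} → IsCycle R a ys →
              (∀ {u v} → R u v → edge u v ∈ edges a ys → R′ u v) → IsCycle R′ a ys
  cycle-map C f = cycle (chain-map (chain C) f) (unique C) (long C)

  edgeSplit : ∀ {x ys z e} → Chain R x ys z → e ∈ edges x ys →
              ∃₂ λ u v → ∃₂ λ p q → ys ≡ p ++ v ∷ q × Chain R x p u × R u v × Chain R v q z × e ≡ edge u v
  edgeSplit (r ∷ c) (here refl) = _ , _ , [] , _ , refl , [] , r , c , refl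
  edgeSplit (r ∷ c) (there m) with edgeSplit c m
  ... | u , v , p , q , refl , c₁ , r′ , c₂ , eq = u , v , _ ∷ p , q , refl , r ∷ c₁ , r′ , c₂ , eq

  -- Two different arcs between the same ends cannot both be a single edge; the edge `e` on only one
  -- of them witnesses that they differ.
  two-arcs-length : ∀ {a b os q e} → Chain R a os b → Chain R b q a →
                    e ∈ edges a os → e ∉ edges b q → 1 ≤ length q → 3 ≤ length os + length q
  two-arcs-length {os = o ∷ []} {x ∷ []} (r ∷ []) (s ∷ []) (here refl) e∉ _ =
    ⊥-elim (e∉ (here (edge-comm _ _)))
  two-arcs-length {os = _ ∷ []} {_ ∷ _ ∷ _} c d e∈ e∉ _ = s≤s (s≤s (s≤s z≤n))
  two-arcs-length {os = _ ∷ _ ∷ os} {_ ∷ q} c d e∈ e∉ _ =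
    s≤s (s≤s (ℕ.≤-trans (s≤s z≤n) (ℕ.m≤n+m _ (length os))))

  -- An ear turns the cycle into two others, one for each arc that it replaces: `forward` drops `p`,
  -- `backward` drops `q`. In `free` the end `b` is excepted because a walk lists its end but not
  -- its start.
  module Ear (Rsym : ∀ {u v} → R u v → R v u)
             {a b p q os} (c : Chain R a p b) (d : Chain R b q a) (C : IsCycle R a (p ++ q)) (a≢b : a ≢ b)
             (o : Chain R a os b) (o! : Unique os) (free : ∀ {w} → w ∈ os → w ≡ b ⊎ w ∉ p ++ q) where

    private
      b∈p : b ∈ p
      b∈p = end∈′ c a≢b
      a∈q : a ∈ q
      a∈q = end∈′ d (≢-sym a≢b)
      a∉p : a ∉ p
      a∉p m = unique-++-disjoint p (unique C) m a∈q
      b∉q : b ∉ q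
      b∉q = unique-++-disjoint p (unique C) b∈p
      a∉os : a ∉ os
      a∉os m with free m
      ... | inj₁ eq = a≢b eq
      ... | inj₂ ∉C = ∉C (∈-++⁺ʳ p a∈q)

    forward : 3 ≤ length os + length q → IsCycle R a (os ++ q)
    forward l = cycle (o ++ᶜ d) (unique-++⁺ o! (unique-++⁻ʳ p (unique C)) disj)
                      (subst (3 ≤_) (sym (List.length-++ os)) l)
      where
      disj : ∀ {w} → w ∈ os → w ∉ q
      disj m m′ with free m
      ... | inj₁ refl = b∉q m′
      ... | inj₂ ∉C = ∉C (∈-++⁺ʳ p m′)

    forward-edges : edges a (os ++ q) ≡ edges a os ++ edges b q
    forward-edges = edges-++ q o

    backward : 3 ≤ length p + length os → IsCycle R a (p ++ rev a os)
    backward l = cycle (c ++ᶜ chain-rev Rsym o)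
        (unique-++⁺ (unique-++⁻ˡ p (unique C)) (tail-unique (rev-unique o (cons-unique a∉os o!))) disj)
        (subst (3 ≤_) (sym (trans (List.length-++ p) (cong (length p +_) (length-rev a os)))) l)
      where
      disj : ∀ {w} → w ∈ p → w ∉ rev a os
      disj m m′ with rev-∈ o (there m′)
      ... | here refl = a∉p m
      ... | there m″ with free m″
      ...   | inj₁ refl = head∉ (rev-unique o (cons-unique a∉os o!)) m′
      ...   | inj₂ ∉C = ∉C (∈-++⁺ˡ m)

    backward-edges : ∀ {e} → e ∈ edges a (p ++ rev a os) → e ∈ edges a p ⊎ e ∈ edges a os
    backward-edges {e} m with ∈-++⁻ (edges a p) (subst (e ∈_) (edges-++ (rev a os) c) m)
    ... | inj₁ m₁ = inj₁ m₁
    ... | inj₂ m₂ = inj₂ (Perm.∈-resp-↭ (rev-edges↭ Rsym o) m₂)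

    backward-edges⁺ : ∀ {e} → e ∈ edges a p ⊎ e ∈ edges a os → e ∈ edges a (p ++ rev a os)
    backward-edges⁺ {e} m = subst (e ∈_) (sym (edges-++ (rev a os) c))
      ([ ∈-++⁺ˡ , (λ m₂ → ∈-++⁺ʳ (edges a p) (Perm.∈-resp-↭ (↭-sym (rev-edges↭ Rsym o)) m₂)) ]′ m)

-- Used on a cycle cut open: `pre` and `post` are the stretches outside the first and the last visit
-- to `P`. Glued across the cut they form one excursion from `β` to `α` that avoids `P` inside.
record OuterHits {N} (R : Fin N → Fin N → Set) (P : Fin N → Set) (y : Fin N) (rest : List (Fin N)) (v : Fin N) : Set where
  field
    {α β} : Fin N
    {pre mid post} : List (Fin N)
    eq : rest ≡ pre ++ mid ++ post
    c₁ : Chain R y pre α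
    c₂ : Chain R α mid β
    c₃ : Chain R β post v
    Pα : P α
    Pβ : P β
    α≢β : α ≢ β
    before : ∀ {w} → w ∈ y ∷ pre → w ≡ α ⊎ ¬ P w
    after  : ∀ {w} → w ∈ post → ¬ P w

module _ {R : Fin N → Fin N → Set} {P : Fin N → Set} (P? : Decidable P) where

  prefix-free : ∀ {x pre z} → Chain R x pre z → All (¬_ ∘ P) (front x pre) → ∀ {w} → w ∈ x ∷ pre → w ≡ z ⊎ ¬ P w
  prefix-free {x} {pre} c al {w} m with ∈-++⁻ (front x pre) (subst (w ∈_) (sym (front-end c)) m)
  ... | inj₁ m₁ = inj₂ (All.lookup al m₁)
  ... | inj₂ (here eq) = inj₁ eq

  outerHits : ∀ {y rest v a b} → Chain R y rest v → Unique (y ∷ rest) →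
              a ∈ y ∷ rest → P a → b ∈ y ∷ rest → P b → a ≢ b → OuterHits R P y rest v
  outerHits {y} {rest} {v} {a} {b} ch u a∈ Pa b∈ Pb a≢b
    with firstHit P? ch (Any.map (λ { refl → Pa }) a∈)
  ... | split α pre _ refl c₁ c′ , Pα , al
    with lastHit P? c′ (here Pα)
  ... | split β mid post refl c₂ c₃ , Pβ , al′ = record
    { eq = refl ; c₁ = c₁ ; c₂ = c₂ ; c₃ = c₃ ; Pα = Pα ; Pβ = Pβ ; α≢β = α≢β mid c₂ u a∈ b∈
    ; before = prefix-free c₁ al ; after = All.lookup al′ }
    where
    sole : ∀ {w} → w ∈ (y ∷ pre) ++ post → P w → w ≡ α
    sole m Pw with ∈-++⁻ (y ∷ pre) m
    ... | inj₁ m₁ = [ id , (λ ¬P → ⊥-elim (¬P Pw)) ]′ (prefix-free c₁ al m₁)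
    ... | inj₂ m₂ = ⊥-elim (All.lookup al′ m₂ Pw)
    α≢β : ∀ mid → Chain R α mid β → Unique (y ∷ pre ++ mid ++ post) →
          a ∈ y ∷ pre ++ mid ++ post → b ∈ y ∷ pre ++ mid ++ post → α ≢ β
    α≢β [] _ _ a∈ b∈ _ = a≢b (trans (sole a∈ Pa) (sym (sole b∈ Pb)))
    α≢β (m ∷ ms) c u _ _ refl =
      unique-++-disjoint (y ∷ pre) u (end∈ c₁) (∈-++⁺ˡ (closed-end∈ c (s≤s z≤n)))

-- Edges on a common short cycle

record GapGraph (N : ℕ) : Set₁ where
  field
    R    : Fin N → Fin N → Set
    R?   : ∀ u v → Dec (R u v)
    Rsym : ∀ {u v} → R u v → R v u
    Rirr : ∀ {u v} → R u v → u ≢ v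
    ℓ    : ℕ
    3≤ℓ  : 3 ≤ ℓ
    gap  : ∀ {a ys} → IsCycle R a ys → length ys < ℓ + ℓ → length ys < ℓ

module Similarity {N : ℕ} (Γ : GapGraph N) where

  open GapGraph Γ

  E : Set
  E = Fin N × Fin N

  OnShort : E → E → Set
  OnShort e f = ∃₂ λ a ys → length ys ≤ N × IsCycle R a ys × length ys < ℓ × e ∈ edges a ys × f ∈ edges a ys

  Sim : E → E → Set
  Sim e f = e ≡ f ⊎ OnShort e f

  Sim? : ∀ e f → Dec (Sim e f)
  Sim? e f = (e ≟ₑ f) ⊎-dec Fin.any? λ a → ∃-list?
    (λ ys → isCycle? R? a ys ×-dec ((length ys ℕ.<? ℓ) ×-dec ((e ∈ₑ? edges a ys) ×-dec (f ∈ₑ? edges a ys)))) N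

  short : ∀ {a ys e f} → IsCycle R a ys → length ys < ℓ → e ∈ edges a ys → f ∈ edges a ys → Sim e f
  short C l p q = inj₂ (_ , _ , unique-length≤ (unique C) , C , l , p , q)

  sim-sym : ∀ {e f} → Sim e f → Sim f e
  sim-sym (inj₁ eq) = inj₁ (sym eq)
  sim-sym (inj₂ (a , ys , h , C , l , p , q)) = inj₂ (a , ys , h , C , l , q , p)

  private
    cycle-ends : ∀ {a ys e} → IsCycle R a ys → e ∈ edges a ys →
                 ∃₂ λ u v → e ≡ edge u v × R u v × u ∈ ys × v ∈ ys
    cycle-ends {a} {ys} C m with edgeSplit (chain C) m
    ... | u , v , p , q , refl , c₁ , r , c₂ , refl =
      u , v , refl , r , cycle-∈ C (inc-edges m inc-edgeˡ) , ∈-++⁺ʳ p (here refl)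

    -- Cut the second cycle at `g`. What is left still contains both ends of `f`, which lie on the
    -- first cycle, so its outermost visits to that cycle are different vertices; the stretch of the
    -- second cycle between them that contains `g` is an ear.
    ear-through : ∀ {a ys b zs f g} → IsCycle R a ys → IsCycle R b zs →
                  f ∈ edges a ys → f ∈ edges b zs → g ∈ edges b zs →
                  ∃₂ λ α β → ∃ λ os → Chain R β os α × Unique os × α ≢ β × α ∈ ys × β ∈ ys ×
                    (∀ {w} → w ∈ os → w ≡ α ⊎ w ∉ ys) × g ∈ edges β os × length os ≤ length zs
    ear-through {a} {ys} {b} C D f∈C f∈D g∈D with edgeSplit (chain D) g∈D
    ... | u , v , p , q , refl , c₁ , r , c₂ , refl
      with cycle-ends C f∈C
    ... | x , y , refl , rxy , x∈C , y∈C
      with outerHits (_∈? ys) K K! (inK inc-edgeˡ) x∈C (inK (inc-edgeʳ {u = x})) y∈C (Rirr rxy)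
      where
      K : Chain R v (q ++ p) u
      K = c₂ ++ᶜ c₁
      K! : Unique (v ∷ q ++ p)
      K! = Unique-resp-↭ (Perm.++-comm p (v ∷ q)) (unique D)
      inK : ∀ {w} → Inc w (edge x y) → w ∈ v ∷ q ++ p
      inK i = Perm.∈-resp-↭ (Perm.++-comm p (v ∷ q)) (cycle-∈ D (inc-edges f∈D i))
    ... | record { α = α ; β = β ; pre = pre ; mid = mid ; post = post ; eq = eq ; c₁ = k₁ ; c₃ = k₃
                 ; Pα = α∈ ; Pβ = β∈ ; α≢β = α≢β ; before = before ; after = after } =
      α , β , os , k₃ ++ᶜ (r ∷ k₁) , os! , α≢β , α∈ , β∈ , free ,
      subst (edge u v ∈_) (sym (edges-++ (v ∷ pre) k₃)) (∈-++⁺ʳ (edges β post) (here refl)) , len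
      where
      os : List (Fin N)
      os = post ++ v ∷ pre
      total↭ : p ++ v ∷ q ↭ (v ∷ pre) ++ (mid ++ post)
      total↭ = ↭-trans (Perm.++-comm p (v ∷ q)) (↭-reflexive (cong (v ∷_) eq))
      total! : Unique ((v ∷ pre) ++ (mid ++ post))
      total! = Unique-resp-↭ total↭ (unique D)
      free : ∀ {w} → w ∈ os → w ≡ α ⊎ w ∉ ys
      free m with ∈-++⁻ post m
      ... | inj₁ m₁ = inj₂ (after m₁)
      ... | inj₂ m₂ = before m₂
      os! : Unique os
      os! = unique-++⁺ (unique-++⁻ʳ mid (unique-++⁻ʳ (v ∷ pre) total!)) (unique-++⁻ˡ (v ∷ pre) total!)
             (λ m m′ → unique-++-disjoint (v ∷ pre) total! m′ (∈-++⁺ʳ mid m))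
      len : length os ≤ length (p ++ v ∷ q)
      len = unique-⊆-length os! (λ m → Perm.∈-resp-↭ (↭-sym total↭)
              ([ (λ m₁ → ∈-++⁺ʳ (v ∷ pre) (∈-++⁺ʳ mid m₁)) , ∈-++⁺ˡ ]′ (∈-++⁻ post m)))

  -- Two short cycles sharing f contain a cycle through e and g shorter than 2ℓ, which is then shorter than ℓ.
  sim-trans : ∀ {e f g} → Sim e f → Sim f g → Sim e g
  sim-trans (inj₁ refl) s = s
  sim-trans s (inj₁ refl) = s
  sim-trans {e} {f} {g} (inj₂ (a , ys , _ , C , lC , e∈C , f∈C)) (inj₂ (b , zs , _ , D , lD , f∈D , g∈D))
    with g ∈ₑ? edges a ys
  ... | yes g∈C = short C lC e∈C g∈C
  ... | no g∉C with ear-through C D f∈C f∈D g∈D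
  ... | α , β , os , o , o! , α≢β , α∈ , β∈ , free , g∈o , len
    with rotateTo C β∈
  ... | xs , C′ , xs↭ys , es↭ with split∈ (chain C′) (there (Perm.∈-resp-↭ (↭-sym xs↭ys) α∈))
  ... | p , q , refl , c , d = go (∈-++⁻ (edges β p) (subst (e ∈_) (edges-++ q c) (Perm.∈-resp-↭ (↭-sym es↭) e∈C)))
    where
    open Ear Rsym c d C′ (≢-sym α≢β) o o! (λ m → Sum.map₂ (λ ∉C m′ → ∉C (Perm.∈-resp-↭ xs↭ys m′)) (free m))
    g∉ : ∀ {h} → h ≡ g → h ∈ edges β p ⊎ h ∈ edges α q → ⊥
    g∉ refl m = g∉C (Perm.∈-resp-↭ es↭ (subst (g ∈_) (sym (edges-++ q c)) ([ ∈-++⁺ˡ , ∈-++⁺ʳ (edges β p) ]′ m)))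
    lC′ : length (p ++ q) < ℓ
    lC′ = subst (_< ℓ) (sym (Perm.↭-length xs↭ys)) lC
    lo : length os < ℓ
    lo = ℕ.≤-<-trans len lD
    1≤ : ∀ {x l z w} → Chain R x l z → w ∈ l → 1 ≤ length l
    1≤ (_ ∷ _) _ = s≤s z≤n
    -- The arc that carries `e` is kept and the ear through `g` replaces the other. Each piece is
    -- shorter than `ℓ`, so the gap applies to the sum.
    go : e ∈ edges β p ⊎ e ∈ edges α q → Sim e g
    go (inj₁ e∈p) = short cyc (gap cyc (subst (_< ℓ + ℓ) (sym eqlen) (ℕ.+-mono-<-≤ lp (ℕ.<⇒≤ lo))))
                          (backward-edges⁺ (inj₁ e∈p)) (backward-edges⁺ (inj₂ g∈o))
      where
      lp : length p < ℓ
      lp = ℕ.≤-<-trans (subst (length p ≤_) (sym (List.length-++ p)) (ℕ.m≤m+n _ _)) lC′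
      three : 3 ≤ length p + length os
      three = subst (3 ≤_) (trans (cong (length os +_) (length-rev β p)) (ℕ.+-comm (length os) (length p)))
               (two-arcs-length o (chain-rev Rsym c) g∈o
                 (λ m → g∉ refl (inj₁ (Perm.∈-resp-↭ (rev-edges↭ Rsym c) m)))
                 (subst (1 ≤_) (sym (length-rev β p)) (1≤ c (end∈′ c (≢-sym α≢β)))))
      cyc = backward three
      eqlen : length (p ++ rev β os) ≡ length p + length os
      eqlen = trans (List.length-++ p) (cong (length p +_) (length-rev β os))
    go (inj₂ e∈q) = short cyc (gap cyc (subst (_< ℓ + ℓ) (sym (List.length-++ os)) (ℕ.+-mono-<-≤ lo (ℕ.<⇒≤ lq))))
                          (subst (e ∈_) (sym forward-edges) (∈-++⁺ʳ (edges β os) e∈q))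
                          (subst (g ∈_) (sym forward-edges) (∈-++⁺ˡ g∈o))
      where
      lq : length q < ℓ
      lq = ℕ.≤-<-trans (subst (length q ≤_) (sym (List.length-++ p)) (ℕ.m≤n+m _ (length p))) lC′
      three : 3 ≤ length os + length q
      three = two-arcs-length o d g∈o (λ m → g∉ refl (inj₂ m)) (1≤ d (end∈′ d α≢β))
      cyc = forward three

-- Monochromatic cycles are short

module Monochrome {N : ℕ} (Γ : GapGraph N) where

  open GapGraph Γ
  open Similarity Γ

  Mono : E → Fin N → List (Fin N) → Set
  Mono e a ys = ∀ {f} → f ∈ edges a ys → Sim e f

  record Chord (e : E) (m : ℕ) : Set where
    field
      {a b} : Fin N
      {p q os} : List (Fin N)
      c    : Chain R a p b
      d    : Chain R b q a
      C    : IsCycle R a (p ++ q)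
      mono : Mono e a (p ++ q)
      size : length (p ++ q) ≡ m
      a≢b  : a ≢ b
      o    : Chain R a os b
      o!   : Unique os
      free : ∀ {w} → w ∈ os → w ≡ b ⊎ w ∉ p ++ q
      o-mono : Mono e a os
      <p   : length os < length p
      <q   : length os < length q

  -- A path between two vertices of a cycle that is shorter than both arcs contains a chord
  -- shorter than both of its own arcs: otherwise replacing its excursions by arcs would not lengthen it.
  findChord : ∀ {e} k {a t p q π} → length π ≤ k →
    Chain R a p t → Chain R t q a → IsCycle R a (p ++ q) → Mono e a (p ++ q) →
    Chain R a π t → Unique (a ∷ π) → Mono e a π → length π < length p → length π < length q →
    Chord e (length (p ++ q))
  findChord k {π = []} h c d C mono [] u _ <p <q =
    ⊥-elim (unique-++-disjoint _ (unique C) (closed-end∈ c <p) (closed-end∈ d <q))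
  findChord {e} (suc k) {a} {t} {p} {q} {y ∷ π} (s≤s h) c d C mono (r ∷ ch) u π-mono <p <q =
    go (∈-++⁻ p b∈)
    where
    t∈ : t ∈ p ++ q
    t∈ = ∈-++⁺ˡ (closed-end∈ c (ℕ.≤-trans (s≤s z≤n) <p))
    F = firstHit (_∈? (p ++ q)) ch (Any.map (λ { refl → t∈ }) (end∈ ch))
    b = Split.mid (proj₁ F)
    pre = Split.pre (proj₁ F)
    post = Split.post (proj₁ F)
    π≡ : π ≡ pre ++ post
    π≡ = Split.eq (proj₁ F)
    b∈ : b ∈ p ++ q
    b∈ = proj₁ (proj₂ F)
    ear : Chain R a (y ∷ pre) b
    ear = r ∷ Split.c₁ (proj₁ F)
    rest : Chain R b post t
    rest = Split.c₂ (proj₁ F)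
    u′ : Unique (a ∷ (y ∷ pre) ++ post)
    u′ = subst (λ l → Unique (a ∷ y ∷ l)) π≡ u
    ear! : Unique (y ∷ pre)
    ear! = unique-++⁻ˡ (y ∷ pre) (tail-unique u′)
    a≢b : a ≢ b
    a≢b eq = head∉ u′ (∈-++⁺ˡ (subst (_∈ y ∷ pre) (sym eq) (end∈ (Split.c₁ (proj₁ F)))))
    free : ∀ {w} → w ∈ y ∷ pre → w ≡ b ⊎ w ∉ p ++ q
    free {w} m with ∈-++⁻ (front y pre) (subst (w ∈_) (sym (front-end (Split.c₁ (proj₁ F)))) m)
    ... | inj₁ m₁ = inj₂ (All.lookup (proj₂ (proj₂ F)) m₁)
    ... | inj₂ (here eq) = inj₁ eq
    split-edges : edges a (y ∷ π) ≡ edges a (y ∷ pre) ++ edges b post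
    split-edges = trans (cong (λ l → edges a (y ∷ l)) π≡) (edges-++ post ear)
    ear-mono : Mono e a (y ∷ pre)
    ear-mono {f} m = π-mono (subst (f ∈_) (sym split-edges) (∈-++⁺ˡ m))
    rest-mono : Mono e b post
    rest-mono {f} m = π-mono (subst (f ∈_) (sym split-edges) (∈-++⁺ʳ (edges a (y ∷ pre)) m))
    rest! : Unique (b ∷ post)
    rest! = unique-++⁻ʳ (front a (y ∷ pre)) (subst Unique
      (trans (cong (_++ post) (sym (front-end ear))) (List.++-assoc (front a (y ∷ pre)) [ b ] post)) u′)
    len : length (y ∷ π) ≡ length (y ∷ pre) + length post
    len = cong suc (trans (cong length π≡) (List.length-++ pre))
    ear≤ : length (y ∷ pre) ≤ length (y ∷ π)
    ear≤ = subst (length (y ∷ pre) ≤_) (sym len) (ℕ.m≤m+n _ _)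
    post≤ : length post ≤ length (y ∷ π)
    post≤ = subst (length post ≤_) (sym len) (ℕ.m≤n+m _ _)
    postk : length post ≤ k
    postk = ℕ.≤-trans (ℕ.≤-trans (ℕ.m≤n+m (length post) (length pre))
              (ℕ.≤-reflexive (sym (trans (cong length π≡) (List.length-++ pre))))) h
    shrink : ∀ {x y s z} → s + x < y + z → y ≤ s → x < z
    shrink {x} {y} {s} {z} l le = ℕ.+-cancelˡ-< y x z (ℕ.≤-<-trans (ℕ.+-monoˡ-≤ x le) l)
    go : b ∈ p ⊎ b ∈ q → Chord e (length (p ++ q))
    go (inj₁ b∈p) with split∈ c (there b∈p)
    ... | p₁ , p₂ , refl , e₁ , e₂ with length (y ∷ pre) ℕ.<? length p₁
    ... | yes lt = record
      { c = e₁ ; d = e₂ ++ᶜ d ; C = subst (IsCycle R a) assoc C ; mono = subst (Mono e a) assoc mono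
      ; size = cong length (sym assoc) ; a≢b = a≢b ; o = ear ; o! = ear!
      ; free = λ {w} m → Sum.map₂ (λ ∉C m′ → ∉C (subst (w ∈_) (sym assoc) m′)) (free m) ; o-mono = ear-mono ; <p = lt
      ; <q = ℕ.≤-<-trans ear≤ (ℕ.<-≤-trans <q (subst (length q ≤_) (sym (List.length-++ p₂)) (ℕ.m≤n+m _ _))) }
      where
      assoc : (p₁ ++ p₂) ++ q ≡ p₁ ++ (p₂ ++ q)
      assoc = List.++-assoc p₁ p₂ q
    -- The excursion to `b` is at least as long as `p₁`. Moving the start from `a` to `b` therefore
    -- takes no more from the arc than from the path, which stays shorter than both new arcs `p₂`
    -- and `q ++ p₁`.
    ... | no ¬lt = subst (Chord e) (sym size)
      (findChord k postk e₂ (d ++ᶜ e₁) C′ mono′ rest rest! rest-mono lt₁ lt₂)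
      where
      assoc : (p₁ ++ p₂) ++ q ≡ p₁ ++ (p₂ ++ q)
      assoc = List.++-assoc p₁ p₂ q
      assoc′ : (p₂ ++ q) ++ p₁ ≡ p₂ ++ (q ++ p₁)
      assoc′ = List.++-assoc p₂ q p₁
      C′ : IsCycle R b (p₂ ++ (q ++ p₁))
      C′ = subst (IsCycle R b) assoc′ (rotate e₁ (e₂ ++ᶜ d) (subst (IsCycle R a) assoc C))
      mono′ : Mono e b (p₂ ++ (q ++ p₁))
      mono′ = subst (Mono e b) assoc′
        (λ m → subst (Mono e a) assoc mono (Perm.∈-resp-↭ (rotate-edges e₁ (e₂ ++ᶜ d)) m))
      size : length ((p₁ ++ p₂) ++ q) ≡ length (p₂ ++ (q ++ p₁))
      size = trans (cong length assoc) (trans (length-++-comm p₁ (p₂ ++ q)) (cong length assoc′))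
      lt₁ : length post < length p₂
      lt₁ = shrink (subst₂ _<_ len (List.length-++ p₁) <p) (ℕ.≮⇒≥ ¬lt)
      lt₂ : length post < length (q ++ p₁)
      lt₂ = ℕ.≤-<-trans post≤ (ℕ.<-≤-trans <q (subst (length q ≤_) (sym (List.length-++ q)) (ℕ.m≤m+n _ _)))
    go (inj₂ b∈q) with split∈ d (there b∈q)
    ... | q₁ , q₂ , refl , e₁ , e₂ with length (y ∷ pre) ℕ.<? length q₂
    ... | yes lt = record
      { c = c ++ᶜ e₁ ; d = e₂ ; C = subst (IsCycle R a) assoc C ; mono = subst (Mono e a) assoc mono
      ; size = cong length (sym assoc) ; a≢b = a≢b ; o = ear ; o! = ear!
      ; free = λ {w} m → Sum.map₂ (λ ∉C m′ → ∉C (subst (w ∈_) (sym assoc) m′)) (free m) ; o-mono = ear-mono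
      ; <p = ℕ.≤-<-trans ear≤ (ℕ.<-≤-trans <p (subst (length p ≤_) (sym (List.length-++ p)) (ℕ.m≤m+n _ _)))
      ; <q = lt }
      where
      assoc : p ++ (q₁ ++ q₂) ≡ (p ++ q₁) ++ q₂
      assoc = sym (List.++-assoc p q₁ q₂)
    ... | no ¬lt = subst (Chord e) (sym size)
      (findChord k postk (e₂ ++ᶜ c) e₁ C′ mono′ rest rest! rest-mono lt₁ lt₂)
      where
      assoc : p ++ (q₁ ++ q₂) ≡ (p ++ q₁) ++ q₂
      assoc = sym (List.++-assoc p q₁ q₂)
      assoc′ : q₂ ++ (p ++ q₁) ≡ (q₂ ++ p) ++ q₁
      assoc′ = sym (List.++-assoc q₂ p q₁)
      C′ : IsCycle R b ((q₂ ++ p) ++ q₁)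
      C′ = subst (IsCycle R b) assoc′ (rotate (c ++ᶜ e₁) e₂ (subst (IsCycle R a) assoc C))
      mono′ : Mono e b ((q₂ ++ p) ++ q₁)
      mono′ = subst (Mono e b) assoc′
        (λ m → subst (Mono e a) assoc mono (Perm.∈-resp-↭ (rotate-edges (c ++ᶜ e₁) e₂) m))
      size : length (p ++ (q₁ ++ q₂)) ≡ length ((q₂ ++ p) ++ q₁)
      size = trans (cong length assoc) (trans (length-++-comm (p ++ q₁) q₂) (cong length assoc′))
      lt₂ : length post < length q₁
      lt₂ = shrink (subst₂ _<_ len (trans (List.length-++ q₁) (ℕ.+-comm (length q₁) (length q₂))) <q) (ℕ.≮⇒≥ ¬lt)
      lt₁ : length post < length (q₂ ++ p)
      lt₁ = ℕ.≤-<-trans post≤ (ℕ.<-≤-trans <p (subst (length p ≤_) (sym (List.length-++ q₂)) (ℕ.m≤n+m _ _)))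

  private
    splitAt : ∀ {x ys z} k → Chain R x ys z → k ≤ length ys →
              ∃ λ w → ∃₂ λ p q → ys ≡ p ++ q × length p ≡ k × Chain R x p w × Chain R w q z
    splitAt zero c _ = _ , [] , _ , refl , refl , [] , c
    splitAt (suc k) (r ∷ c) (s≤s h) with splitAt k c h
    ... | w , p , q , refl , l , c₁ , c₂ = w , _ ∷ p , q , refl , cong suc l , r ∷ c₁ , c₂

    -- An arc of a short cycle through `e` and `f` joins their ends, and all its edges are similar
    -- to `e`. If `e ≡ f`, the path is that edge itself.
    shortPath : ∀ {e f a t} → Sim e f → Inc a e → Inc t f → (e ≡ edge a t → R a t) → a ≢ t → (∃₂ λ u v → e ≡ edge u v) →
                ∃ λ π → Chain R a π t × Unique (a ∷ π) × length π < ℓ × (∀ {g} → g ∈ edges a π → Sim e g)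
    shortPath {a = a} {t} (inj₁ refl) ia it rat a≢t (u , v , refl) =
      [ t ] , rat e≡ ∷ [] , cons-unique (λ { (here eq) → a≢t eq }) ([] ∷ []) , ℕ.<-≤-trans (s≤s (s≤s z≤n)) 3≤ℓ ,
      λ { (here eq) → inj₁ (trans e≡ (sym eq)) }
      where
      e≡ : edge u v ≡ edge a t
      e≡ with inc-edge⁻ {u = u} {v} ia | inc-edge⁻ {u = u} {v} it
      ... | inj₁ refl | inj₁ refl = ⊥-elim (a≢t refl)
      ... | inj₁ refl | inj₂ refl = refl
      ... | inj₂ refl | inj₁ refl = edge-comm _ _
      ... | inj₂ refl | inj₂ refl = ⊥-elim (a≢t refl)
    shortPath {e} {f} {a} {t} (inj₂ (b , zs , _ , D , lD , e∈ , f∈)) ia it _ a≢t _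
      with rotateTo D (cycle-∈ D (inc-edges e∈ ia))
    ... | xs , D′ , xs↭zs , es↭
      with split∈ (chain D′) (there (Perm.∈-resp-↭ (↭-sym xs↭zs) (cycle-∈ D (inc-edges f∈ it))))
    ... | p , q , refl , c , d = p , c , cons-unique a∉p (unique-++⁻ˡ p (unique D′)) ,
          ℕ.≤-<-trans (subst (length p ≤_) (sym (List.length-++ p)) (ℕ.m≤m+n _ _)) (subst (_< ℓ) (sym (Perm.↭-length xs↭zs)) lD) ,
          λ {g} m → short D lD e∈ (Perm.∈-resp-↭ es↭ (subst (g ∈_) (sym (edges-++ q c)) (∈-++⁺ˡ m)))
      where
      a∉p : a ∉ p
      a∉p m = unique-++-disjoint p (unique D′) m (end∈′ d (≢-sym a≢t))

    -- The longer arc has at least `ℓ` edges, being half of at least `ℓ + ℓ`. Closing it with the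
    -- chord keeps this bound and saves edges, since the chord is shorter than the arc it replaces.
    shorten : ∀ {e m} → Chord e m → ℓ + ℓ ≤ m →
              ∃₂ λ a ys → IsCycle R a ys × Mono e a ys × length ys < m × ℓ ≤ length ys
    shorten {e} {m} ch ℓ+ℓ≤ = go (ℕ.≤-total (length q) (length p))
      where
      open Chord ch
      module Ear′ = Ear Rsym c d C a≢b o o! free
      total : length p + length q ≡ m
      total = trans (sym (List.length-++ p)) size
      total′ : length q + length p ≡ m
      total′ = trans (ℕ.+-comm (length q) (length p)) total
      half : ∀ {x y} → x + y ≡ m → y ≤ x → ℓ ≤ x
      half {x} {y} eq y≤x = ℕ.≮⇒≥ λ x<ℓ →
        ℕ.<⇒≱ (ℕ.+-mono-<-≤ x<ℓ (ℕ.≤-trans y≤x (ℕ.<⇒≤ x<ℓ))) (subst (ℓ + ℓ ≤_) (sym eq) ℓ+ℓ≤)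
      fits : ∀ {x y o} → x + y ≡ m → o < y → x + o < m
      fits {x} {y} {o} eq o<y = subst (suc (x + o) ≤_) eq (ℕ.+-monoʳ-< x o<y)
      go : length q ≤ length p ⊎ length p ≤ length q →
           ∃₂ λ a ys → IsCycle R a ys × Mono e a ys × length ys < m × ℓ ≤ length ys
      go (inj₁ q≤p) = a , p ++ rev a os , Ear′.backward (ℕ.≤-trans 3≤ℓ ℓ≤) , mono′ ,
                      subst (_< m) (sym len) (fits total <q) , subst (ℓ ≤_) (sym len) ℓ≤
        where
        len : length (p ++ rev a os) ≡ length p + length os
        len = trans (List.length-++ p) (cong (length p +_) (length-rev a os))
        ℓ≤ : ℓ ≤ length p + length os
        ℓ≤ = ℕ.≤-trans (half total q≤p) (ℕ.m≤m+n _ _)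
        mono′ : Mono e a (p ++ rev a os)
        mono′ {f} m with Ear′.backward-edges m
        ... | inj₁ m₁ = mono (subst (f ∈_) (sym (edges-++ q c)) (∈-++⁺ˡ m₁))
        ... | inj₂ m₂ = o-mono m₂
      go (inj₂ p≤q) = a , os ++ q , Ear′.forward (ℕ.≤-trans 3≤ℓ ℓ≤) , mono′ ,
                      subst (_< m) (sym len) (subst (_< m) (ℕ.+-comm (length q) _) (fits total′ <p)) , subst (ℓ ≤_) (sym len) ℓ≤
        where
        len : length (os ++ q) ≡ length os + length q
        len = List.length-++ os
        ℓ≤ : ℓ ≤ length os + length q
        ℓ≤ = ℕ.≤-trans (half total′ p≤q) (ℕ.m≤n+m _ (length os))
        mono′ : Mono e a (os ++ q)
        mono′ {f} m with ∈-++⁻ (edges a os) (subst (f ∈_) Ear′.forward-edges m)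
        ... | inj₁ m₁ = o-mono m₁
        ... | inj₂ m₂ = mono (subst (f ∈_) (sym (edges-++ q c)) (∈-++⁺ʳ (edges a p) m₂))

  -- Descent on the length. By the gap a counterexample has length at least `ℓ + ℓ`, so two of its
  -- vertices have both arcs of length at least `ℓ` between them. Similarity joins them by a shorter
  -- path of the same colour, hence there is a chord, and `shorten` yields a smaller counterexample.
  mono⇒short : ∀ {e} k {a ys} → length ys ≤ k → IsCycle R a ys → Mono e a ys → length ys < ℓ
  mono⇒short zero h C _ = ⊥-elim (ℕ.<⇒≱ (long C) (ℕ.≤-trans h z≤n))
  mono⇒short {e} (suc k) {a} {ys} h C mono with length ys ℕ.<? ℓ + ℓ
  ... | yes lt = gap C lt
  ... | no ¬lt with splitAt ℓ (chain C) (ℕ.≤-trans (ℕ.m≤m+n ℓ ℓ) (ℕ.≮⇒≥ ¬lt))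
  ... | t , p , q , refl , lp , c , d = ⊥-elim contra
    where
    ℓ+ℓ≤ : ℓ + ℓ ≤ length (p ++ q)
    ℓ+ℓ≤ = ℕ.≮⇒≥ ¬lt
    ℓ≤q : ℓ ≤ length q
    ℓ≤q = ℕ.+-cancelˡ-≤ ℓ ℓ (length q) (subst (ℓ + ℓ ≤_) (trans (List.length-++ p) (cong (_+ length q) lp)) ℓ+ℓ≤)
    1≤p : 1 ≤ length p
    1≤p = subst (1 ≤_) (sym lp) (ℕ.≤-trans (s≤s z≤n) 3≤ℓ)
    1≤q : 1 ≤ length q
    1≤q = ℕ.≤-trans (ℕ.≤-trans (s≤s z≤n) 3≤ℓ) ℓ≤q
    a≢t : a ≢ t
    a≢t refl = unique-++-disjoint p (unique C) (closed-end∈ c 1≤p) (closed-end∈ d 1≤q)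
    E₁ = ∈⇒inc c 1≤p (here refl)
    E₂ = ∈⇒inc c 1≤p (end∈ c)
    inC : ∀ {g} → g ∈ edges a p → g ∈ edges a (p ++ q)
    inC {g} m = subst (g ∈_) (sym (edges-++ q c)) (∈-++⁺ˡ m)
    ends : ∀ {g} → g ∈ edges a p → ∃₂ λ u v → g ≡ edge u v
    ends m with edgeSplit c m
    ... | u , v , _ , _ , _ , _ , _ , _ , eq = u , v , eq
    S = shortPath (sim-trans (sim-sym (mono (inC (proj₁ (proj₂ E₁))))) (mono (inC (proj₁ (proj₂ E₂)))))
          (proj₂ (proj₂ E₁)) (proj₂ (proj₂ E₂))
          (λ eq → edge∈⇒R Rsym c (subst (_∈ edges a p) eq (proj₁ (proj₂ E₁)))) a≢t (ends (proj₁ (proj₂ E₁)))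
    π-short = proj₁ (proj₂ (proj₂ (proj₂ S)))
    ch : Chord e (length (p ++ q))
    ch = findChord _ ℕ.≤-refl c d C mono (proj₁ (proj₂ S)) (proj₁ (proj₂ (proj₂ S)))
           (λ m → sim-trans (mono (inC (proj₁ (proj₂ E₁)))) (proj₂ (proj₂ (proj₂ (proj₂ S))) m))
           (subst (length (proj₁ S) <_) (sym lp) π-short) (ℕ.<-≤-trans π-short ℓ≤q)
    contra : ⊥
    contra with shorten ch ℓ+ℓ≤
    ... | b , zs , D , D-mono , lt , ℓ≤ = ℕ.<⇒≱ (mono⇒short k (ℕ.≤-pred (ℕ.≤-trans lt h)) D D-mono) ℓ≤

-- Graphs given by edge lists; walks forced by degree two

Joined : List (Fin N × Fin N) → Fin N → Fin N → Set
Joined E u v = edge u v ∈ E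

joined-sym : ∀ {E} {u v : Fin N} → Joined E u v → Joined E v u
joined-sym {E = E} {u} {v} = subst (_∈ E) (edge-comm u v)

joined? : ∀ E (u v : Fin N) → Dec (Joined E u v)
joined? E u v = edge u v ∈ₑ? E

deg : List (Fin N × Fin N) → Fin N → ℕ
deg E v = length (filter (Inc? v) E)

deg-++ : ∀ E E′ (v : Fin N) → deg (E ++ E′) v ≡ deg E v + deg E′ v
deg-++ E E′ v = trans (cong length (List.filter-++ (Inc? v) E E′)) (List.length-++ (filter (Inc? v) E))

deg-none : ∀ E {v : Fin N} → (∀ {e} → e ∈ E → ¬ Inc v e) → deg E v ≡ 0
deg-none E {v} f = cong length (List.filter-none (Inc? v) (All.tabulate f))

deg-∷-inc : ∀ {e E} {v : Fin N} → Inc v e → deg (e ∷ E) v ≡ suc (deg E v)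
deg-∷-inc {v = v} i = cong length (List.filter-accept (Inc? v) i)

deg-∷-¬inc : ∀ {e E} {v : Fin N} → ¬ Inc v e → deg (e ∷ E) v ≡ deg E v
deg-∷-¬inc {v = v} i = cong length (List.filter-reject (Inc? v) i)

deg-∷≤ : ∀ e E (v : Fin N) → deg (e ∷ E) v ≤ suc (deg E v)
deg-∷≤ e E v with Inc? v e
... | yes i = ℕ.≤-reflexive (deg-∷-inc {E = E} i)
... | no i = ℕ.≤-trans (ℕ.≤-reflexive (deg-∷-¬inc {E = E} i)) (ℕ.n≤1+n _)

nbrs-length : ∀ {E} {v : Fin N} {ws} → Unique ws → (∀ {w} → w ∈ ws → Joined E v w) → length ws ≤ deg E v
nbrs-length {E = E} {v} {ws} u f = subst (_≤ deg E v) (List.length-map (edge v) ws)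
  (unique-⊆-length (Unique.map⁺ edge-injʳ u) λ m → case ∈-map⁻ (edge v) m of λ
    { (w , w∈ , refl) → ∈-filter⁺ (Inc? v) (f w∈) inc-edgeˡ })

two-nbrs : ∀ {E} {v a b w : Fin N} → deg E v ≤ 2 → Joined E v a → Joined E v b → a ≢ b → Joined E v w → w ≡ a ⊎ w ≡ b
two-nbrs {E = E} {v} {a} {b} {w} d ja jb a≢b jw with w Fin.≟ a | w Fin.≟ b
... | yes p | _ = inj₁ p
... | _ | yes q = inj₂ q
... | no p | no q = ⊥-elim (ℕ.<⇒≱ (s≤s d) (nbrs-length {ws = w ∷ a ∷ b ∷ []}
        ((p ∷ q ∷ []) ∷ (a≢b ∷ []) ∷ [] ∷ [])
        λ { (here refl) → jw ; (there (here refl)) → ja ; (there (there (here refl))) → jb }))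

-- Missing neighbours are replaced by defaults: `v` if there is none, a repetition if there is only
-- one.
some-two-nbrs : ∀ {E} {v : Fin N} → deg E v ≤ 2 → ∃₂ λ a b → ∀ {w} → Joined E v w → w ≡ a ⊎ w ≡ b
some-two-nbrs {E = E} {v} d with Fin.any? (joined? E v)
... | no ¬j = v , v , λ j → ⊥-elim (¬j (_ , j))
... | yes (a , ja) with Fin.any? (λ b → joined? E v b ×-dec ¬? (a Fin.≟ b))
... | no ¬j = a , a , λ {w} j → case a Fin.≟ w of λ { (yes p) → inj₁ (sym p) ; (no q) → ⊥-elim (¬j (w , j , q)) }
... | yes (b , jb , a≢b) = a , b , two-nbrs d ja jb a≢b

edges-vertex : ∀ {E} {x z w : Fin N} {ys} → Chain (Joined E) x ys z → w ∈ ys → ∃ λ e → e ∈ E × Inc w e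
edges-vertex {x = x} {ys = y ∷ _} (j ∷ c) (here refl) = edge x y , j , inc-edgeʳ {u = x}
edges-vertex (j ∷ c) (there m) = edges-vertex c m

module _ {R : Fin N → Fin N → Set} where

  path-deg-outside : ∀ {x ys z w} → Chain R x ys z → w ∉ x ∷ ys → deg (edges x ys) w ≡ 0
  path-deg-outside {x} {ys} c w∉ = deg-none (edges x ys) (λ m i → w∉ (inc-edges m i))

  path-deg-start : ∀ {x ys z} → Chain R x ys z → Unique (x ∷ ys) → deg (edges x ys) x ≤ 1
  path-deg-start [] u = z≤n
  path-deg-start {x} {y ∷ ys} (r ∷ c) u =
    ℕ.≤-trans (deg-∷≤ (edge x y) (edges y ys) x) (s≤s (ℕ.≤-reflexive (path-deg-outside c (head∉ u))))

  path-deg-end : ∀ {x ys z} → Chain R x ys z → Unique (x ∷ ys) → deg (edges x ys) z ≤ 1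
  path-deg-end [] u = z≤n
  path-deg-end {x} {y ∷ []} (r ∷ []) u = deg-∷≤ (edge x y) [] y
  path-deg-end {x} {y ∷ ys@(_ ∷ _)} {z} (r ∷ c@(_ ∷ _)) u =
    subst (_≤ 1) (sym (deg-∷-¬inc {E = edges y ys} ¬i)) (path-deg-end c (tail-unique u))
    where
    ¬i : ¬ Inc z (edge x y)
    ¬i i with inc-edge⁻ {u = x} {y} i
    ... | inj₁ refl = head∉ u (end∈ c)
    ... | inj₂ refl = head∉ (tail-unique u) (closed-end∈ c (s≤s z≤n))

  path-deg≤2 : ∀ {x ys z} → Chain R x ys z → Unique (x ∷ ys) → ∀ w → deg (edges x ys) w ≤ 2
  path-deg≤2 [] u w = z≤n
  path-deg≤2 {x} {y ∷ ys} (r ∷ c) u w with Inc? w (edge x y)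
  ... | no ¬i = subst (_≤ 2) (sym (deg-∷-¬inc {E = edges y ys} ¬i)) (path-deg≤2 c (tail-unique u) w)
  ... | yes i with inc-edge⁻ {u = x} {y} i
  ...   | inj₁ refl = ℕ.≤-trans (deg-∷≤ (edge x y) (edges y ys) w) (s≤s (ℕ.≤-trans (ℕ.≤-reflexive (path-deg-outside c (head∉ u))) z≤n))
  ...   | inj₂ refl = ℕ.≤-trans (deg-∷≤ (edge x y) (edges y ys) w) (s≤s (path-deg-start c (tail-unique u)))

  path-edges-unique : ∀ {x ys z} → Chain R x ys z → Unique (x ∷ ys) → Unique (edges x ys)
  path-edges-unique [] u = []
  path-edges-unique {x} (r ∷ c) u =
    cons-unique (λ m → head∉ u (inc-edges m inc-edgeˡ)) (path-edges-unique c (tail-unique u))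

  cycle-deg≤2 : ∀ {a ys} → IsCycle R a ys → ∀ w → deg (edges a ys) w ≤ 2
  cycle-deg≤2 {a} {y ∷ ys} (cycle (r ∷ c) u l) w with Inc? w (edge a y)
  ... | no ¬i = subst (_≤ 2) (sym (deg-∷-¬inc {E = edges y ys} ¬i)) (path-deg≤2 c u w)
  ... | yes i with inc-edge⁻ {u = a} {y} i
  ...   | inj₁ refl = ℕ.≤-trans (deg-∷≤ (edge a y) (edges y ys) w) (s≤s (path-deg-end c u))
  ...   | inj₂ refl = ℕ.≤-trans (deg-∷≤ (edge a y) (edges y ys) w) (s≤s (path-deg-start c u))

  cycle-edges-unique : ∀ {a ys} → IsCycle R a ys → Unique (edges a ys)
  cycle-edges-unique {a} {y ∷ ys} (cycle (r ∷ c) u l) = cons-unique (fresh c u l) (path-edges-unique c u)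
    where
    fresh : ∀ {y ys} → Chain R y ys a → Unique (y ∷ ys) → 3 ≤ suc (length ys) → edge a y ∉ edges y ys
    fresh [] u (s≤s ())
    fresh {y} {z ∷ []} (_ ∷ []) u (s≤s (s≤s ()))
    fresh {y} {z ∷ ys@(_ ∷ _)} (_ ∷ c) u l (here eq) with edge-inj eq
    ... | inj₁ (refl , refl) = head∉ u (here refl)
    ... | inj₂ (refl , _) = head∉ (tail-unique u) (closed-end∈ c (s≤s z≤n))
    fresh {y} {z ∷ ys@(_ ∷ _)} (_ ∷ c) u l (there m) = head∉ u (inc-edges m (inc-edgeʳ {u = a}))

  lastEdge : ∀ {x y ys z} → Chain R x (y ∷ ys) z → ∃ λ p → p ∈ front x (y ∷ ys) × edge p z ∈ edges x (y ∷ ys) × R p z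
  lastEdge {x} {y} {[]} (r ∷ []) = x , here refl , here refl , r
  lastEdge {x} {y} {_ ∷ _} (r ∷ c) with lastEdge c
  ... | p , m , e , r′ = p , there m , there e , r′

  -- A path through vertices of degree two as a walker sees it: coming from `x`, the next vertex is
  -- always the only alternative to going back.
  data Forced : Fin N → Fin N → List (Fin N) → Set where
    []  : ∀ {x y} → Forced x y []
    _∷_ : ∀ {x y q qs} → (∀ {w} → R y w → w ≡ x ⊎ w ≡ q) → Forced y q qs → Forced x y (q ∷ qs)

  data NonBacktracking : Fin N → Fin N → List (Fin N) → Set where
    []  : ∀ {x y} → NonBacktracking x y []
    _∷_ : ∀ {x y w ds} → w ≢ x → NonBacktracking y w ds → NonBacktracking x y (w ∷ ds)

  nb-path : ∀ {x y ds} → Unique (x ∷ y ∷ ds) → NonBacktracking x y ds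
  nb-path {ds = []} u = []
  nb-path {ds = w ∷ ds} u = (λ { refl → head∉ u (there (here refl)) }) ∷ nb-path (tail-unique u)

  nb-cycle : ∀ {a y ds} → IsCycle R a (y ∷ ds) → NonBacktracking a y ds
  nb-cycle {ds = []} C = []
  nb-cycle {a} {y} {w ∷ []} (cycle _ _ (s≤s (s≤s ())))
  nb-cycle {a} {y} {w ∷ ds@(_ ∷ _)} (cycle (_ ∷ _ ∷ c) u l) =
    (λ { refl → head∉ (tail-unique u) (closed-end∈ c (s≤s z≤n)) }) ∷ nb-path u

  -- Unable to turn back, the walk has to copy `qs`; it gets as far as `v` or stops on the way.
  follow : ∀ {x y qs v ds z} {Q : Fin N → Fin N → Set} → Forced x y qs → Chain Q y qs v → Chain R y ds z → NonBacktracking x y ds →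
           (∃ λ es → ds ≡ qs ++ es × Chain R v es z) ⊎ z ∈ front y qs
  follow [] [] c nb = inj₁ (_ , refl , c)
  follow (_ ∷ _) (_ ∷ _) [] nb = inj₂ (here refl)
  follow (f ∷ fs) (_ ∷ qc) (r ∷ c) (w≢x ∷ nb) with f r
  ... | inj₁ eq = ⊥-elim (w≢x eq)
  ... | inj₂ refl with follow fs qc c nb
  ...   | inj₁ (es , refl , c′) = inj₁ (es , refl , c′)
  ...   | inj₂ m = inj₂ (there m)

-- F is the edge list of a subcubic graph on S, obtained from c disjoint cycles by adding e ears; B lists the ends
-- of the ears. Every component of F − B contains a vertex of Reps, so that Reps bounds the number of components.
record State {N} (Γ : GapGraph N) (e c : ℕ) : Set where
  open GapGraph Γ
  field
    F         : List (Fin N × Fin N)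
    S B Reps  : List (Fin N)
    F⊆R       : ∀ {u v} → Joined F u v → R u v
    F-edges   : ∀ {f} → f ∈ F → ∃₂ λ u v → f ≡ edge u v
    F-ends    : ∀ {f w} → f ∈ F → Inc w f → w ∈ S
    F!        : Unique F
    S!        : Unique S
    size      : length F ≡ length S + e
    B-size    : length B ≡ e + e
    deg≤3     : ∀ v → deg F v ≤ 3
    deg≤2     : ∀ {v} → v ∉ B → deg F v ≤ 2
    noShort   : ∀ {a ys} → IsCycle (Joined F) a ys → ℓ ≤ length ys
    Reps-size : length Reps ≤ (e + e + e) + c
    rep       : ∀ {v} → v ∈ S → v ∉ B →
                ∃₂ λ ρ ys → ρ ∈ Reps × Chain (λ u w → Joined F u w × u ∉ B × w ∉ B) v ys ρ
    B⊆S       : B ⊆ S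

-- Open ears and monochromatic links

module Ears {N} {Γ : GapGraph N} {e c : ℕ} (St : State Γ e c) where
  open GapGraph Γ
  open Similarity Γ
  open Monochrome Γ
  open State St

  Free : Fin N → Fin N → Set
  Free u w = Joined F u w × u ∉ B × w ∉ B

  -- Ends outside `B` have degree at most two in `F`, so adding the ear keeps `F` subcubic.
  record OpenEar (u : Fin N) (os : List (Fin N)) (v : Fin N) : Set where
    field
      path     : Chain R u os v
      u∈S      : u ∈ S
      u∉B      : u ∉ B
      v∈S      : v ∈ S
      v∉B      : v ∉ B
      u≢v      : u ≢ v
      path!    : Unique (u ∷ os)
      interior : ∀ {w} → w ∈ os → w ≡ v ⊎ w ∉ S
      new      : ∀ {f} → f ∈ edges u os → f ∉ F

  -- The only obstacle to adding an ear: with this path of `F` it would close a cycle shorter than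
  -- `ℓ`. `Stuck` says that every candidate is blocked in this way.
  ShortBypass : Fin N → List (Fin N) → Fin N → Set
  ShortBypass u os v = ∃ λ qs → Chain (Joined F) u qs v × Unique (u ∷ qs) × length os + length qs < ℓ

  Stuck : Set
  Stuck = ∀ {u os v} → OpenEar u os v → ShortBypass u os v

  joined⇒R : ∀ {x ys z} → Chain (Joined F) x ys z → Chain R x ys z
  joined⇒R c = chain-map c (λ j _ → F⊆R j)

  chain⊆S : ∀ {x ys z w} → Chain (Joined F) x ys z → w ∈ ys → w ∈ S
  chain⊆S c m with edges-vertex c m
  ... | e , e∈ , i = F-ends e∈ i

  -- Both ends of an edge of `F` lie in `S`, and the interior of the ear does not meet `S`, so such
  -- an edge must run from end to end.
  ear-single : ∀ {u os v f} → Chain R u os v → Unique (u ∷ os) → u ≢ v → (∀ {w} → w ∈ os → w ≡ v ⊎ w ∉ S) →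
               f ∈ edges u os → f ∈ F → os ≡ [ v ] × f ≡ edge u v
  ear-single {u} {os} {v} c u! u≢v int f∈ f∈F with edgeSplit c f∈
  ... | x , y , p , q , refl , c₁ , r , c₂ , refl = go p q c₁ c₂ u! (int′ (∈-++⁺ʳ p (here refl)) y∈S) int
    where
    x∈S : x ∈ S
    x∈S = F-ends f∈F inc-edgeˡ
    y∈S : y ∈ S
    y∈S = F-ends f∈F (inc-edgeʳ {u = x})
    int′ : ∀ {w} → w ∈ p ++ y ∷ q → w ∈ S → w ≡ v
    int′ m w∈S = [ id , (λ ∉S → ⊥-elim (∉S w∈S)) ]′ (int m)
    go : ∀ p q → Chain R u p x → Chain R y q v → Unique (u ∷ p ++ y ∷ q) → y ≡ v →
         (∀ {w} → w ∈ p ++ y ∷ q → w ≡ v ⊎ w ∉ S) → p ++ y ∷ q ≡ [ v ] × edge x y ≡ edge u v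
    go [] [] [] _ u! refl _ = refl , refl
    go [] (_ ∷ _) [] c₂ u! refl _ = ⊥-elim (head∉ (tail-unique u!) (closed-end∈ c₂ (s≤s z≤n)))
    go p@(_ ∷ _) q c₁ c₂ u! refl int with int (∈-++⁺ˡ (closed-end∈ c₁ (s≤s z≤n)))
    ... | inj₁ refl = ⊥-elim (Rirr r refl)
    ... | inj₂ ∉S = ⊥-elim (∉S x∈S)

  PairSim : List E → Set
  PairSim es = ∀ {f g} → f ∈ es → g ∈ es → Sim f g

  pairSim-⊆ : ∀ {es fs} → es ⊆ fs → PairSim fs → PairSim es
  pairSim-⊆ s p m m′ = p (s m) (s m′)

  -- The shadow in `F` of a path of the host graph with edges `es`: a path of `F` with the same ends
  -- and the same colour. Links make it possible to trace a cycle of the host inside `F`, where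
  -- degrees are small.
  Link : List E → Fin N → Fin N → Set
  Link es s t = ∃ λ qs → Chain (Joined F) s qs t × Unique (s ∷ qs) × PairSim (es ++ edges s qs)

  link-rev : ∀ {es s t} → Link es s t → Link es t s
  link-rev {es} {s} {t} (qs , c , u , p) = rev s qs , chain-rev (joined-sym {E = F}) c , rev-unique c u ,
    pairSim-⊆ (λ m → [ ∈-++⁺ˡ , (λ m₂ → ∈-++⁺ʳ es (Perm.∈-resp-↭ (rev-edges↭ (joined-sym {E = F}) c) m₂)) ]′ (∈-++⁻ es m)) p

  module _ (stuck : Stuck) where

    -- The ear and its bypass form a cycle shorter than `ℓ`, and all edges of such a cycle are
    -- similar.
    ear-link : ∀ {u os v} → OpenEar u os v → Link (edges u os) u v
    ear-link {u} {os} {v} H with stuck H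
    ... | qs , c , u! , lt = qs , c , u! , λ m m′ → short cyc lt′ (onCycle m) (onCycle m′)
      where
      open OpenEar H
      c′ : Chain R v (rev u qs) u
      c′ = chain-rev Rsym (joined⇒R c)
      v∉rev : v ∉ rev u qs
      v∉rev = head∉ (rev-unique c u!)
      rev⊆S : ∀ {w} → w ∈ rev u qs → w ∈ S
      rev⊆S m with rev-∈ c (there m)
      ... | here refl = u∈S
      ... | there m′ = chain⊆S c m′
      disj : ∀ {w} → w ∈ os → w ∉ rev u qs
      disj m m′ with interior m
      ... | inj₁ refl = v∉rev m′
      ... | inj₂ ∉S = ∉S (rev⊆S m′)
      edges-rev : edges v (rev u qs) ↭ edges u qs
      edges-rev = rev-edges↭ (joined-sym {E = F}) c
      old : ∀ {f} → f ∈ edges u qs → f ∈ F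
      old m with edgeSplit c m
      ... | _ , _ , _ , _ , _ , _ , j , _ , refl = j
      1≤ : ∀ {x l z} → Chain R x l z → x ≢ z → 1 ≤ length l
      1≤ [] x≢x = ⊥-elim (x≢x refl)
      1≤ (_ ∷ _) _ = s≤s z≤n
      three : 3 ≤ length os + length (rev u qs)
      three with lastEdge′ path u≢v
        where
        lastEdge′ : ∀ {x l z} → Chain R x l z → x ≢ z → ∃ λ f → f ∈ edges x l
        lastEdge′ [] x≢x = ⊥-elim (x≢x refl)
        lastEdge′ (_ ∷ _) _ = _ , here refl
      ... | f , f∈ = two-arcs-length path c′ f∈ (λ m → new f∈ (old (Perm.∈-resp-↭ edges-rev m))) (1≤ c′ (≢-sym u≢v))
      cyc : IsCycle R u (os ++ rev u qs)
      cyc = cycle (path ++ᶜ c′) (unique-++⁺ (tail-unique path!) (tail-unique (rev-unique c u!)) disj)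
              (subst (3 ≤_) (sym (List.length-++ os)) three)
      lt′ : length (os ++ rev u qs) < ℓ
      lt′ = subst (_< ℓ) (sym (trans (List.length-++ os) (cong (length os +_) (length-rev u qs)))) lt
      onCycle : ∀ {f} → f ∈ edges u os ++ edges u qs → f ∈ edges u (os ++ rev u qs)
      onCycle {f} m = subst (f ∈_) (sym (edges-++ (rev u qs) path))
        ([ ∈-++⁺ˡ , (λ m₂ → ∈-++⁺ʳ (edges u os) (Perm.∈-resp-↭ (↭-sym edges-rev) m₂)) ]′ (∈-++⁻ (edges u os) m))

    mkLink : ∀ {u os v} → Chain R u os v → u ∈ S → u ∉ B → v ∈ S → v ∉ B → u ≢ v → Unique (u ∷ os) →
             (∀ {w} → w ∈ os → w ≡ v ⊎ w ∉ S) → Link (edges u os) u v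
    mkLink {u} {os} {v} c u∈S u∉B v∈S v∉B u≢v u! int with Any.any? (_∈ₑ? F) (edges u os)
    ... | no none = ear-link (record { path = c ; u∈S = u∈S ; u∉B = u∉B ; v∈S = v∈S ; v∉B = v∉B ; u≢v = u≢v
            ; path! = u! ; interior = int ; new = λ m m′ → none (Any.map (λ { refl → m′ }) m) })
    ... | yes some with find some
    ... | f , f∈ , f∈F with ear-single c u! u≢v int f∈ f∈F
    ... | refl , refl = [ v ] , f∈F ∷ [] , u! ,
      λ m m′ → inj₁ (trans (only m) (sym (only m′)))
      where
      only : ∀ {g} → g ∈ edge u v ∷ edge u v ∷ [] → g ≡ edge u v
      only (here eq) = eq
      only (there (here eq)) = eq

    SpecialCycle : Fin N → List (Fin N) → Set
    SpecialCycle z ys = IsCycle R z ys × ℓ ≤ length ys × All (λ w → w ≡ z ⊎ w ∉ S) ys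

    -- If two special cycles met, both arcs of the first would extend to ears ending with the same edge,
    -- so the first cycle would be monochromatic.
    special-disjoint : ∀ {z ys z′ zs w} → SpecialCycle z ys → z ∈ S → z ∉ B → SpecialCycle z′ zs → z′ ∈ S → z′ ∉ B →
                       z ≢ z′ → w ∈ ys → w ∉ zs
    special-disjoint {z} {ys} {z′} {zs} {w₀} (C , ℓ≤ , Cfree) z∈S z∉B (D , _ , Dfree) z′∈S z′∉B z≢z′ w∈ys w∈zs
      with firstHit (_∈? ys) (chain D) (Any.map (λ { refl → w∈ys }) (there w∈zs))
    ... | split w pre post refl δ δ′ , w∈C , al with split∈ (chain C) (there w∈C)
    ... | p , q , refl , c , d = ℕ.<⇒≱ (mono⇒short _ ℕ.≤-refl C mono) ℓ≤
      where
      Cf : ∀ {x} → x ∈ p ++ q → x ≡ z ⊎ x ∉ S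
      Cf = All.lookup Cfree
      Df : ∀ {x} → x ∈ pre ++ post → x ≡ z′ ⊎ x ∉ S
      Df = All.lookup Dfree
      z∉D : z ∉ pre ++ post
      z∉D m = [ z≢z′ , (λ ∉S → ∉S z∈S) ]′ (Df m)
      z′∉C : z′ ∉ p ++ q
      z′∉C m = [ (λ eq → z≢z′ (sym eq)) , (λ ∉S → ∉S z′∈S) ]′ (Cf m)
      w≢z′ : w ≢ z′
      w≢z′ refl = z′∉C w∈C
      w∈pre : w ∈ pre
      w∈pre = end∈′ δ (≢-sym w≢z′)
      w≢z : w ≢ z
      w≢z refl = z∉D (∈-++⁺ˡ w∈pre)
      z′∈post : z′ ∈ post
      z′∈post = end∈′ δ′ w≢z′
      pre! : Unique (z′ ∷ pre)
      pre! = cons-unique (λ m → unique-++-disjoint pre (unique D) m z′∈post) (unique-++⁻ˡ pre (unique D))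
      rs = rev z′ pre
      δr : Chain R w rs z′
      δr = chain-rev Rsym δ
      rs-out : ∀ {x} → x ∈ rs → x ∉ p ++ q
      rs-out m = All.lookup al (Perm.∈-resp-↭ (rev↭front z′ pre) m)
      rs-int : ∀ {x} → x ∈ rs → x ≡ z′ ⊎ x ∉ S
      rs-int m with rev-∈ δ (there m)
      ... | here refl = inj₁ refl
      ... | there m′ = Df (∈-++⁺ˡ m′)
      rs! : Unique rs
      rs! = tail-unique (rev-unique δ pre!)
      lastE : ∃ λ g → g ∈ edges w rs
      lastE with rs | δr
      ... | [] | [] = ⊥-elim (w≢z′ refl)
      ... | _ ∷ _ | _ = _ , here refl
      g = proj₁ lastE
      arc : ∀ {l} → Chain R z l w → Unique (z ∷ l) → l ⊆ p ++ q → ∀ {f} → f ∈ edges z l → Sim g f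
      arc {l} cl l! l⊆ {f} f∈ = proj₂ (proj₂ (proj₂ lk)) (inl (∈-++⁺ʳ (edges z l) (proj₂ lastE))) (inl (∈-++⁺ˡ f∈))
        where
        z∉ : z ∉ l ++ rs
        z∉ m with ∈-++⁻ l m
        ... | inj₁ m₁ = head∉ l! m₁
        ... | inj₂ m₂ = rs-out m₂ (base∈ C)
        lk : Link (edges z (l ++ rs)) z z′
        lk = mkLink (cl ++ᶜ δr) z∈S z∉B z′∈S z′∉B z≢z′
          (cons-unique z∉ (unique-++⁺ (tail-unique l!) rs! (λ m m′ → rs-out m′ (l⊆ m))))
          (λ {x} m → [ (λ m₁ → [ (λ { refl → ⊥-elim (head∉ l! m₁) }) , inj₂ ]′ (Cf (l⊆ m₁))) , rs-int ]′ (∈-++⁻ l m))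
        inl : ∀ {h} → h ∈ edges z l ++ edges w rs → h ∈ edges z (l ++ rs) ++ edges z (proj₁ lk)
        inl {h} m = ∈-++⁺ˡ (subst (h ∈_) (sym (edges-++ rs cl)) m)
      z∈q : z ∈ q
      z∈q = end∈′ d w≢z
      p! : Unique (z ∷ p)
      p! = cons-unique (λ m → unique-++-disjoint p (unique C) m z∈q) (unique-++⁻ˡ p (unique C))
      w∈p : w ∈ p
      w∈p = end∈′ c (≢-sym w≢z)
      q! : Unique (w ∷ q)
      q! = cons-unique (λ m → unique-++-disjoint p (unique C) w∈p m) (unique-++⁻ʳ p (unique C))
      revq⊆ : rev w q ⊆ p ++ q
      revq⊆ m with rev-∈ d (there m)
      ... | here refl = w∈C
      ... | there m′ = ∈-++⁺ʳ p m′
      mono : Mono g z (p ++ q)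
      mono {f} m with ∈-++⁻ (edges z p) (subst (f ∈_) (edges-++ q c) m)
      ... | inj₁ m₁ = arc c p! ∈-++⁺ˡ m₁
      ... | inj₂ m₂ = arc (chain-rev Rsym d) (rev-unique d q!) revq⊆ (Perm.∈-resp-↭ (↭-sym (rev-edges↭ Rsym d)) m₂)

-- Turns, and the traps between them

module Turns {N} {Γ : GapGraph N} {e c : ℕ} (St : State Γ e c) where
  open GapGraph Γ
  open Similarity Γ
  open Monochrome Γ
  open State St
  open Ears St

  Turn : Fin N → Set
  Turn x = ∃₂ λ p q → Joined F x p × Joined F x q × ¬ Sim (edge x p) (edge x q)

  turn? : ∀ x → Dec (Turn x)
  turn? x = Fin.any? λ p → Fin.any? λ q →
    joined? F x p ×-dec (joined? F x q ×-dec ¬? (Sim? (edge x p) (edge x q)))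

  -- Outside `B` the two dissimilar edges are all the edges of `F` at `x`, so no monochromatic path
  -- of `F` passes through a turn.
  turn-blocks : ∀ {x a b} → Turn x → x ∉ B → Joined F x a → Joined F x b → a ≢ b → ¬ Sim (edge x a) (edge x b)
  turn-blocks {x} {a} {b} (p , q , jp , jq , ¬s) x∉B ja jb a≢b s
    with two-nbrs {E = F} (deg≤2 x∉B) ja jb a≢b jp | two-nbrs {E = F} (deg≤2 x∉B) ja jb a≢b jq
  ... | inj₁ refl | inj₁ refl = ¬s (inj₁ refl)
  ... | inj₁ refl | inj₂ refl = ¬s s
  ... | inj₂ refl | inj₁ refl = ¬s (sim-sym s)
  ... | inj₂ refl | inj₂ refl = ¬s (inj₁ refl)

  free-sym : ∀ {u v} → Free u v → Free v u
  free-sym (j , p , q) = joined-sym {E = F} j , q , p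

  free⇒joined : ∀ {x ys z} → Chain Free x ys z → Chain (Joined F) x ys z
  free⇒joined c = chain-map c (λ (j , _) _ → j)

  free-forced : ∀ {x b qs y} → Chain Free x (b ∷ qs) y → Unique (x ∷ b ∷ qs) → Forced {R = Joined F} x b qs
  free-forced ((j , _ , b∉B) ∷ []) u = []
  free-forced ((j , _ , b∉B) ∷ (r@(j′ , _) ∷ c)) u =
    (λ jw → two-nbrs {E = F} (deg≤2 b∉B) (joined-sym {E = F} j) j′ (λ { refl → head∉ u (there (here refl)) }) jw)
    ∷ free-forced (r ∷ c) (tail-unique u)

  -- The monochromatic path starts along `path`, whose inner vertices have degree two, and so has to
  -- follow it; it cannot continue through the turn `t`.
  run : ∀ {s b qs t ds s′} → Chain Free s (b ∷ qs) t → Unique (s ∷ b ∷ qs) → Turn t → t ∉ B →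
        Chain (Joined F) s (b ∷ ds) s′ → Unique (s ∷ b ∷ ds) → PairSim (edges s (b ∷ ds)) →
        s′ ∈ front b qs ⊎ (s′ ≡ t × edges s (b ∷ qs) ⊆ edges s (b ∷ ds))
  run {s} {b} {qs} {t} {ds} path@(_ ∷ path′) u turn t∉B (j ∷ ch) u′ sims with follow (free-forced path u) path′ ch (nb-path u′)
  ... | inj₂ m = inj₁ m
  ... | inj₁ ([] , refl , []) = inj₂ (refl , λ {x} m → subst (λ l → x ∈ edges s (b ∷ l)) (sym (List.++-identityʳ qs)) m)
  ... | inj₁ (z ∷ es , refl , jz ∷ _) with lastEdge (free⇒joined path)
  ...   | p , p∈ , e∈ , jp = ⊥-elim (turn-blocks turn t∉B (joined-sym {E = F} jp) jz p≢z
            (sims (on (inj₁ (subst (_∈ edges s (b ∷ qs)) (edge-comm p t) e∈))) (on (inj₂ (here refl)))))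
    where
    p≢z : p ≢ z
    p≢z refl = unique-++-disjoint (s ∷ b ∷ qs) u′ (front⊆ path p∈) (here refl)
    on : ∀ {f} → f ∈ edges s (b ∷ qs) ⊎ f ∈ edges t (z ∷ es) → f ∈ edges s (b ∷ qs ++ z ∷ es)
    on {f} m = subst (f ∈_) (sym (edges-++ (z ∷ es) path)) ([ ∈-++⁺ˡ , ∈-++⁺ʳ (edges s (b ∷ qs)) ]′ m)

  start∉B : ∀ {x y ys w} → Chain Free x (y ∷ ys) w → x ∉ B
  start∉B ((_ , p , _) ∷ _) = p

  end∉B : ∀ {x y ys w} → Chain Free x (y ∷ ys) w → w ∉ B
  end∉B ((_ , _ , q) ∷ []) = q
  end∉B (_ ∷ c@(_ ∷ _)) = end∉B c

  -- From `s` a path of `F` can set out only towards `y` or towards `v`, and `run` applies in either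
  -- direction. The only exit other than `y` is `v`, reached over the edge from `k₁`.
  step-inside : ∀ {v k₁ κ y s t qs} → Chain Free v (k₁ ∷ κ) y → Unique (v ∷ k₁ ∷ κ) → Turn v → Turn y →
                s ∈ front k₁ κ → Chain (Joined F) s qs t → Unique (s ∷ qs) → PairSim (edges s qs) →
                s ≢ t → t ≢ y → t ∈ front k₁ κ ⊎ (t ≡ v × edge v k₁ ∈ edges s qs)
  step-inside _ _ _ _ s∈ [] u sims s≢t t≢y = ⊥-elim (s≢t refl)
  step-inside {v} {k₁} {y = y} {s} {t} path@(k-edge ∷ path′) path! v-turn y-turn s∈ ch@(_∷_ {y = x} {ys = ds} jx _) u sims s≢t t≢y
    with split∈ path′ (front⊆ path′ s∈)
  ... | p , q , refl , c₁ , c₂ = go q c₂ path! (s≢y q c₂)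
    where
    fwd-path : Chain Free v (k₁ ∷ p) s
    fwd-path = k-edge ∷ c₁
    v∉B = start∉B path
    y∉B = end∉B path
    s≢y : ∀ q → Chain Free s q y → s ≢ y
    s≢y q c₂ refl = end∉front path′ (tail-unique path!) s∈
    front-split : ∀ q → front k₁ (p ++ q) ≡ front k₁ p ++ front s q
    front-split q = front-++ q c₁
    go : ∀ q → Chain Free s q y → Unique (v ∷ k₁ ∷ p ++ q) → s ≢ y →
         t ∈ front k₁ (p ++ q) ⊎ (t ≡ v × edge v k₁ ∈ edges s (x ∷ ds))
    go [] [] _ s≢y = ⊥-elim (s≢y refl)
    go (b ∷ q) c₂@((jb , s∉B , _) ∷ _) p! _ with lastEdge fwd-path
    ... | a , a∈ , _ , (ja , _) with two-nbrs {E = F} (deg≤2 s∉B) (joined-sym {E = F} ja) jb a≢b jx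
      where
      a≢b : a ≢ b
      a≢b refl = unique-++-disjoint (v ∷ k₁ ∷ p) p! (front⊆ fwd-path a∈) (here refl)
    ... | inj₂ refl with run c₂ s! y-turn y∉B ch u sims
      where
      s! : Unique (s ∷ b ∷ q)
      s! = unique-++⁻ʳ (front v (k₁ ∷ p)) (subst Unique
             (trans (cong (_++ b ∷ q) (sym (front-end fwd-path))) (List.++-assoc (front v (k₁ ∷ p)) [ s ] (b ∷ q))) p!)
    ...   | inj₁ m = inj₁ (subst (t ∈_) (sym (front-split (b ∷ q))) (∈-++⁺ʳ (front k₁ p) (there m)))
    ...   | inj₂ (refl , _) = ⊥-elim (t≢y refl)
    go (b ∷ q) c₂@((jb , s∉B , _) ∷ _) p! _ | a , a∈ , _ , (ja , _) | inj₁ refl = back _ refl (chain-rev free-sym fwd-path)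
      where
      fwd! : Unique (v ∷ k₁ ∷ p)
      fwd! = unique-++⁻ˡ (v ∷ k₁ ∷ p) p!
      ret! : Unique (s ∷ rev v (k₁ ∷ p))
      ret! = rev-unique fwd-path fwd!
      s≢v : s ≢ v
      s≢v refl = head∉ fwd! (end∈ c₁)
      back : ∀ l → l ≡ rev v (k₁ ∷ p) → Chain Free s l v →
             t ∈ front k₁ (p ++ b ∷ q) ⊎ (t ≡ v × edge v k₁ ∈ edges s (x ∷ ds))
      back [] _ [] = ⊥-elim (s≢v refl)
      back (a′ ∷ l) eq ret@((ja′ , _) ∷ _) with two-nbrs {E = F} (deg≤2 s∉B) (joined-sym {E = F} ja) jb
             (λ { refl → unique-++-disjoint (v ∷ k₁ ∷ p) p! (front⊆ fwd-path a∈) (here refl) }) ja′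
      ... | inj₂ refl = ⊥-elim (unique-++-disjoint (v ∷ k₁ ∷ p) p!
              (rev-∈ fwd-path (there (subst (a′ ∈_) eq (here refl)))) (here refl))
      ... | inj₁ refl with run ret (subst (λ l → Unique (s ∷ l)) (sym eq) ret!) v-turn v∉B ch u sims
      ...   | inj₂ (refl , sub) = inj₂ (refl , sub (subst (λ l → edge v k₁ ∈ edges s l) (sym eq)
                (Perm.∈-resp-↭ (↭-sym (rev-edges↭ free-sym fwd-path)) (here refl))))
      ...   | inj₁ m = inj₁ (subst (t ∈_) (sym (front-split (b ∷ q))) (in-front (Perm.∈-resp-↭ (rev↭front v (k₁ ∷ p))
                (subst (t ∈_) eq (front-rev ret m)))))
        where
        t≢v : t ≢ v
        t≢v refl = end∉front ret (subst (λ l → Unique (s ∷ l)) (sym eq) ret!) (there m)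
        front-rev : ∀ {s a l v} → Chain Free s (a ∷ l) v → t ∈ front a l → t ∈ a ∷ l
        front-rev (_ ∷ c) = front⊆ c
        in-front : t ∈ front v (k₁ ∷ p) → t ∈ front k₁ p ++ front s (b ∷ q)
        in-front (here eq′) = ⊥-elim (t≢v eq′)
        in-front (there m′) = ∈-++⁺ˡ m′

  -- Between two turns, a path of branch-free vertices is a trap: a sequence of monochromatic
  -- steps entering it can only come back to where it entered.
  module Trap {v k₁ κ y} (path : Chain Free v (k₁ ∷ κ) y) (path! : Unique (v ∷ k₁ ∷ κ))
              (v-turn : Turn v) (y-turn : Turn y) where

    Step : Fin N → Fin N → Set
    Step s t = Link [] s t × t ≢ v × t ≢ y

    v∉front : v ∉ front k₁ κ
    v∉front m = go path path! m
      where
      go : ∀ {v k κ y} → Chain Free v (k ∷ κ) y → Unique (v ∷ k ∷ κ) → v ∉ front k κ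
      go (_ ∷ path′) u m = head∉ u (front⊆ path′ m)

    stays : ∀ {s ss u} → s ∈ front k₁ κ → Chain Step s ss u → u ∈ front k₁ κ
    stays s∈ [] = s∈
    stays {s} s∈ (_∷_ {y = t} ((qs , ch , u , sims) , t≢v , t≢y) c) with s Fin.≟ t
    ... | yes refl = stays s∈ c
    ... | no s≢t with step-inside path path! v-turn y-turn s∈ ch u sims s≢t t≢y
    ...   | inj₁ m = stays m c
    ...   | inj₂ (t≡v , _) = ⊥-elim (t≢v t≡v)

    -- The leaving and the returning path share the edge `edge v k₁`. This shared edge is what later
    -- transfers similarity from one to the other.
    returns : ∀ {ds w ss u qs} → Chain (Joined F) v (k₁ ∷ ds) w → Unique (v ∷ k₁ ∷ ds) → PairSim (edges v (k₁ ∷ ds)) → w ≢ y →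
              Chain Step w ss u → Chain (Joined F) u qs v → Unique (u ∷ qs) → PairSim (edges u qs) → edge v k₁ ∈ edges u qs
    returns ch u sims w≢y steps ch′ u′ sims′ with run path path! y-turn (end∉B path) ch u sims
    ... | inj₂ (w≡y , _) = ⊥-elim (w≢y w≡y)
    ... | inj₁ w∈ with stays w∈ steps
    ...   | u∈ with step-inside path path! v-turn y-turn u∈ ch′ u′ sims′ (λ { refl → v∉front u∈ }) v≢y
      where
      v≢y : v ≢ y
      v≢y refl = head∉ path! (closed-end∈ path (s≤s z≤n))
    ...     | inj₁ v∈ = ⊥-elim (v∉front v∈)
    ...     | inj₂ (_ , m) = m

-- The hitting set of a stuck state

GoodCycle : ∀ {N} (R : Fin N → Fin N → Set) (ℓ : ℕ) → Fin N × List (Fin N) → Set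
GoodCycle R ℓ (a , ys) = IsCycle R a ys × ℓ ≤ length ys

DisjointCycles : ∀ {N} → Fin N × List (Fin N) → Fin N × List (Fin N) → Set
DisjointCycles (_ , ys) (_ , zs) = ∀ {w} → w ∈ ys → w ∉ zs

record Packing {N} (R : Fin N → Fin N → Set) (ℓ k : ℕ) : Set where
  field
    cycles   : List (Fin N × List (Fin N))
    count    : k ≤ length cycles
    good     : All (GoodCycle R ℓ) cycles
    disjoint : AllPairs DisjointCycles cycles

Meets : ∀ {N} → GapGraph N → List (Fin N) → Set
Meets Γ S = ∀ {a ys} → IsCycle R a ys → ℓ ≤ length ys → Any (_∈ S) ys
  where open GapGraph Γ

module Hitting {N} {Γ : GapGraph N} {e c : ℕ} (St : State Γ e c) (stuck : Ears.Stuck St) (meets : Meets Γ (State.S St)) where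
  open GapGraph Γ
  open Similarity Γ
  open Monochrome Γ
  open State St
  open Ears St
  open Turns St

  free? : ∀ u w → Dec (Free u w)
  free? u w = joined? F u w ×-dec (¬? (u ∈? B) ×-dec ¬? (w ∈? B))

  -- One turn, if there is any, from each component of `F` without `B`: two turns joined to the same
  -- representative are joined to each other, so the chosen one can be the far end of a trap for all
  -- the others.
  turnCover : ∀ rs → ∃ λ X → length X ≤ length rs × (∀ {x} → x ∈ X → Turn x) ×
    (∀ {ρ v ys} → ρ ∈ rs → Turn v → Chain Free v ys ρ → ∃₂ λ y zs → y ∈ X × Chain Free v zs y)
  turnCover [] = [] , z≤n , (λ ()) , λ ()
  turnCover (ρ ∷ rs) with turnCover rs
    | Fin.any? (λ x → turn? x ×-dec ∃-list? (λ ys → chain? free? x ys ρ) N)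
  ... | X , l , ok , cov | no none = X , ℕ.m≤n⇒m≤1+n l , ok , λ
        { (here refl) t c → ⊥-elim (none (_ , t , proj₁ (simplify c) ,
             unique-length≤ (tail-unique (proj₁ (proj₂ (proj₂ (simplify c))))) , proj₁ (proj₂ (simplify c))))
        ; (there m) t c → cov m t c }
  ... | X , l , ok , cov | yes (x , tx , ys , _ , d) = x ∷ X , s≤s l , (λ { (here refl) → tx ; (there m) → ok m }) , λ
        { (here refl) t c → x , _ , here refl , c ++ᶜ chain-rev free-sym d
        ; (there m) t c → let (y , zs , y∈ , c′) = cov m t c in y , zs , there y∈ , c′ }

  X : List (Fin N)
  X = proj₁ (turnCover Reps)

  X-size : length X ≤ length Reps
  X-size = proj₁ (proj₂ (turnCover Reps))

  X-turn : ∀ {x} → x ∈ X → Turn x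
  X-turn = proj₁ (proj₂ (proj₂ (turnCover Reps)))

  X-cover : ∀ {v} → v ∈ S → v ∉ B → Turn v → ∃₂ λ y zs → y ∈ X × Chain Free v zs y
  X-cover v∈S v∉B t with rep v∈S v∉B
  ... | ρ , ys , ρ∈ , c = proj₂ (proj₂ (proj₂ (turnCover Reps))) ρ∈ t c

  Special : Fin N → Set
  Special z = z ∈ S × z ∉ B × ∃ λ ys → length ys ≤ N × SpecialCycle stuck z ys

  special? : ∀ z → Dec (Special z)
  special? z = (z ∈? S) ×-dec (¬? (z ∈? B) ×-dec ∃-list? (λ ys → isCycle? R? z ys ×-dec ((ℓ ℕ.≤? length ys) ×-dec
    All.all? (λ w → (w Fin.≟ z) ⊎-dec ¬? (w ∈? S)) ys)) N)

  Z : List (Fin N)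
  Z = filter special? (allFin N)

  -- By `special-disjoint` the special cycles at different vertices of `Z` are disjoint, so a large
  -- `Z` is itself a packing.
  Z-packing : Packing R ℓ (length Z)
  Z-packing with go Z (Unique.filter⁺ special? (Unique.allFin⁺ N)) (λ m → proj₂ (∈-filter⁻ special? {xs = allFin N} m))
    where
    go : ∀ zs → Unique zs → (∀ {z} → z ∈ zs → Special z) →
         ∃ λ cs → length zs ≤ length cs × AllPairs DisjointCycles cs × All (λ (a , ys) → a ∈ zs × SpecialCycle stuck a ys) cs
    go [] _ _ = [] , z≤n , [] , []
    go (z ∷ zs) u sp with go zs (tail-unique u) (λ m → sp (there m)) | sp (here refl)
    ... | cs , l , dj , al | z∈S , z∉B , ys , _ , sc = (z , ys) ∷ cs , s≤s l ,
          All.map (λ {x} → fresh x) al ∷ dj , (here refl , sc) ∷ All.map (λ (m , s) → there m , s) al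
      where
      fresh : ∀ x → proj₁ x ∈ zs × SpecialCycle stuck (proj₁ x) (proj₂ x) → DisjointCycles (z , ys) x
      fresh (a , xs) (a∈ , sc′) with sp (there a∈)
      ... | a∈S , a∉B , _ = special-disjoint stuck sc z∈S z∉B sc′ a∈S a∉B (λ { refl → head∉ u a∈ })
  ... | cs , l , dj , al = record { cycles = cs ; count = l ; good = All.map (λ (_ , C , ℓ≤ , _) → C , ℓ≤) al ; disjoint = dj }

  TwoIn : List (Fin N) → Set
  TwoIn ys = ∃₂ λ a b → a ∈ ys × a ∈ S × b ∈ ys × b ∈ S × a ≢ b

  Avoids : List (Fin N) → Set
  Avoids ys = ∀ {w} → w ∈ ys → w ∉ B × w ∉ X

  link-strip : ∀ {es s t} → Link es s t → Link [] s t
  link-strip {es} (qs , ch , u , sims) = qs , ch , u , pairSim-⊆ (∈-++⁺ʳ es) sims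

  module _ (v : Fin N) where

    Visit : Fin N → Fin N → Set
    Visit s t = Link [] s t × (s ≢ v × s ∉ X) × (t ≢ v × t ∉ X)

    visit-sym : ∀ {s t} → Visit s t → Visit t s
    visit-sym (l , p , q) = link-rev l , q , p

    -- Cut the walk wherever it meets `S`; each piece is an ear or an edge of `F` and leaves a link.
    -- The edges of the last piece are remembered in `es`, because the edge `f` by which the walk
    -- arrives at `v` is among them.
    visits : ∀ k {s ys f} → length ys ≤ k → Chain R s ys v → s ∈ S → v ∈ S → s ≢ v → Unique (s ∷ ys) →
             Avoids (s ∷ ys) → f ∈ edges s ys → Inc v f →
             ∃₂ λ ss u → Chain Visit s ss u × u ≢ v × u ∉ X × ∃ λ es → f ∈ es × Link es u v
    visits k h [] s∈S v∈S s≢v _ _ _ _ = ⊥-elim (s≢v refl)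
    visits (suc k) {s} {y ∷ ys} {f} (s≤s h) (r ∷ ch) s∈S v∈S s≢v u av f∈ inc
      with firstHit (_∈? S) ch (Any.map (λ { refl → v∈S }) (end∈ ch))
    ... | split t pre post refl c₁ c₂ , t∈S , al = go (t Fin.≟ v) post c₂ h u av f∈
      where
      go : Dec (t ≡ v) → ∀ post → Chain R t post v → length (pre ++ post) ≤ k → Unique (s ∷ y ∷ pre ++ post) →
           Avoids (s ∷ y ∷ pre ++ post) → f ∈ edges s (y ∷ pre ++ post) →
           ∃₂ λ ss u → Chain Visit s ss u × u ≢ v × u ∉ X × ∃ λ es → f ∈ es × Link es u v
      go d post c₂ h u av f∈ = go′ d post c₂ h u av f∈ link
        where
        u₁ : Unique (s ∷ y ∷ pre)
        u₁ = unique-++⁻ˡ (s ∷ y ∷ pre) u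
        t∈ : t ∈ y ∷ pre
        t∈ = end∈ c₁
        s≢t : s ≢ t
        s≢t refl = head∉ u₁ t∈
        link : Link (edges s (y ∷ pre)) s t
        link = mkLink stuck (r ∷ c₁) s∈S (proj₁ (av (here refl))) t∈S (proj₁ (av (there (∈-++⁺ˡ t∈)))) s≢t u₁ (prefix-free (_∈? S) c₁ al)
        go′ : Dec (t ≡ v) → ∀ post → Chain R t post v → length (pre ++ post) ≤ k → Unique (s ∷ y ∷ pre ++ post) →
           Avoids (s ∷ y ∷ pre ++ post) → f ∈ edges s (y ∷ pre ++ post) → Link (edges s (y ∷ pre)) s t →
           ∃₂ λ ss u → Chain Visit s ss u × u ≢ v × u ∉ X × ∃ λ es → f ∈ es × Link es u v
        go′ (yes refl) [] c₂ h u av f∈ link = [] , s , [] , s≢v , proj₂ (av (here refl)) , edges s (y ∷ pre) ,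
           subst (λ l → f ∈ edges s (y ∷ l)) (List.++-identityʳ pre) f∈ , link
        go′ (yes refl) (_ ∷ _) c₂ h u av f∈ link =
          ⊥-elim (unique-++-disjoint (y ∷ pre) (tail-unique u) t∈ (closed-end∈ c₂ (s≤s z≤n)))
        go′ (no t≢v) post c₂ h u av f∈ link with visits k (ℕ.≤-trans (subst (length post ≤_) (sym (List.length-++ pre)) (ℕ.m≤n+m _ _)) h)
            c₂ t∈S v∈S t≢v tu av′ f∈′ inc
          where
          v∈post : v ∈ post
          v∈post = end∈′ c₂ t≢v
          tu : Unique (t ∷ post)
          tu = cons-unique (unique-++-disjoint (y ∷ pre) (tail-unique u) t∈) (unique-++⁻ʳ (s ∷ y ∷ pre) u)
          av′ : Avoids (t ∷ post)
          av′ (here refl) = av (there (∈-++⁺ˡ t∈))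
          av′ (there m) = av (∈-++⁺ʳ (s ∷ y ∷ pre) m)
          f∈′ : f ∈ edges t post
          f∈′ with ∈-++⁻ (edges s (y ∷ pre)) (subst (f ∈_) (edges-++ post (r ∷ c₁)) f∈)
          ... | inj₂ m = m
          ... | inj₁ m = ⊥-elim (unique-++-disjoint (s ∷ y ∷ pre) u (inc-edges m inc) v∈post)
        ... | ss , w , ch′ , w≢v , w∉X , es , f∈es , lk =
          t ∷ ss , w , (link-strip link , (s≢v , proj₂ (av (here refl))) , (t≢v , proj₂ (av (there (∈-++⁺ˡ t∈))))) ∷ ch′ , w≢v , w∉X , es , f∈es , lk

  -- If `v ∉ S`, both edges lie on one ear through `v`. If `v ∈ S`, the pieces of the cycle that
  -- leave and enter `v` have links; when these meet `v` in similar edges of `F`, transitivity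
  -- suffices. Otherwise `v` is a turn, some turn in `X` lies in its component, and the trap between
  -- the two forces both links over the same edge at `v`.
  no-bend : ∀ {v y rest f} → IsCycle R v (y ∷ rest) → Avoids (y ∷ rest) → TwoIn (y ∷ rest) →
            f ∈ edges y rest → Inc v f → Sim (edge v y) f
  no-bend {v} {y} {rest} {f} C@(cycle (r ∷ K) u _) av (a , b , a∈ , a∈S , b∈ , b∈S , a≢b) f∈ inc with v ∈? S
  ... | no v∉S with outerHits (_∈? S) K u a∈ a∈S b∈ b∈S a≢b
  ... | record { α = α ; β = β ; pre = pre ; mid = mid ; post = post ; eq = refl ; c₁ = c₁ ; c₂ = c₂ ; c₃ = c₃
               ; Pα = α∈S ; Pβ = β∈S ; α≢β = α≢β ; before = before ; after = after } =
    proj₂ (proj₂ (proj₂ link)) (in-link (∈-++⁺ʳ (edges β post) (here refl))) (in-link (∈-++⁺ˡ f∈post))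
    where
    β≢v : β ≢ v
    β≢v refl = v∉S β∈S
    v∈post : v ∈ post
    v∈post = end∈′ c₃ β≢v
    os = post ++ y ∷ pre
    β∈ : β ∈ y ∷ pre ++ mid ++ post
    β∈ = ∈-++⁺ʳ (y ∷ pre) (∈-++⁺ˡ (end∈′ c₂ α≢β))
    os! : Unique (β ∷ os)
    os! = cons-unique β∉ (unique-++⁺ (unique-++⁻ʳ mid (unique-++⁻ʳ (y ∷ pre) u)) (unique-++⁻ˡ (y ∷ pre) u)
            (λ m m′ → unique-++-disjoint (y ∷ pre) u m′ (∈-++⁺ʳ mid m)))
      where
      β∉ : β ∉ os
      β∉ m with ∈-++⁻ post m
      ... | inj₁ m₁ = after m₁ β∈S
      ... | inj₂ m₂ = [ (λ eq → α≢β (sym eq)) , (λ ∉S → ∉S β∈S) ]′ (before m₂)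
    link : Link (edges β os) β α
    link = mkLink stuck (c₃ ++ᶜ (r ∷ c₁)) β∈S (proj₁ (av β∈)) α∈S (proj₁ (av (∈-++⁺ˡ (end∈ c₁)))) (≢-sym α≢β) os!
      (λ m → [ (λ m₁ → inj₂ (after m₁)) , before ]′ (∈-++⁻ post m))
    in-link : ∀ {g} → g ∈ edges β post ++ edges v (y ∷ pre) → g ∈ edges β os ++ edges β (proj₁ link)
    in-link {g} m = ∈-++⁺ˡ (subst (g ∈_) (sym (edges-++ (y ∷ pre) c₃)) m)
    f∈post : f ∈ edges β post
    f∈post with ∈-++⁻ (edges y pre) (subst (f ∈_) (edges-++ (mid ++ post) c₁) f∈)
    ... | inj₁ m = ⊥-elim (unique-++-disjoint (y ∷ pre) u (inc-edges m inc) (∈-++⁺ʳ mid v∈post))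
    ... | inj₂ m with ∈-++⁻ (edges α mid) (subst (f ∈_) (edges-++ post c₂) m)
    ...   | inj₂ m₂ = m₂
    ...   | inj₁ m₁ with inc-edges m₁ inc
    ...     | here refl = ⊥-elim (v∉S α∈S)
    ...     | there v∈mid = ⊥-elim (unique-++-disjoint mid (unique-++⁻ʳ (y ∷ pre) u) v∈mid v∈post)
  no-bend {v} {y} {rest} {f} C@(cycle (r ∷ K) u _) av (a , b , a∈ , a∈S , b∈ , b∈S , a≢b) f∈ inc | yes v∈S
    with firstHit (_∈? S) K (Any.map (λ { refl → v∈S }) (end∈ K))
  ... | split w pre post refl c₁ c₂ , w∈S , al = decidable-stable (Sim? _ _) contra
    where
    v∈C : v ∈ y ∷ pre ++ post
    v∈C = base∈ C
    w∈ : w ∈ y ∷ pre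
    w∈ = end∈ c₁
    w≢v : w ≢ v
    w≢v w≡v = go post c₂ u a∈ b∈
      where
      only : ∀ {x} → x ∈ y ∷ pre → x ∈ S → x ≡ w
      only m x∈S = [ id , (λ ∉S → ⊥-elim (∉S x∈S)) ]′ (prefix-free (_∈? S) c₁ al m)
      go : ∀ post → Chain R w post v → Unique (y ∷ pre ++ post) → a ∈ y ∷ pre ++ post → b ∈ y ∷ pre ++ post → ⊥
      go [] _ _ a∈ b∈ = a≢b (trans (only (strip a∈) a∈S) (sym (only (strip b∈) b∈S)))
        where
        strip : ∀ {x} → x ∈ y ∷ pre ++ [] → x ∈ y ∷ pre
        strip {x} = subst (λ l → x ∈ y ∷ l) (List.++-identityʳ pre)
      go (_ ∷ _) c₂ u _ _ = unique-++-disjoint (y ∷ pre) u (subst (_∈ y ∷ pre) w≡v w∈) (closed-end∈ c₂ (s≤s z≤n))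
    v∈post : v ∈ post
    v∈post = end∈′ c₂ w≢v
    link₁ : Link (edges v (y ∷ pre)) v w
    link₁ = mkLink stuck (r ∷ c₁) v∈S (proj₁ (av v∈C)) w∈S (proj₁ (av (∈-++⁺ˡ w∈))) (≢-sym w≢v)
      (cons-unique (λ m → unique-++-disjoint (y ∷ pre) u m v∈post) (unique-++⁻ˡ (y ∷ pre) u)) (prefix-free (_∈? S) c₁ al)
    f∈post : f ∈ edges w post
    f∈post with ∈-++⁻ (edges y pre) (subst (f ∈_) (edges-++ post c₁) f∈)
    ... | inj₂ m = m
    ... | inj₁ m = ⊥-elim (unique-++-disjoint (y ∷ pre) u (inc-edges m inc) v∈post)
    V = visits v _ ℕ.≤-refl c₂ w∈S v∈S w≢v
          (cons-unique (unique-++-disjoint (y ∷ pre) u w∈) (unique-++⁻ʳ (y ∷ pre) u))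
          (λ { (here refl) → av (∈-++⁺ˡ w∈) ; (there m) → av (∈-++⁺ʳ (y ∷ pre) m) }) f∈post inc

    conclude : ∀ {w t ss es} → Link (edges v (y ∷ pre)) v w → w ≢ v → w ∉ X → Chain (Visit v) w ss t → t ≢ v → t ∉ X →
               f ∈ es → Link es t v → Sim (edge v y) f
    conclude {w} {t} {ss} {es} ([] , [] , _) w≢v _ _ _ _ _ _ = ⊥-elim (w≢v refl)
    conclude {w} {t} {ss} {es} l₁@(a₂ ∷ ds , ch₁@(j₂ ∷ _) , u₁ , sims₁) w≢v w∉X steps t≢v t∉X f∈es l₂@(qs , ch₂ , u₂ , sims₂)
      with link-rev l₂
    ... | [] , [] , _ = ⊥-elim (t≢v refl)
    ... | a₁ ∷ ds′ , ch₂′@(j₁ ∷ _) , u₂′ , sims₂′ with Sim? (edge v a₂) (edge v a₁)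
    ... | yes s = sim-trans y~a₂ (sim-trans s (sims₂′ (∈-++⁺ʳ es (here refl)) (∈-++⁺ˡ f∈es)))
      where
      y~a₂ = sims₁ (here refl) (∈-++⁺ʳ (edges v (y ∷ pre)) (here refl))
    ... | no ¬s with X-cover v∈S (proj₁ (av v∈C)) (a₂ , a₁ , j₂ , j₁ , ¬s)
    ... | y* , zs , y*∈X , κ with simplify κ
    ... | [] , [] , _ = ⊥-elim (proj₂ (av v∈C) y*∈X)
    ... | k₁ ∷ κ′ , path@((jk , _) ∷ _) , path! , _
      with two-nbrs {E = F} (deg≤2 (proj₁ (av v∈C))) j₂ j₁ (λ { refl → ¬s (inj₁ refl) }) jk
    -- The way to the far end of the trap starts with the first edge of the outgoing link, so the
    -- tour is caught at once. In the other case it is caught when walked backwards.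
    ... | inj₁ refl = sim-trans y~a₂ (sims₂ (∈-++⁺ʳ es (returns ch₁ u₁ (pairSim-⊆ (∈-++⁺ʳ (edges v (y ∷ pre))) sims₁)
            (avoid w∉X) (chain-map steps (λ (l , _ , t≢v , t∉X) _ → l , t≢v , avoid t∉X)) ch₂ u₂ (pairSim-⊆ (∈-++⁺ʳ es) sims₂)))
            (∈-++⁺ˡ f∈es))
      where
      open Trap path path! (a₂ , a₁ , j₂ , j₁ , ¬s) (X-turn y*∈X)
      y~a₂ = sims₁ (here refl) (∈-++⁺ʳ (edges v (y ∷ pre)) (here refl))
      avoid : ∀ {x} → x ∉ X → x ≢ y*
      avoid x∉X refl = x∉X y*∈X
    ... | inj₂ refl with link-rev l₁
    ... | qs₁ , ch₁′ , u₁′ , sims₁′ =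
      sim-trans (sims₁′ (here refl) (∈-++⁺ʳ (edges v (y ∷ pre)) (returns ch₂′ u₂′ (pairSim-⊆ (∈-++⁺ʳ es) sims₂′)
            (avoid t∉X) (chain-map (chain-rev (visit-sym v) steps) (λ (l , _ , t≢v , t∉X) _ → l , t≢v , avoid t∉X)) ch₁′ u₁′
            (pairSim-⊆ (∈-++⁺ʳ (edges v (y ∷ pre))) sims₁′))))
        (sims₂′ (∈-++⁺ʳ es (here refl)) (∈-++⁺ˡ f∈es))
      where
      open Trap path path! (a₂ , a₁ , j₂ , j₁ , ¬s) (X-turn y*∈X)
      avoid : ∀ {x} → x ∉ X → x ≢ y*
      avoid x∉X refl = x∉X y*∈X

    contra : ¬ ¬ Sim (edge v y) f
    contra ¬s with V
    ... | ss , t , steps , t≢v , t∉X , es , f∈es , l₂ =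
      ¬s (conclude link₁ w≢v (proj₂ (av (∈-++⁺ˡ w∈))) steps t≢v t∉X f∈es l₂)

  -- `no-bend` at every vertex, chained around the cycle by transitivity.
  cycle-mono : ∀ {a ys} → IsCycle R a ys → Avoids ys → TwoIn ys → ∃ λ g → Mono g a ys
  cycle-mono {a} {y ∷ ys} C@(cycle (r ∷ K) _ _) av two = edge a y ,
    λ { (here eq) → inj₁ (sym eq) ; (there m) → along [] [] r K refl m }
    where
    along : ∀ p {x v q} → Chain R a p x → R x v → Chain R v q a → y ∷ ys ≡ p ++ v ∷ q → ∀ {f} → f ∈ edges v q → Sim (edge x v) f
    along p {x} {v} {z ∷ q} c₁ r (s ∷ c₂) eq {f} m = onward m
      where
      eq′ : y ∷ ys ≡ (p ++ [ v ]) ++ z ∷ q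
      eq′ = trans eq (sym (List.++-assoc p [ v ] (z ∷ q)))
      C′ : IsCycle R v ((z ∷ q) ++ (p ++ [ v ]))
      C′ = rotate (snoc c₁ r) (s ∷ c₂) (subst (IsCycle R a) eq′ C)
      back : ∀ {w} → w ∈ (z ∷ q) ++ (p ++ [ v ]) → w ∈ y ∷ ys
      back {w} m = subst (w ∈_) (sym eq′) (Perm.∈-resp-↭ (Perm.++-comm (z ∷ q) (p ++ [ v ])) m)
      forth : ∀ {w} → w ∈ y ∷ ys → w ∈ (z ∷ q) ++ (p ++ [ v ])
      forth {w} m = Perm.∈-resp-↭ (Perm.++-comm (p ++ [ v ]) (z ∷ q)) (subst (w ∈_) eq′ m)
      bend : Sim (edge v z) (edge x v)
      bend = no-bend C′ (λ m → av (back m)) (let (a , b , a∈ , a∈S , b∈ , b∈S , ne) = two in a , b , forth a∈ , a∈S , forth b∈ , b∈S , ne)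
        (subst (edge x v ∈_) (sym (trans (edges-++ (p ++ [ v ]) c₂) (cong (edges z q ++_) (edges-++ [ v ] c₁))))
           (∈-++⁺ʳ (edges z q) (∈-++⁺ʳ (edges a p) (here refl)))) (inc-edgeʳ {u = x})
      onward : f ∈ edge v z ∷ edges z q → Sim (edge x v) f
      onward (here refl) = sim-sym bend
      onward (there m′) = sim-trans (sim-sym bend) (along (p ++ [ v ]) (snoc c₁ r) s c₂ eq′ m′)

  -- A long cycle meets `S`. If it does so in one vertex only, that vertex is in `Z`; with two
  -- vertices of `S` and none of `B` and `X` it is monochromatic, hence short.
  hits : ∀ {a ys} → IsCycle R a ys → Avoids ys → (∀ {w} → w ∈ ys → w ∉ Z) → length ys < ℓ
  hits {a} {ys} C av avZ with length ys ℕ.<? ℓ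
  ... | yes lt = lt
  ... | no ¬lt with find (meets C (ℕ.≮⇒≥ ¬lt))
  ... | s , s∈ , s∈S with rotateTo C s∈
  ... | zs , C′ , zs↭ , _ with All.all? (λ w → (w Fin.≟ s) ⊎-dec ¬? (w ∈? S)) zs
  ... | yes al = ⊥-elim (avZ s∈ (∈-filter⁺ special? (∈-allFin s) (s∈S , proj₁ (av s∈) , zs , unique-length≤ (unique C′) ,
                   C′ , subst (ℓ ≤_) (sym (Perm.↭-length zs↭)) (ℕ.≮⇒≥ ¬lt) , al)))
  ... | no ¬al with find (All.¬All⇒Any¬ (λ w → (w Fin.≟ s) ⊎-dec ¬? (w ∈? S)) zs ¬al)
  ... | t , t∈ , ¬t with cycle-mono C av (s , t , s∈ , s∈S , Perm.∈-resp-↭ zs↭ t∈ ,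
                           decidable-stable (t ∈? S) (λ t∉S → ¬t (inj₂ t∉S)) , λ { refl → ¬t (inj₁ refl) })
  ... | g , mono = mono⇒short _ ℕ.≤-refl C mono

  hitters : ∃₂ λ X Z → length X ≤ length Reps × Packing R ℓ (length Z) ×
    (∀ {a ys} → IsCycle R a ys → (∀ {w} → w ∈ ys → w ∉ B × w ∉ X) → (∀ {w} → w ∈ ys → w ∉ Z) → length ys < ℓ)
  hitters = X , Z , X-size , Z-packing , hits

-- Adding cycles and ears to the state

module _ {R : Fin N → Fin N → Set} (Rsym : ∀ {u v} → R u v → R v u) where

  startWith : ∀ {a ys b y} → IsCycle R a ys → edge b y ∈ edges a ys →
              ∃ λ zs → IsCycle R b (y ∷ zs) × (y ∷ zs) ↭ ys × edges b (y ∷ zs) ↭ edges a ys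
  startWith {a} {ys} {b} {y} C m with edgeSplit (chain C) m
  ... | u , v , p , q , refl , c₁ , r , c₂ , eq with edge-inj eq
  ... | inj₁ (refl , refl) = q ++ p , rotate c₁ (r ∷ c₂) C , Perm.++-comm (v ∷ q) p , rotate-edges c₁ (r ∷ c₂)
  ... | inj₂ (refl , refl) = rev v (q ++ p) , cycle (Rsym r ∷ chain-rev Rsym K) (rev-unique K K!) three , verts ,
          ↭-trans (↭-reflexive (cong (_∷ edges u (rev v (q ++ p))) (edge-comm v u)))
            (↭-trans (prep _ (rev-edges↭ Rsym K)) (rotate-edges c₁ (r ∷ c₂)))
    where
    K : Chain R v (q ++ p) u
    K = c₂ ++ᶜ c₁
    K! : Unique (v ∷ q ++ p)
    K! = unique (rotate c₁ (r ∷ c₂) C)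
    verts : u ∷ rev v (q ++ p) ↭ p ++ v ∷ q
    verts = ↭-trans (prep u (rev↭front v (q ++ p)))
      (↭-trans (Perm.∷↭∷ʳ u (front v (q ++ p))) (↭-trans (↭-reflexive (front-end K)) (Perm.++-comm (v ∷ q) p)))
    three : 3 ≤ length (u ∷ rev v (q ++ p))
    three = subst (3 ≤_) (sym (Perm.↭-length verts)) (long C)

forced-by-degree : ∀ {G : List (Fin N × Fin N)} {x y zs z} → Chain (Joined G) x (y ∷ zs) z → NonBacktracking {R = Joined G} x y zs →
                   (∀ {w} → w ∈ front y zs → deg G w ≤ 2) → Forced {R = Joined G} x y zs
forced-by-degree (j ∷ []) [] d = []
forced-by-degree {G = G} (j ∷ (j′ ∷ c)) (w≢x ∷ nb) d =
  two-nbrs {E = G} (d (here refl)) (joined-sym {E = G} j) j′ (λ eq → w≢x (sym eq)) ∷ forced-by-degree (j′ ∷ c) nb (λ m → d (there m))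

FreeIn : List (Fin N × Fin N) → List (Fin N) → Fin N → Fin N → Set
FreeIn F B u w = Joined F u w × u ∉ B × w ∉ B

Represents : List (Fin N × Fin N) → List (Fin N) → List (Fin N) → List (Fin N) → Set
Represents F S B rs = ∀ {v} → v ∈ S → v ∉ B → ∃₂ λ ρ ys → ρ ∈ rs × Chain (FreeIn F B) v ys ρ

module _ {F : List (Fin N × Fin N)} {B : List (Fin N)} {u : Fin N} where

  stop-before : ∀ {v ys} → Chain (FreeIn F B) v ys u → v ≢ u →
                ∃₂ λ w zs → Joined F u w × Chain (FreeIn F (u ∷ B)) v zs w
  stop-before [] v≢u = ⊥-elim (v≢u refl)
  stop-before {v} (_∷_ {y = y} (j , p , q) c) v≢u with y Fin.≟ u
  ... | yes refl = v , [] , joined-sym {E = F} j , []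
  ... | no y≢u with stop-before c y≢u
  ...   | w , zs , jw , c′ = w , y ∷ zs , jw , (j , keep v≢u p , keep y≢u q) ∷ c′
    where
    keep : ∀ {x} → x ≢ u → x ∉ B → x ∉ u ∷ B
    keep x≢u x∉ (here eq) = x≢u eq
    keep x≢u x∉ (there m) = x∉ m

  avoid-or-stop : ∀ {v ys t} → Chain (FreeIn F B) v ys t → v ≢ u →
                  Chain (FreeIn F (u ∷ B)) v ys t ⊎ (∃₂ λ w zs → Joined F u w × Chain (FreeIn F (u ∷ B)) v zs w)
  avoid-or-stop {ys = ys} c v≢u with u ∈? ys
  ... | yes u∈ with split∈ c (there u∈)
  ...   | p , q , refl , c₁ , c₂ = inj₂ (stop-before c₁ v≢u)
  avoid-or-stop {v} {ys} c v≢u | no u∉ = inj₁ (chain-map c λ {x} {y} (j , p , q) m →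
      j , keep (inc-edges m inc-edgeˡ) p , keep (inc-edges m (inc-edgeʳ {u = x})) q)
    where
    keep : ∀ {x} → x ∈ v ∷ ys → x ∉ B → x ∉ u ∷ B
    keep (here refl) x∉ (here eq) = v≢u eq
    keep (there m) x∉ (here refl) = u∉ m
    keep m x∉ (there m′) = x∉ m′

  -- The representative of the component of u becomes redundant: whatever it represented is joined to it and then
  -- to u, hence, stopping before u, to a neighbour of u.
  branch-step : ∀ {S rs} → Represents F S B rs → u ∈ S → u ∉ B → deg F u ≤ 2 →
                ∃ λ rs′ → length rs′ ≤ suc (length rs) × Represents F S (u ∷ B) rs′
  branch-step {S} {rs} rp u∈S u∉B d with some-two-nbrs {E = F} d | rp u∈S u∉B
  ... | a , b , nbrs | ρ , xs , ρ∈ , cρ = a ∷ b ∷ rest , s≤s short , rp′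
    where
    rest = filter (λ x → ¬? (x Fin.≟ ρ)) rs
    short : suc (length rest) ≤ length rs
    short = List.filter-notAll (λ x → ¬? (x Fin.≟ ρ)) rs (Any.map (λ { refl ¬p → ¬p refl }) ρ∈)
    back : ∀ {x y} → FreeIn F B x y → FreeIn F B y x
    back (j , p , q) = joined-sym {E = F} j , q , p
    nbr : ∀ {v} → (∃₂ λ w zs → Joined F u w × Chain (FreeIn F (u ∷ B)) v zs w) →
          ∃₂ λ σ ys → σ ∈ a ∷ b ∷ rest × Chain (FreeIn F (u ∷ B)) v ys σ
    nbr (w , zs , j , c) with nbrs j
    ... | inj₁ refl = w , zs , here refl , c
    ... | inj₂ refl = w , zs , there (here refl) , c
    rp′ : Represents F S (u ∷ B) (a ∷ b ∷ rest)
    rp′ {v} v∈S v∉ with rp v∈S (λ m → v∉ (there m))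
    ... | σ , ys , σ∈ , c with σ Fin.≟ ρ
    ...   | yes refl = nbr (stop-before (c ++ᶜ chain-rev back cρ) (λ { refl → v∉ (here refl) }))
    ...   | no σ≢ρ with avoid-or-stop c (λ { refl → v∉ (here refl) })
    ...     | inj₁ c′ = σ , ys , there (there (∈-filter⁺ (λ x → ¬? (x Fin.≟ ρ)) σ∈ σ≢ρ)) , c′
    ...     | inj₂ s = nbr s

module Growth {N} {Γ : GapGraph N} where
  open GapGraph Γ

  emptyState : State Γ 0 0
  emptyState = record
    { F = [] ; S = [] ; B = [] ; Reps = [] ; F⊆R = λ () ; F-edges = λ () ; F-ends = λ () ; F! = [] ; S! = []
    ; size = refl ; B-size = refl ; deg≤3 = λ _ → z≤n ; deg≤2 = λ _ → z≤n
    ; noShort = λ { (cycle (() ∷ _) _ _) ; (cycle [] _ ()) } ; Reps-size = z≤n ; rep = λ () ; B⊆S = λ () }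

  module AddCycle {e c a ys} (St : State Γ e c) (C : IsCycle R a ys) (ℓ≤ : ℓ ≤ length ys) (fresh : ∀ {w} → w ∈ ys → w ∉ State.S St) where
    open State St

    F′ = edges a ys ++ F

    on-C : ∀ {f w} → f ∈ edges a ys → Inc w f → w ∈ ys
    on-C m i = cycle-∈ C (inc-edges m i)

    deg-old : ∀ {w} → w ∉ ys → deg F′ w ≡ deg F w
    deg-old {w} w∉ = trans (deg-++ (edges a ys) F w) (cong (_+ deg F w) (deg-none (edges a ys) (λ m i → w∉ (on-C m i))))

    deg-new : ∀ {w} → w ∈ ys → deg F′ w ≤ 2
    deg-new {w} w∈ = subst (_≤ 2) (sym (trans (deg-++ (edges a ys) F w)
      (trans (cong (deg (edges a ys) w +_) (deg-none F (λ m i → fresh w∈ (F-ends m i)))) (ℕ.+-identityʳ _))))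
      (cycle-deg≤2 C w)

    C′ : IsCycle (Joined F′) a ys
    C′ = cycle-map C (λ _ m → ∈-++⁺ˡ m)

    stay : ∀ {x ds z} → x ∈ S → Chain (Joined F′) x ds z → Chain (Joined F) x ds z
    stay x∈ [] = []
    stay {x} x∈ (j ∷ ch) with ∈-++⁻ (edges a ys) j
    ... | inj₁ m = ⊥-elim (fresh (on-C m inc-edgeˡ) x∈)
    ... | inj₂ m = m ∷ stay (F-ends m (inc-edgeʳ {u = x})) ch

    -- No edge joins `S` to the new cycle, and on it all degrees are at most two. A cycle with base
    -- in `S` is therefore old, and any other has to run around the whole new cycle.
    noShort′ : ∀ {b ds} → IsCycle (Joined F′) b ds → ℓ ≤ length ds
    noShort′ {b} {ds} D@(cycle ch u l) with b ∈? S
    ... | yes b∈ = noShort (cycle (stay b∈ ch) u l)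
    noShort′ {b} {y ∷ ds} D@(cycle (j ∷ ch) u l) | no b∉ with ∈-++⁻ (edges a ys) j
    ... | inj₂ m = ⊥-elim (b∉ (F-ends m inc-edgeˡ))
    ... | inj₁ m with startWith (joined-sym {E = F′}) C′ m
    ... | zs , K@(cycle kc@(_ ∷ kc′) ku _) , k↭ , _ with follow
            (forced-by-degree kc (nb-cycle K) (λ w∈ → deg-new (Perm.∈-resp-↭ k↭ (front⊆ kc′ w∈)))) kc′ ch (nb-cycle D)
    ... | inj₂ b∈ = ⊥-elim (end∉front kc′ ku b∈)
    ... | inj₁ (es , refl , _) = ℕ.≤-trans ℓ≤ (ℕ.≤-trans (ℕ.≤-reflexive (sym (Perm.↭-length k↭)))
            (s≤s (subst (length zs ≤_) (sym (List.length-++ zs)) (ℕ.m≤m+n _ _))))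

    state : State Γ e (suc c)
    state = record
      { F = F′ ; S = ys ++ S ; B = B ; Reps = a ∷ Reps
      ; F⊆R = λ m → [ edge∈⇒R Rsym (chain C) , F⊆R ]′ (∈-++⁻ (edges a ys) m)
      ; F-edges = λ m → [ (λ m₁ → let (u , v , _ , _ , _ , _ , _ , _ , eq) = edgeSplit (chain C) m₁ in u , v , eq) , F-edges ]′ (∈-++⁻ (edges a ys) m)
      ; F-ends = λ m i → [ (λ m₁ → ∈-++⁺ˡ (on-C m₁ i)) , (λ m₂ → ∈-++⁺ʳ ys (F-ends m₂ i)) ]′ (∈-++⁻ (edges a ys) m)
      ; F! = unique-++⁺ (cycle-edges-unique C) F! disj
      ; S! = unique-++⁺ (unique C) S! fresh
      ; size = trans (List.length-++ (edges a ys)) (trans (cong₂ _+_ (length-edges a ys) size)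
                 (trans (sym (ℕ.+-assoc (length ys) (length S) e)) (cong (_+ e) (sym (List.length-++ ys)))))
      ; B-size = B-size
      ; deg≤3 = λ v → case v ∈? ys of λ
          { (yes v∈) → ℕ.m≤n⇒m≤1+n (deg-new v∈) ; (no v∉) → subst (_≤ 3) (sym (deg-old v∉)) (deg≤3 v) }
      ; deg≤2 = λ {v} v∉B → case v ∈? ys of λ
          { (yes v∈) → deg-new v∈ ; (no v∉) → subst (_≤ 2) (sym (deg-old v∉)) (deg≤2 v∉B) }
      ; noShort = noShort′
      ; Reps-size = subst (suc (length Reps) ≤_) (sym (ℕ.+-suc (e + e + e) c)) (s≤s Reps-size)
      ; rep = rep′
      ; B⊆S = λ m → ∈-++⁺ʳ ys (B⊆S m) }
      where
      disj : ∀ {f} → f ∈ edges a ys → f ∉ F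
      disj m m′ with F-edges m′
      ... | u , v , refl = fresh (on-C m (inc-edgeˡ {u = u} {v})) (F-ends m′ (inc-edgeˡ {u = u} {v}))
      ∉B : ∀ {w} → w ∈ ys → w ∉ B
      ∉B w∈ m = fresh w∈ (B⊆S m)
      rep′ : Represents F′ (ys ++ S) B (a ∷ Reps)
      rep′ {v} v∈ v∉B with ∈-++⁻ ys v∈
      ... | inj₂ v∈S with rep v∈S v∉B
      ...   | ρ , xs , ρ∈ , ch = ρ , xs , there ρ∈ , chain-map ch (λ (j , p , q) _ → ∈-++⁺ʳ (edges a ys) j , p , q)
      rep′ {v} v∈ v∉B | inj₁ v∈ys with split∈ (chain C) (there v∈ys)
      ... | p , q , refl , c₁ , c₂ = a , q , here refl , chain-map c₂ λ {x} _ m →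
              let m′ = subst (_ ∈_) (sym (edges-++ q c₁)) (∈-++⁺ʳ (edges a p) m)
              in ∈-++⁺ˡ m′ , ∉B (on-C m′ inc-edgeˡ) , ∉B (on-C m′ (inc-edgeʳ {u = x}))

  module AddEar {e c u y ys v} (St : State Γ e c) (H : Ears.OpenEar St u (y ∷ ys) v)
                (¬bypass : ¬ Ears.ShortBypass St u (y ∷ ys) v) where
    open State St
    open Ears.OpenEar H

    os I S′ B′ : List (Fin N)
    os = y ∷ ys
    I = front y ys
    S′ = I ++ S
    B′ = v ∷ u ∷ B

    F′ : List (Fin N × Fin N)
    F′ = edges u os ++ F

    tail-chain : Chain R y ys v
    tail-chain with path
    ... | _ ∷ ch = ch

    v∉I : v ∉ I
    v∉I = end∉front tail-chain (tail-unique path!)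

    I⊆os : I ⊆ os
    I⊆os = front⊆ tail-chain

    I∉S : ∀ {w} → w ∈ I → w ∉ S
    I∉S m with interior (I⊆os m)
    ... | inj₁ refl = ⊥-elim (v∉I m)
    ... | inj₂ ∉S = ∉S

    os-cases : ∀ {w} → w ∈ os → w ∈ I ⊎ w ≡ v
    os-cases {w} m with ∈-++⁻ I (subst (w ∈_) (sym (front-end tail-chain)) m)
    ... | inj₁ m₁ = inj₁ m₁
    ... | inj₂ (here eq) = inj₂ eq

    I∉B′ : ∀ {w} → w ∈ I → w ∉ B′
    I∉B′ m (here refl) = v∉I m
    I∉B′ m (there (here refl)) = head∉ path! (I⊆os m)
    I∉B′ m (there (there m′)) = I∉S m (B⊆S m′)

    deg-sum : ∀ w → deg F′ w ≡ deg (edges u os) w + deg F w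
    deg-sum = deg-++ (edges u os) F

    deg-off : ∀ {w} → w ∉ u ∷ os → deg F′ w ≡ deg F w
    deg-off {w} w∉ = trans (deg-sum w) (cong (_+ deg F w) (path-deg-outside path w∉))

    deg-I : ∀ {w} → w ∈ I → deg F′ w ≤ 2
    deg-I {w} m = subst (_≤ 2) (sym (trans (deg-sum w) (trans (cong (deg (edges u os) w +_)
      (deg-none F (λ f∈ i → I∉S m (F-ends f∈ i)))) (ℕ.+-identityʳ _)))) (path-deg≤2 path path! w)

    deg≤3′ : ∀ w → deg F′ w ≤ 3
    deg≤3′ w with w ∈? (u ∷ os)
    ... | no w∉ = subst (_≤ 3) (sym (deg-off w∉)) (deg≤3 w)
    ... | yes (here refl) = subst (_≤ 3) (sym (deg-sum w)) (ℕ.+-mono-≤ (path-deg-start path path!) (deg≤2 u∉B))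
    ... | yes (there m) with os-cases m
    ...   | inj₁ w∈I = ℕ.m≤n⇒m≤1+n (deg-I w∈I)
    ...   | inj₂ refl = subst (_≤ 3) (sym (deg-sum w)) (ℕ.+-mono-≤ (path-deg-end path path!) (deg≤2 v∉B))

    deg≤2′ : ∀ {w} → w ∉ B′ → deg F′ w ≤ 2
    deg≤2′ {w} w∉ with w ∈? (u ∷ os)
    ... | no w∉P = subst (_≤ 2) (sym (deg-off w∉P)) (deg≤2 (λ m → w∉ (there (there m))))
    ... | yes (here refl) = ⊥-elim (w∉ (there (here refl)))
    ... | yes (there m) with os-cases m
    ...   | inj₁ w∈I = deg-I w∈I
    ...   | inj₂ refl = ⊥-elim (w∉ (here refl))

    path′ : Chain (Joined F′) u os v
    path′ = chain-map path (λ _ m → ∈-++⁺ˡ m)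

    -- A cycle using an edge of the ear is forced back along it to u, hence uses its first edge, and is then forced to v.
    first-edge : ∀ {b ds f} → IsCycle (Joined F′) b ds → f ∈ edges b ds → f ∈ edges u os → edge u y ∈ edges b ds
    first-edge {b} {ds} D f∈D f∈P with edgeSplit path′ f∈P
    ... | x , x′ , [] , q , refl , [] , j , _ , refl = f∈D
    ... | x , x′ , .y ∷ p , q , refl , c₁@(_ ∷ _) , j , _ , refl with startWith (joined-sym {E = F′}) D (subst (_∈ edges b ds) (edge-comm x x′) f∈D)
    ... | zs , D′@(cycle (_ ∷ dc) du _) , _ , des↭ = go (rev u (y ∷ p)) refl (chain-rev (joined-sym {E = F′}) c₁)
      where
      pre : Chain (Joined F′) u (y ∷ p) x
      pre = c₁
      pre! : Unique (u ∷ y ∷ p)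
      pre! = unique-++⁻ˡ (u ∷ y ∷ p) path!
      x′∉ : x′ ∉ u ∷ y ∷ p
      x′∉ m = unique-++-disjoint (u ∷ y ∷ p) path! m (here refl)
      go : ∀ l → l ≡ rev u (y ∷ p) → Chain (Joined F′) x l u → edge u y ∈ edges b ds
      go l eq lc with follow (forced-by-degree (joined-sym {E = F′} j ∷ lc) (nb-path l!) inner) lc dc (nb-cycle D′)
        where
        l! : Unique (x′ ∷ x ∷ l)
        l! = cons-unique (λ m → x′∉ (rev-∈ pre (subst (λ l → x′ ∈ x ∷ l) eq m)))
               (subst (λ l → Unique (x ∷ l)) (sym eq) (rev-unique pre pre!))
        inner : ∀ {w} → w ∈ front x l → deg F′ w ≤ 2
        inner {w} m with rev-∈ pre (subst (λ l → w ∈ x ∷ l) eq (front⊆ lc m))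
        ... | here refl = ⊥-elim (end∉front lc (tail-unique l!) m)
        ... | there m′ with os-cases (∈-++⁺ˡ m′)
        ...   | inj₁ w∈I = deg-I w∈I
        ...   | inj₂ refl = ⊥-elim (unique-++-disjoint (y ∷ p) (tail-unique path!) m′ (ends-later (y ∷ p) path′))
          where
          ends-later : ∀ {x₀} l → Chain (Joined F′) x₀ (l ++ x′ ∷ q) v → v ∈ x′ ∷ q
          ends-later [] ch = closed-end∈ ch (s≤s z≤n)
          ends-later (_ ∷ l) (_ ∷ ch) = ends-later l ch
      ... | inj₁ (es , refl , _) = Perm.∈-resp-↭ des↭ (there (subst (edge u y ∈_) (sym (edges-++ es lc)) (∈-++⁺ˡ
              (subst (λ l → edge u y ∈ edges x l) (sym eq) (Perm.∈-resp-↭ (↭-sym (rev-edges↭ (joined-sym {E = F′}) pre)) (here refl))))))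
      ... | inj₂ m = ⊥-elim (x′∉ (rev-∈ pre (subst (λ l → x′ ∈ x ∷ l) eq (front⊆ lc m))))

    -- A cycle that uses the ear uses all of it, by `first-edge` and `follow`. Its other part is a
    -- path of `F` between the ends of the ear, and a total below `ℓ` would make this path the
    -- excluded bypass.
    noShort′ : ∀ {b ds} → IsCycle (Joined F′) b ds → ℓ ≤ length ds
    noShort′ {b} {ds} D with Any.any? (_∈ₑ? edges u os) (edges b ds)
    ... | no none = noShort (cycle-map D λ j m → [ (λ m₁ → ⊥-elim (none (lose m m₁))) , id ]′ (∈-++⁻ (edges u os) j))
    ... | yes some with find some
    ... | f , f∈D , f∈P with startWith (joined-sym {E = F′}) D (first-edge D f∈D f∈P)
    ... | zs , D′@(cycle (_ ∷ dc) du dl) , d↭ , _ with path′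
    ... | pc@(_ ∷ pc′) with follow (forced-by-degree pc (nb-path path!) deg-I) pc′ dc (nb-cycle D′)
    ... | inj₂ u∈ = ⊥-elim (head∉ path! (front⊆ pc′ u∈))
    ... | inj₁ (es , refl , ec) = ℕ.≮⇒≥ λ lt → ¬bypass (rev v es , chain-rev (joined-sym {E = F}) ec′ , rev-unique ec′ es! ,
            subst (_< ℓ) (trans (sym (Perm.↭-length d↭)) (trans (List.length-++ os) (cong (length os +_) (sym (length-rev v es))))) lt)
      where
      es! : Unique (v ∷ es)
      es! = cons-unique (unique-++-disjoint os du (end∈ tail-chain)) (unique-++⁻ʳ os du)
      ec′ : Chain (Joined F) v es u
      ec′ = chain-map ec λ {x} {w} j m → [ (λ m₁ → ⊥-elim (unique-++-disjoint (edges u os)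
               (subst Unique (edges-++ es pc) (cycle-edges-unique D′)) m₁ m)) , id ]′ (∈-++⁻ (edges u os) j)

    reps₁ = branch-step {F = F} {B} {u} {S} {Reps} rep u∈S u∉B (deg≤2 u∉B)

    reps₂ = branch-step {F = F} {u ∷ B} {v} (proj₂ (proj₂ reps₁)) v∈S
              (λ { (here eq) → u≢v (sym eq) ; (there m) → v∉B m }) (deg≤2 v∉B)

    -- The interior of the ear is a path that avoids `B′`, so the single vertex `y` can represent
    -- it. For an ear of one edge, `y` is the end `v` and there is no interior vertex to represent.
    rep′ : Represents F′ S′ B′ (y ∷ proj₁ reps₂)
    rep′ {w} w∈ w∉ with ∈-++⁻ I w∈
    ... | inj₂ w∈S with proj₂ (proj₂ reps₂) w∈S w∉
    ...   | ρ , xs , ρ∈ , ch = ρ , xs , there ρ∈ , chain-map ch (λ (j , p , q) _ → ∈-++⁺ʳ (edges u os) j , p , q)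
    rep′ {w} w∈ w∉ | inj₁ w∈I with split∈ tail-chain (I⊆os w∈I)
    ... | p , q , eq , c₁ , c₂ = y , rev y p , here refl , chain-rev (λ (j , a , b) → joined-sym {E = F′} j , b , a)
            (chain-map c₁ λ {x} {x′} _ m → ∈-++⁺ˡ (there (subst (λ l → edge x x′ ∈ edges y l) (sym eq) (subst (edge x x′ ∈_) (sym (edges-++ q c₁)) (∈-++⁺ˡ m)))) ,
               I∉B′ (in-I (inc-edges m (inc-edgeˡ {u = x} {x′}))) , I∉B′ (in-I (inc-edges m (inc-edgeʳ {u = x} {x′}))))
      where
      v∈q : v ∈ q
      v∈q = end∈′ c₂ (λ { refl → v∉I w∈I })
      in-I : ∀ {x} → x ∈ y ∷ p → x ∈ I
      in-I {x} m with os-cases (subst (λ l → x ∈ y ∷ l) (sym eq) (∈-++⁺ˡ m))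
      ... | inj₁ x∈I = x∈I
      ... | inj₂ refl = ⊥-elim (unique-++-disjoint (y ∷ p) (subst (λ l → Unique (y ∷ l)) eq (tail-unique path!)) m v∈q)

    state : State Γ (suc e) c
    state = record
      { F = F′ ; S = S′ ; B = B′ ; Reps = y ∷ proj₁ reps₂
      ; F⊆R = λ m → [ edge∈⇒R Rsym path , F⊆R ]′ (∈-++⁻ (edges u os) m)
      ; F-edges = λ m → [ (λ m₁ → let (a , b , _ , _ , _ , _ , _ , _ , eq) = edgeSplit path m₁ in a , b , eq) , F-edges ]′ (∈-++⁻ (edges u os) m)
      ; F-ends = λ m i → [ (λ m₁ → end-S (inc-edges m₁ i)) , (λ m₂ → ∈-++⁺ʳ I (F-ends m₂ i)) ]′ (∈-++⁻ (edges u os) m)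
      ; F! = unique-++⁺ (path-edges-unique path path!) F! new
      ; S! = unique-++⁺ (front-unique tail-chain (tail-unique path!)) S! I∉S
      ; size = size′
      ; B-size = trans (cong (2 +_) B-size) (cong suc (sym (ℕ.+-suc e e)))
      ; deg≤3 = deg≤3′ ; deg≤2 = deg≤2′ ; noShort = noShort′
      ; Reps-size = reps-size
      ; rep = rep′
      ; B⊆S = λ { (here refl) → ∈-++⁺ʳ I v∈S ; (there (here refl)) → ∈-++⁺ʳ I u∈S ; (there (there m)) → ∈-++⁺ʳ I (B⊆S m) } }
      where
      end-S : ∀ {w} → w ∈ u ∷ os → w ∈ S′
      end-S (here refl) = ∈-++⁺ʳ I u∈S
      end-S (there m) = [ ∈-++⁺ˡ , (λ { refl → ∈-++⁺ʳ I v∈S }) ]′ (os-cases m)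
      -- An ear has one more edge than inner vertices, so `length F` exceeds `length S` by the
      -- number of ears.
      size′ : length F′ ≡ length S′ + suc e
      size′ = begin
        length F′                          ≡⟨ List.length-++ (edges u os) ⟩
        length (edges u os) + length F     ≡⟨ cong₂ _+_ (length-edges u os) size ⟩
        suc (length ys) + (length S + e)   ≡⟨ cong (λ k → suc k + (length S + e)) (sym (length-front y ys)) ⟩
        suc (length I + (length S + e))    ≡⟨ cong suc (sym (ℕ.+-assoc (length I) (length S) e)) ⟩
        suc (length I + length S + e)      ≡⟨ cong (λ k → suc (k + e)) (sym (List.length-++ I)) ⟩
        suc (length S′ + e)                ≡⟨ sym (ℕ.+-suc (length S′) e) ⟩
        length S′ + suc e                  ∎
        where open ≡-Reasoning
      -- Three new representatives at most: one more for each end that becomes a branch vertex, and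
      -- `y`.
      reps-size : suc (length (proj₁ reps₂)) ≤ (suc e + suc e + suc e) + c
      reps-size = begin
        suc (length (proj₁ reps₂))         ≤⟨ s≤s (proj₁ (proj₂ reps₂)) ⟩
        2 + length (proj₁ reps₁)           ≤⟨ ℕ.+-monoʳ-≤ 2 (proj₁ (proj₂ reps₁)) ⟩
        3 + length Reps                    ≤⟨ ℕ.+-monoʳ-≤ 3 Reps-size ⟩
        3 + ((e + e + e) + c)              ≡⟨ cong (_+ c) (sym three) ⟩
        (suc e + suc e + suc e) + c        ∎
        where
        open ℕ.≤-Reasoning
        three : suc e + suc e + suc e ≡ 3 + (e + e + e)
        three = trans (cong (_+ suc e) (cong suc (ℕ.+-suc e e))) (cong (λ k → suc (suc k)) (ℕ.+-suc (e + e) e))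

-- Cycles with few branch vertices in subcubic graphs

length-filter-¬ : {P : A → Set} (P? : Decidable P) (xs : List A) →
                  length (filter P? xs) + length (filter (λ x → ¬? (P? x)) xs) ≡ length xs
length-filter-¬ P? [] = refl
length-filter-¬ P? (x ∷ xs) with P? x
... | yes p = cong suc (length-filter-¬ P? xs)
... | no ¬p = trans (ℕ.+-suc _ _) (cong suc (length-filter-¬ P? xs))

degSum : List (Fin N × Fin N) → List (Fin N) → ℕ
degSum E [] = 0
degSum E (x ∷ xs) = deg E x + degSum E xs

ends-count : Fin N × Fin N → List (Fin N) → ℕ
ends-count e xs = length (filter (λ x → Inc? x e) xs)

degSum-∷ : ∀ e E (xs : List (Fin N)) → degSum (e ∷ E) xs ≡ ends-count e xs + degSum E xs
degSum-∷ e E [] = refl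
degSum-∷ e E (x ∷ xs) = go (Inc? x e)
  where
  open ≡-Reasoning
  go : Dec (Inc x e) → degSum (e ∷ E) (x ∷ xs) ≡ ends-count e (x ∷ xs) + degSum E (x ∷ xs)
  go (yes i) = begin
    deg (e ∷ E) x + degSum (e ∷ E) xs                      ≡⟨ cong₂ _+_ (deg-∷-inc {E = E} i) (degSum-∷ e E xs) ⟩
    suc (deg E x) + (ends-count e xs + degSum E xs)        ≡⟨ cong suc (swap-left (deg E x) (ends-count e xs) _) ⟩
    suc (ends-count e xs) + (deg E x + degSum E xs)        ≡⟨ cong (_+ (deg E x + degSum E xs)) (sym (cong length (List.filter-accept (λ x → Inc? x e) i))) ⟩
    ends-count e (x ∷ xs) + degSum E (x ∷ xs)              ∎
    where
    swap-left : ∀ a b c → a + (b + c) ≡ b + (a + c)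
    swap-left a b c = trans (sym (ℕ.+-assoc a b c)) (trans (cong (_+ c) (ℕ.+-comm a b)) (ℕ.+-assoc b a c))
  go (no ¬i) = begin
    deg (e ∷ E) x + degSum (e ∷ E) xs                      ≡⟨ cong₂ _+_ (deg-∷-¬inc {E = E} ¬i) (degSum-∷ e E xs) ⟩
    deg E x + (ends-count e xs + degSum E xs)              ≡⟨ sym (ℕ.+-assoc (deg E x) _ _) ⟩
    deg E x + ends-count e xs + degSum E xs                ≡⟨ cong (_+ degSum E xs) (ℕ.+-comm (deg E x) _) ⟩
    ends-count e xs + deg E x + degSum E xs                ≡⟨ ℕ.+-assoc (ends-count e xs) _ _ ⟩
    ends-count e xs + (deg E x + degSum E xs)              ≡⟨ cong (_+ (deg E x + degSum E xs)) (sym (cong length (List.filter-reject (λ x → Inc? x e) ¬i))) ⟩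
    ends-count e (x ∷ xs) + degSum E (x ∷ xs)              ∎

Touches Inside : List (Fin N) → Fin N × Fin N → Set
Touches xs (p , q) = p ∈ xs ⊎ q ∈ xs
Inside xs (p , q) = p ∈ xs × q ∈ xs

touches? : (xs : List (Fin N)) → Decidable (Touches xs)
touches? xs (p , q) = (p ∈? xs) ⊎-dec (q ∈? xs)

inside? : (xs : List (Fin N)) → Decidable (Inside xs)
inside? xs (p , q) = (p ∈? xs) ×-dec (q ∈? xs)

-- In the sum of degrees over `xs` an edge counts once for each of its ends in `xs`: at least once
-- if it touches `xs`, and twice if it lies inside.
handshake : ∀ E {xs : List (Fin N)} → (∀ {f} → f ∈ E → proj₁ f ≢ proj₂ f) →
            length (filter (touches? xs) E) + length (filter (inside? xs) E) ≤ degSum E xs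
handshake [] ne = z≤n
handshake (e@(p , q) ∷ E) {xs} ne = ℕ.≤-trans (go (touches? xs e) (inside? xs e)) (ℕ.≤-reflexive (sym (degSum-∷ e E xs)))
  where
  IH : length (filter (touches? xs) E) + length (filter (inside? xs) E) ≤ degSum E xs
  IH = handshake E (λ m → ne (there m))
  touching = filter (touches? xs)
  within = filter (inside? xs)
  one : Touches xs e → 1 ≤ ends-count e xs
  one (inj₁ m) = unique-⊆-length {xs = [ p ]} ([] ∷ []) (λ { (here refl) → ∈-filter⁺ (λ x → Inc? x e) m (inj₁ refl) })
  one (inj₂ m) = unique-⊆-length {xs = [ q ]} ([] ∷ []) (λ { (here refl) → ∈-filter⁺ (λ x → Inc? x e) m (inj₂ refl) })
  two : Inside xs e → 2 ≤ ends-count e xs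
  two (m , m′) = unique-⊆-length {xs = p ∷ q ∷ []} ((ne (here refl) ∷ []) ∷ [] ∷ [])
    (λ { (here refl) → ∈-filter⁺ (λ x → Inc? x e) m (inj₁ refl) ; (there (here refl)) → ∈-filter⁺ (λ x → Inc? x e) m′ (inj₂ refl) })
  go : Dec (Touches xs e) → Dec (Inside xs e) → length (touching (e ∷ E)) + length (within (e ∷ E)) ≤ ends-count e xs + degSum E xs
  go (no ¬t) (yes (m , _)) = ⊥-elim (¬t (inj₁ m))
  go (no ¬t) (no ¬i) rewrite List.filter-reject (touches? xs) {xs = E} ¬t | List.filter-reject (inside? xs) {xs = E} ¬i =
    ℕ.≤-trans IH (ℕ.m≤n+m _ _)
  go (yes t) (no ¬i) rewrite List.filter-accept (touches? xs) {xs = E} t | List.filter-reject (inside? xs) {xs = E} ¬i =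
    ℕ.+-mono-≤ (one t) IH
  go (yes t) (yes i) rewrite List.filter-accept (touches? xs) {xs = E} t | List.filter-accept (inside? xs) {xs = E} i =
    ℕ.≤-trans (ℕ.≤-reflexive (cong suc (ℕ.+-suc _ _))) (ℕ.+-mono-≤ (two i) IH)

-- The state stripped of the host graph. `Bs` may be any list that contains the vertices of degree
-- three; its having fewer than `2 ^ r` entries is the capacity in the later pigeonhole argument.
record Web {N} (r : ℕ) (E : List (Fin N × Fin N)) (A : List (Fin N)) : Set where
  field
    proper : ∀ {f} → f ∈ E → ∃₂ λ u v → f ≡ edge u v × u ≢ v
    ends   : ∀ {f w} → f ∈ E → Inc w f → w ∈ A
    E!     : Unique E
    A!     : Unique A
    deg≤3  : ∀ v → deg E v ≤ 3
    Bs     : List (Fin N)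
    branch : ∀ {v} → 3 ≤ deg E v → v ∈ Bs
    few    : length Bs < 2 ^ r

module _ {r : ℕ} {E : List (Fin N × Fin N)} {A : List (Fin N)} (W : Web r E A) where
  open Web W

  proper-ne : ∀ {f} → f ∈ E → proj₁ f ≢ proj₂ f
  proper-ne m with proper m
  ... | u , v , refl , u≢v with edge-cases u v
  ... | inj₁ eq = λ e → u≢v (trans (sym (cong proj₁ eq)) (trans e (cong proj₂ eq)))
  ... | inj₂ eq = λ e → u≢v (sym (trans (sym (cong proj₁ eq)) (trans e (cong proj₂ eq))))

  delete : (xs : List (Fin N)) → List (Fin N × Fin N)
  delete xs = filter (λ f → ¬? (touches? xs f)) E

  deleteV : (xs : List (Fin N)) → List (Fin N)
  deleteV xs = filter (λ v → ¬? (v ∈? xs)) A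

  delete⊆ : ∀ xs → delete xs ⊆ E
  delete⊆ xs m = proj₁ (∈-filter⁻ (λ f → ¬? (touches? xs f)) m)

  delete-out : ∀ xs {f w} → f ∈ delete xs → Inc w f → w ∉ xs
  delete-out xs m (inj₁ refl) w∈ = proj₂ (∈-filter⁻ (λ f → ¬? (touches? xs f)) {xs = E} m) (inj₁ w∈)
  delete-out xs m (inj₂ refl) w∈ = proj₂ (∈-filter⁻ (λ f → ¬? (touches? xs f)) {xs = E} m) (inj₂ w∈)

  deg-delete : ∀ xs v → deg (delete xs) v ≤ deg E v
  deg-delete xs v = unique-⊆-length (Unique.filter⁺ (Inc? v) (Unique.filter⁺ (λ f → ¬? (touches? xs f)) E!))
    (λ m → let (m₁ , i) = ∈-filter⁻ (Inc? v) {xs = delete xs} m in ∈-filter⁺ (Inc? v) (delete⊆ xs m₁) i)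

  delete-web : ∀ xs → Web r (delete xs) (deleteV xs)
  delete-web xs = record
    { proper = λ m → proper (delete⊆ xs m)
    ; ends = λ m i → ∈-filter⁺ (λ v → ¬? (v ∈? xs)) (ends (delete⊆ xs m) i) (delete-out xs m i)
    ; E! = Unique.filter⁺ (λ f → ¬? (touches? xs f)) E!
    ; A! = Unique.filter⁺ (λ v → ¬? (v ∈? xs)) A!
    ; deg≤3 = λ v → ℕ.≤-trans (deg-delete xs v) (deg≤3 v)
    ; Bs = Bs ; branch = λ {v} d → branch (ℕ.≤-trans d (deg-delete xs v)) ; few = few }

  -- By `handshake` the edges lost number at most the degree sum minus the inside edges, thus at
  -- most `length xs + d`, against `length xs` lost vertices. The excess drops by no more than `d`.
  delete-excess : ∀ {xs d t} → Unique xs → xs ⊆ A → degSum E xs ≤ length (filter (inside? xs) E) + (length xs + d) →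
                  length A + (d + t) ≤ length E → length (deleteV xs) + t ≤ length (delete xs)
  delete-excess {xs} {d} {t} u sub bound ex = ℕ.+-cancelˡ-≤ (length xs + d) _ _ (begin
      (length xs + d) + (length (deleteV xs) + t)       ≡⟨ shuffle (length xs) d (length (deleteV xs)) t ⟩
      (length xs + length (deleteV xs)) + (d + t)       ≤⟨ ℕ.+-monoˡ-≤ (d + t) vertices ⟩
      length A + (d + t)                                ≤⟨ ex ⟩
      length E                                          ≡⟨ sym (length-filter-¬ (touches? xs) E) ⟩
      length (filter (touches? xs) E) + length (delete xs) ≤⟨ ℕ.+-monoˡ-≤ _ lost ⟩
      (length xs + d) + length (delete xs)              ∎)
    where
    open ℕ.≤-Reasoning
    shuffle : ∀ a b c e → (a + b) + (c + e) ≡ (a + c) + (b + e)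
    shuffle a b c e = trans (ℕ.+-assoc a b (c + e)) (trans (cong (a +_) (trans (sym (ℕ.+-assoc b c e))
      (trans (cong (_+ e) (ℕ.+-comm b c)) (ℕ.+-assoc c b e)))) (sym (ℕ.+-assoc a c (b + e))))
    vertices : length xs + length (deleteV xs) ≤ length A
    vertices = subst (_≤ length A) (List.length-++ xs) (unique-⊆-length
      (unique-++⁺ u (Unique.filter⁺ (λ v → ¬? (v ∈? xs)) A!) (λ m m′ → proj₂ (∈-filter⁻ (λ v → ¬? (v ∈? xs)) {xs = A} m′) m))
      (λ m → [ sub , (λ m′ → proj₁ (∈-filter⁻ (λ v → ¬? (v ∈? xs)) m′)) ]′ (∈-++⁻ xs m)))
    lost : length (filter (touches? xs) E) ≤ length xs + d
    lost = ℕ.+-cancelʳ-≤ (length (filter (inside? xs) E)) _ _ (ℕ.≤-trans (handshake E proper-ne)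
             (ℕ.≤-trans bound (ℕ.≤-reflexive (ℕ.+-comm (length (filter (inside? xs) E)) (length xs + d)))))

record Core {N} (r t : ℕ) (E : List (Fin N × Fin N)) : Set where
  field
    {E′}   : List (Fin N × Fin N)
    {A′}   : List (Fin N)
    web    : Web r E′ A′
    sub    : E′ ⊆ E
    excess : length A′ + t ≤ length E′
    min2   : ∀ {v} → v ∈ A′ → 2 ≤ deg E′ v

-- A vertex of degree at most one takes at most one edge with it, so deleting it does not lower the
-- excess.
core : ∀ k {r t E} {A : List (Fin N)} → length A ≤ k → Web r E A → length A + t ≤ length E → Core r t E
core k {r} {t} {E} {A} h W ex with Any.any? (λ v → deg E v ℕ.≤? 1) A
... | no none = record { web = W ; sub = id ; excess = ex ; min2 = λ m → ℕ.≰⇒> (λ le → none (lose m le)) }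
core zero {A = []} h W ex | yes ()
core (suc k) {r} {t} {E} {A} h W ex | yes some with find some
... | v , v∈ , d≤1 = record { web = Core.web rec ; sub = λ m → delete⊆ W [ v ] (Core.sub rec m) ; excess = Core.excess rec ; min2 = Core.min2 rec }
  where
  bound : degSum E [ v ] ≤ length (filter (inside? [ v ]) E) + 1
  bound = ℕ.≤-trans (ℕ.≤-reflexive (ℕ.+-identityʳ _)) (ℕ.≤-trans d≤1 (ℕ.m≤n+m 1 _))
  smaller : length (deleteV W [ v ]) ≤ k
  smaller = ℕ.≤-pred (ℕ.<-≤-trans (List.filter-notAll (λ w → ¬? (w ∈? [ v ])) A (lose v∈ (λ ¬p → ¬p (here refl)))) h)
  rec : Core r t (delete W [ v ])
  rec = core k smaller (delete-web W [ v ]) (delete-excess W {xs = [ v ]} {d = 0} ([] ∷ []) (λ { (here refl) → v∈ }) bound ex)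

module ShortCycles {N r} {E : List (Fin N × Fin N)} {A : List (Fin N)} (W : Web r E A) (min2 : ∀ {v} → v ∈ A → 2 ≤ deg E v) where
  open Web W

  G : Fin N → Fin N → Set
  G = Joined E

  G-sym : ∀ {u v} → G u v → G v u
  G-sym = joined-sym {E = E}

  G-irr : ∀ {u v} → G u v → u ≢ v
  G-irr {u} j refl with proper j
  ... | a , b , eq , a≢b with edge-inj eq
  ... | inj₁ (refl , refl) = a≢b refl
  ... | inj₂ (refl , refl) = a≢b refl

  branch? : ∀ v → Dec (3 ≤ deg E v)
  branch? v = 3 ℕ.≤? deg E v

  branches : List (Fin N) → List (Fin N)
  branches = filter branch?

  G∈A : ∀ {u v} → G u v → v ∈ A
  G∈A {u} j = ends j (inc-edgeʳ {u = u})

  nbrs : ∀ y → ∃ λ ws → length ws ≡ deg E y × Unique ws × All (G y) ws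
  nbrs y with go (filter (Inc? y) E) (Unique.filter⁺ (Inc? y) E!) (λ m → ∈-filter⁻ (Inc? y) m)
    where
    go : ∀ fs → Unique fs → (∀ {f} → f ∈ fs → f ∈ E × Inc y f) →
         ∃ λ ws → length ws ≡ length fs × Unique ws × All (λ w → edge y w ∈ fs) ws
    go [] u h = [] , refl , [] , []
    go (f ∷ fs) u h with go fs (tail-unique u) (λ m → h (there m)) | h (here refl)
    ... | ws , l , wu , al | f∈E , i with other (proper f∈E) i
      where
      other : (∃₂ λ a b → f ≡ edge a b × a ≢ b) → Inc y f → ∃ λ w → edge y w ≡ f
      other (a , b , refl , _) i with inc-edge⁻ {u = a} {b} i
      ... | inj₁ refl = b , refl
      ... | inj₂ refl = a , edge-comm b a
    ... | w , refl = w ∷ ws , cong suc l , cons-unique (λ m → head∉ u (All.lookup al m)) wu , here refl ∷ All.map there al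
  ... | ws , l , u , al = ws , l , u , All.map (λ m → proj₁ (∈-filter⁻ (Inc? y) m)) al

  next : ∀ {x y} → y ∈ A → ∃ λ w → G y w × w ≢ x
  next {x} {y} y∈ with nbrs y | min2 y∈
  ... | [] , l , _ | d = case subst (2 ≤_) (sym l) d of λ ()
  ... | _ ∷ [] , l , _ | d = case subst (2 ≤_) (sym l) d of λ { (s≤s ()) }
  ... | a ∷ b ∷ _ , l , (a≢b ∷ _) ∷ _ , ja ∷ jb ∷ _ | d with a Fin.≟ x
  ...   | no a≢x = a , ja , a≢x
  ...   | yes refl = b , jb , ≢-sym a≢b

  next₂ : ∀ {x y} → 3 ≤ deg E y → ∃₂ λ w₁ w₂ → w₁ ≢ w₂ × G y w₁ × w₁ ≢ x × G y w₂ × w₂ ≢ x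
  next₂ {x} {y} d with nbrs y
  ... | [] , l , _ = case subst (3 ≤_) (sym l) d of λ ()
  ... | _ ∷ [] , l , _ = case subst (3 ≤_) (sym l) d of λ { (s≤s ()) }
  ... | _ ∷ _ ∷ [] , l , _ = case subst (3 ≤_) (sym l) d of λ { (s≤s (s≤s ())) }
  ... | a ∷ b ∷ c ∷ _ , l , (a≢b ∷ a≢c ∷ _) ∷ (b≢c ∷ _) ∷ _ , ja ∷ jb ∷ jc ∷ _ with a Fin.≟ x | b Fin.≟ x
  ...   | yes refl | _ = b , c , b≢c , jb , ≢-sym a≢b , jc , ≢-sym a≢c
  ...   | no a≢x | yes refl = a , c , a≢c , ja , a≢x , jc , ≢-sym b≢c
  ...   | no a≢x | no b≢x = a , b , a≢b , ja , a≢x , jb , b≢x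

  CycleIn : List (Fin N) → Set
  CycleIn vs = ∃₂ λ a ys → IsCycle G a ys × ys ⊆ vs

  NB : Fin N → Fin N → List (Fin N) → Set
  NB = NonBacktracking {R = G}

  -- The shortest suffix with a repetition returns to its start along otherwise distinct vertices.
  -- Loops are excluded by `G-irr` and closed walks of two steps by not turning back, so a cycle
  -- remains.
  repeat⇒cycle : ∀ {x y ds z} → Chain G x (y ∷ ds) z → NB x y ds → ¬ Unique (x ∷ y ∷ ds) → CycleIn (x ∷ y ∷ ds)
  repeat⇒cycle {x} {y} {ds} (j ∷ c) nb ¬u with unique? Fin._≟_ (y ∷ ds)
  repeat⇒cycle {x} {y} {[]} (j ∷ c) nb ¬u | no ¬u′ = ⊥-elim (¬u′ ([] ∷ []))
  repeat⇒cycle {x} {y} {w ∷ ds} (j ∷ c) (_ ∷ nb) ¬u | no ¬u′ with repeat⇒cycle c nb ¬u′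
  ... | a , ys , C , sub = a , ys , C , λ m → there (sub m)
  repeat⇒cycle {x} {y} {ds} (j ∷ c) nb ¬u | yes u with x ∈? (y ∷ ds)
  ... | no x∉ = ⊥-elim (¬u (cons-unique x∉ u))
  ... | yes x∈ with split∈ c x∈
  ... | p , q , refl , c₁ , _ = x , y ∷ p , cycle (j ∷ c₁) (unique-++⁻ˡ (y ∷ p) u) (len p c₁ nb) , λ m → there (∈-++⁺ˡ m)
    where
    len : ∀ p {q} → Chain G y p x → NB x y (p ++ q) → 3 ≤ length (y ∷ p)
    len [] [] _ = ⊥-elim (G-irr j refl)
    len (w ∷ []) (_ ∷ []) (w≢x ∷ _) = ⊥-elim (w≢x refl)
    len (_ ∷ _ ∷ _) _ _ = s≤s (s≤s (s≤s z≤n))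

  -- If neither walk repeats a vertex, the second one followed up to its first vertex on the first
  -- closes a cycle through `d`; the different first steps keep it from being one edge traversed
  -- twice.
  fork⇒cycle : ∀ {d a α b β z} → Chain G d (a ∷ α) z → NB d a α → Chain G d (b ∷ β) z → NB d b β → a ≢ b →
               CycleIn (d ∷ (a ∷ α) ++ (b ∷ β))
  fork⇒cycle {d} {a} {α} {b} {β} {z} c nb c′ nb′ a≢b with unique? Fin._≟_ (d ∷ a ∷ α) | unique? Fin._≟_ (d ∷ b ∷ β)
  ... | no ¬u | _ with repeat⇒cycle c nb ¬u
  ...   | x , ys , C , sub = x , ys , C , λ m → ∈-++⁺ˡ {xs = d ∷ a ∷ α} (sub m)
  fork⇒cycle {d} {a} {α} {b} {β} c nb c′ nb′ a≢b | yes _ | no ¬u with repeat⇒cycle c′ nb′ ¬u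
  ...   | x , ys , C , sub = x , ys , C , λ m → case sub m of λ
          { (here eq) → here eq ; (there m′) → there (∈-++⁺ʳ (a ∷ α) m′) }
  fork⇒cycle {d} {a} {α} {b} {β} {z} c nb c′@(j′ ∷ c″) nb′ a≢b | yes u | yes u′
    with firstHit (_∈? (a ∷ α)) c″ (Any.map (λ { refl → closed-end∈ c (s≤s z≤n) }) (end∈ c″))
  ... | split h pre post refl c₁ c₂ , h∈ , al with split∈ c (there h∈)
  ... | [] , q , eq , [] , _ = ⊥-elim (head∉ u h∈)
  ... | .a ∷ p , q , refl , e₁@(_ ∷ _) , _ = d , (a ∷ p) ++ rev d (b ∷ pre) ,
        cycle (e₁ ++ᶜ chain-rev G-sym (j′ ∷ c₁)) C! three , C⊆
    where
    back : ∀ {w} → w ∈ rev d (b ∷ pre) → w ∈ d ∷ front b pre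
    back = Perm.∈-resp-↭ (rev↭front d (b ∷ pre))
    u″ : Unique (d ∷ b ∷ pre)
    u″ = unique-++⁻ˡ (d ∷ b ∷ pre) u′
    C! : Unique ((a ∷ p) ++ rev d (b ∷ pre))
    C! = unique-++⁺ (unique-++⁻ˡ (a ∷ p) (tail-unique u)) (tail-unique (rev-unique (j′ ∷ c₁) u″)) λ m m′ → case back m′ of λ
      { (here refl) → head∉ u (∈-++⁺ˡ m) ; (there m″) → All.lookup al m″ (∈-++⁺ˡ m) }
    three : 3 ≤ length ((a ∷ p) ++ rev d (b ∷ pre))
    three = subst (3 ≤_) (sym (trans (List.length-++ (a ∷ p)) (cong (length (a ∷ p) +_) (length-rev d (b ∷ pre))))) (go p pre e₁ c₁)
      where
      go : ∀ p pre → Chain G d (a ∷ p) h → Chain G b pre h → 3 ≤ length (a ∷ p) + length (b ∷ pre)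
      go [] [] (_ ∷ []) [] = ⊥-elim (a≢b refl)
      go [] (_ ∷ _) _ _ = s≤s (s≤s (s≤s z≤n))
      go (_ ∷ p) pre _ _ = s≤s (s≤s (ℕ.≤-trans (s≤s z≤n) (ℕ.m≤n+m _ (length p))))
    C⊆ : ∀ {w} → w ∈ (a ∷ p) ++ rev d (b ∷ pre) → w ∈ d ∷ (a ∷ p ++ q) ++ (b ∷ pre ++ post)
    C⊆ m with ∈-++⁻ (a ∷ p) m
    ... | inj₁ m₁ = there (∈-++⁺ˡ (∈-++⁺ˡ m₁))
    ... | inj₂ m₂ with rev-∈ (j′ ∷ c₁) (there m₂)
    ...   | here eq = here eq
    ...   | there m₃ = there (∈-++⁺ʳ (a ∷ p ++ q) (∈-++⁺ˡ m₃))

  -- A walk from `x` by way of `y` to the next branch vertex `z`. The vertex `pred` before `z` is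
  -- kept because `join` lets any walk that does not go back to it be appended without turning back.
  record Run (x y : Fin N) : Set where
    field
      {pred z} : Fin N
      {ds}     : List (Fin N)
      walk     : Chain G x (y ∷ ds) z
      nb       : NB x y ds
      z-branch : 3 ≤ deg E z
      plain    : All (λ w → ¬ 3 ≤ deg E w) (front y ds)
      join     : ∀ {w es} → w ≢ pred → NB z w es → NB x y (ds ++ w ∷ es)

  FewCycle : Set
  FewCycle = ∃₂ λ a ys → IsCycle G a ys × length (branches ys) ≤ r + r

  toBranch : ∀ k {x y} → G x y → Run x y ⊎ (∃₂ λ ds z → Chain G x (y ∷ ds) z × NB x y ds × length ds ≡ k × All (λ w → ¬ 3 ≤ deg E w) (y ∷ ds))
  toBranch k {x} {y} j with branch? y
  ... | yes b = inj₁ (record { walk = j ∷ [] ; nb = [] ; z-branch = b ; plain = [] ; join = λ w≢x nb → w≢x ∷ nb })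
  toBranch zero {x} {y} j | no ¬b = inj₂ ([] , y , j ∷ [] , [] , refl , ¬b ∷ [])
  toBranch (suc k) {x} {y} j | no ¬b with next {x} (G∈A j)
  ... | w , jw , w≢x with toBranch k jw
  ...   | inj₁ R = inj₁ (record { walk = j ∷ Run.walk R ; nb = w≢x ∷ Run.nb R ; z-branch = Run.z-branch R
            ; plain = ¬b ∷ Run.plain R ; join = λ ne nb → w≢x ∷ Run.join R ne nb })
  ...   | inj₂ (ds , z , c , nb , l , al) = inj₂ (w ∷ ds , z , j ∷ c , w≢x ∷ nb , cong suc l , ¬b ∷ al)

  no-branches : ∀ {ys vs} → ys ⊆ vs → All (λ w → ¬ 3 ≤ deg E w) vs → length (branches ys) ≤ r + r
  no-branches {ys} sub al = ℕ.≤-trans (ℕ.≤-reflexive (cong length (List.filter-none branch? (All.tabulate (λ m → All.lookup al (sub m)))))) z≤n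

  -- After more than `N` steps without a branch vertex the walk has repeated itself, and the
  -- resulting cycle contains no branch vertex at all.
  advance : ∀ {x y} → G x y → Run x y ⊎ FewCycle
  advance {x} {y} j with toBranch N j
  ... | inj₁ R = inj₁ R
  ... | inj₂ ([] , z , c , nb , l , al) = case subst Fin (sym l) x of λ ()
  ... | inj₂ (w ∷ ds , z , _ ∷ c , _ ∷ nb , l , al)
    with repeat⇒cycle c nb (λ u → ℕ.<⇒≱ (s≤s (ℕ.≤-reflexive (sym l))) (unique-length≤ u))
  ...   | a , ys , C , sub = inj₂ (a , ys , C , no-branches sub al)

  record Walk (x : Fin N) (k : ℕ) : Set where
    constructor mkWalk
    field
      {y z} : Fin N
      {ds}  : List (Fin N)
      walk  : Chain G x (y ∷ ds) z
      nb    : NB x y ds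
      z-branch : 3 ≤ deg E z
      few   : length (branches (y ∷ ds)) ≤ k
    steps : List (Fin N)
    steps = y ∷ ds

  -- Stronger than inequality: neither list is a prefix of the other. So two diverging walks with a
  -- common end split at a definite vertex, where `fork⇒cycle` applies.
  data Diverge : List (Fin N) → List (Fin N) → Set where
    here  : ∀ {a b xs ys} → a ≢ b → Diverge (a ∷ xs) (b ∷ ys)
    there : ∀ {a xs ys} → Diverge xs ys → Diverge (a ∷ xs) (a ∷ ys)

  diverge-++ : ∀ p {xs ys} → Diverge xs ys → Diverge (p ++ xs) (p ++ ys)
  diverge-++ [] d = d
  diverge-++ (x ∷ p) d = there (diverge-++ p d)

  Bouquet : Fin N → ℕ → ℕ → Set
  Bouquet x k m = ∃ λ (L : List (Walk x k)) → length L ≡ m × AllPairs (λ w w′ → Diverge (Walk.steps w) (Walk.steps w′)) L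

  StartsWith : ∀ {x k} → Fin N → Walk x k → Set
  StartsWith y w = Walk.y w ≡ y

  -- The size has the form to which `2 * m` reduces, so that in `bouquet` the powers of two match
  -- definitionally.
  both : ∀ {x k m y₁ y₂} → y₁ ≢ y₂ → (b₁ : Bouquet x k m) → All (StartsWith y₁) (proj₁ b₁) →
         (b₂ : Bouquet x k m) → All (StartsWith y₂) (proj₁ b₂) → Bouquet x k (m + (m + 0))
  both {m = m} ne (L₁ , l₁ , d₁) s₁ (L₂ , l₂ , d₂) s₂ = L₁ ++ L₂ ,
    trans (List.length-++ L₁) (cong₂ _+_ l₁ (trans l₂ (sym (ℕ.+-identityʳ m)))) ,
    AllPairs.++⁺ d₁ d₂ (All.map (λ { {mkWalk _ _ _ _} refl → All.map (λ { {mkWalk _ _ _ _} refl → here ne }) s₂ }) s₁)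

  run-branches : ∀ {x y} (R : Run x y) → length (branches (y ∷ Run.ds R)) ≤ 1
  run-branches {x} {y} R = subst (λ l → length (branches l) ≤ 1) (front-end (tailᶜ (Run.walk R))) (subst (_≤ 1)
      (sym (trans (cong length (List.filter-++ branch? (front y (Run.ds R)) [ Run.z R ]))
        (trans (List.length-++ (branches (front y (Run.ds R)))) (cong (_+ length (branches [ Run.z R ]))
          (cong length (List.filter-none branch? (Run.plain R)))))))
      (List.length-filter branch? [ Run.z R ]))
    where
    tailᶜ : ∀ {x y ds z} → Chain G x (y ∷ ds) z → Chain G y ds z
    tailᶜ (_ ∷ c) = c

  prefix-walk : ∀ {x y k} (R : Run x y) → (w : Walk (Run.z R) k) → Walk.y w ≢ Run.pred R → Walk x (suc k)
  prefix-walk {x} {y} {k} R w ne = mkWalk (Run.walk R ++ᶜ Walk.walk w) (Run.join R ne (Walk.nb w)) (Walk.z-branch w)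
    (subst (_≤ suc k) (sym (trans (cong length (List.filter-++ branch? (y ∷ Run.ds R) (Walk.steps w))) (List.length-++ (branches (y ∷ Run.ds R)))))
      (ℕ.+-mono-≤ (run-branches R) (Walk.few w)))

  prefix-all : ∀ {x y k m} (R : Run x y) (b : Bouquet (Run.z R) k m) → All (λ w → Walk.y w ≢ Run.pred R) (proj₁ b) →
               ∃ λ (b′ : Bouquet x (suc k) m) → All (StartsWith y) (proj₁ b′)
  prefix-all {x} {y} {k} R (L , l , d) ne with go L d ne
    where
    go : ∀ L → AllPairs (λ w w′ → Diverge (Walk.steps w) (Walk.steps w′)) L → All (λ w → Walk.y w ≢ Run.pred R) L →
         ∃ λ (L′ : List (Walk x (suc k))) → length L′ ≡ length L × AllPairs (λ w w′ → Diverge (Walk.steps w) (Walk.steps w′)) L′ ×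
           All (StartsWith y) L′ × (∀ vs → All (λ w → Diverge vs (Walk.steps w)) L → All (λ w → Diverge ((y ∷ Run.ds R) ++ vs) (Walk.steps w)) L′)
    go [] [] [] = [] , refl , [] , [] , λ _ _ → []
    go (w ∷ L) (a ∷ d) (ne ∷ nes) with go L d nes
    ... | L′ , l′ , d′ , s′ , f = prefix-walk R w ne ∷ L′ , cong suc l′ , f (Walk.steps w) a ∷ d′ , refl ∷ s′ ,
          λ { vs (g ∷ gs) → diverge-++ (y ∷ Run.ds R) g ∷ f vs gs }
  ... | L′ , l′ , d′ , s′ , _ = (L′ , trans l′ l , d′) , s′

  -- Each branch vertex reached offers two continuations besides the way back, so the number of
  -- walks doubles while each takes in one more branch vertex.
  bouquet : ∀ k {x y} → G x y → (∃ λ (b : Bouquet x (suc k) (2 ^ k)) → All (StartsWith y) (proj₁ b)) ⊎ FewCycle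
  bouquet k j with advance j
  ... | inj₂ C = inj₂ C
  bouquet zero j | inj₁ R = inj₁ ((mkWalk (Run.walk R) (Run.nb R) (Run.z-branch R) (run-branches R) ∷ [] , refl , [] ∷ []) , refl ∷ [])
  bouquet (suc k) j | inj₁ R with next₂ {Run.pred R} (Run.z-branch R)
  ... | w₁ , w₂ , w₁≢w₂ , j₁ , n₁ , j₂ , n₂ with bouquet k j₁ | bouquet k j₂
  ... | inj₂ C | _ = inj₂ C
  ... | inj₁ _ | inj₂ C = inj₂ C
  ... | inj₁ (b₁ , s₁) | inj₁ (b₂ , s₂) = inj₁ (prefix-all R (both w₁≢w₂ b₁ s₁ b₂ s₂)
          (All.++⁺ (All.map (λ { refl → n₁ }) s₁) (All.map (λ { refl → n₂ }) s₂)))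

  diverge⇒cycle : ∀ {x k} (w w′ : Walk x k) → Diverge (Walk.steps w) (Walk.steps w′) → Walk.z w ≡ Walk.z w′ →
                  CycleIn (x ∷ Walk.steps w ++ Walk.steps w′)
  diverge⇒cycle (mkWalk c nb _ _) (mkWalk c′ nb′ _ _) d refl = go c nb c′ nb′ d
    where
    go : ∀ {x y ds y′ ds′ z} → Chain G x (y ∷ ds) z → NB x y ds → Chain G x (y′ ∷ ds′) z → NB x y′ ds′ →
         Diverge (y ∷ ds) (y′ ∷ ds′) → CycleIn (x ∷ (y ∷ ds) ++ (y′ ∷ ds′))
    go c nb c′ nb′ (here a≢b) = fork⇒cycle c nb c′ nb′ a≢b
    go {x} {y} {l@(_ ∷ _)} {_} {l′@(_ ∷ _)} (_ ∷ c) (_ ∷ nb) (_ ∷ c′) (_ ∷ nb′) (there d) with go c nb c′ nb′ d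
    ... | a , ys , C , sub = a , ys , C , λ m → wider (sub m)
      where
      wider : ∀ {w} → w ∈ y ∷ l ++ l′ → w ∈ x ∷ (y ∷ l) ++ (y ∷ l′)
      wider (here eq) = there (here eq)
      wider (there m) with ∈-++⁻ l m
      ... | inj₁ m₁ = there (there (∈-++⁺ˡ m₁))
      ... | inj₂ m₂ = there (there (∈-++⁺ʳ l (there m₂)))

  -- The cycle can contain the start `x`, at most `r` branch vertices of `w` and at most `r` of
  -- `w′`. The common end is counted twice in this, which makes up for `x`.
  collide⇒few : ∀ {x} (w w′ : Walk x r) → Diverge (Walk.steps w) (Walk.steps w′) → Walk.z w ≡ Walk.z w′ → FewCycle
  collide⇒few {x} w w′ d eq with diverge⇒cycle w w′ d eq
  ... | a , ys , C , sub = a , ys , C , ℕ.≤-trans (unique-⊆-length (Unique.filter⁺ branch? (unique C)) inside) size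
    where
    z = Walk.z w′
    bs′ = branches (Walk.steps w′)
    cut = filter (λ v → ¬? (v Fin.≟ z)) bs′
    end∈steps : ∀ {k} (w : Walk x k) → Walk.z w ∈ branches (Walk.steps w)
    end∈steps w = ∈-filter⁺ branch? (closed-end∈ (Walk.walk w) (s≤s z≤n)) (Walk.z-branch w)
    bound : List (Fin N)
    bound = x ∷ branches (Walk.steps w) ++ cut
    inside : branches ys ⊆ bound
    inside {v} m with ∈-filter⁻ branch? {xs = ys} m
    ... | v∈ , bv with sub v∈
    ... | here refl = here refl
    ... | there m′ with ∈-++⁻ (Walk.steps w) m′
    ...   | inj₁ m₁ = there (∈-++⁺ˡ (∈-filter⁺ branch? m₁ bv))
    ...   | inj₂ m₂ with v Fin.≟ z
    ...     | yes refl = there (∈-++⁺ˡ (subst (_∈ branches (Walk.steps w)) eq (end∈steps w)))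
    ...     | no v≢z = there (∈-++⁺ʳ (branches (Walk.steps w)) (∈-filter⁺ (λ v → ¬? (v Fin.≟ z)) (∈-filter⁺ branch? m₂ bv) v≢z))
    size : length bound ≤ r + r
    size = begin
      suc (length (branches (Walk.steps w) ++ cut))        ≡⟨ cong suc (List.length-++ (branches (Walk.steps w))) ⟩
      suc (length (branches (Walk.steps w)) + length cut)  ≡⟨ sym (ℕ.+-suc _ _) ⟩
      length (branches (Walk.steps w)) + suc (length cut)  ≤⟨ ℕ.+-mono-≤ (Walk.few w) (ℕ.≤-trans
          (List.filter-notAll (λ v → ¬? (v Fin.≟ z)) bs′ (lose (end∈steps w′) (λ ¬p → ¬p refl))) (Walk.few w′)) ⟩
      r + r                                                ∎
      where open ℕ.≤-Reasoning

  pigeon : ∀ {k x} (L : List (Walk x k)) → AllPairs (λ w w′ → Diverge (Walk.steps w) (Walk.steps w′)) L →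
           ¬ Unique (map Walk.z L) → ∃₂ λ (w w′ : Walk x k) → Diverge (Walk.steps w) (Walk.steps w′) × Walk.z w ≡ Walk.z w′
  pigeon [] _ ¬u = ⊥-elim (¬u [])
  pigeon (w ∷ L) (a ∷ d) ¬u with Walk.z w ∈? map Walk.z L
  ... | no z∉ = pigeon L d (λ u → ¬u (cons-unique z∉ u))
  ... | yes z∈ with ∈-map⁻ Walk.z z∈
  ...   | w′ , w′∈ , eq = w , w′ , All.lookup a w′∈ , eq

  -- Two bouquets of `2 ^ r′` walks leave `v` by different edges. Their `2 ^ r` ends are branch
  -- vertices, of which there are fewer, so two walks collide.
  fewCycle : ∀ {v r′} → r ≡ suc r′ → 3 ≤ deg E v → FewCycle
  fewCycle {v} {r′} refl d with next₂ {v} d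
  ... | w₁ , w₂ , w₁≢w₂ , j₁ , _ , j₂ , _ with bouquet r′ j₁ | bouquet r′ j₂
  ... | inj₂ C | _ = C
  ... | inj₁ _ | inj₂ C = C
  ... | inj₁ (b₁ , s₁) | inj₁ (b₂ , s₂) with both w₁≢w₂ b₁ s₁ b₂ s₂
  ... | L , l , dv with pigeon L dv (λ u → ℕ.<⇒≱ few (subst (_≤ length Bs) (trans (List.length-map Walk.z L) l)
          (unique-⊆-length u (λ m → case ∈-map⁻ Walk.z m of λ { (w , _ , refl) → branch (Walk.z-branch w) }))))
  ... | w , w′ , dd , eq = collide⇒few w w′ dd eq

module _ {r : ℕ} {E : List (Fin N × Fin N)} {A : List (Fin N)} (W : Web r E A) where
  open Web W

  -- If all degrees were at most two, twice the number of edges would be at most twice the number of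
  -- vertices.
  branch-exists : length A + 1 ≤ length E → ∃ λ v → 3 ≤ deg E v
  branch-exists ex with Any.any? (λ v → 3 ℕ.≤? deg E v) A
  ... | yes some = let (v , _ , d) = find some in v , d
  ... | no none = ⊥-elim (ℕ.<⇒≱ (ℕ.+-mono-< lt lt) (ℕ.≤-trans both (small A (λ m → ℕ.≤-pred (ℕ.≰⇒> (λ d → none (lose m d)))))))
    where
    lt : length A < length E
    lt = subst (_≤ length E) (ℕ.+-comm (length A) 1) ex
    small : ∀ xs → (∀ {v} → v ∈ xs → deg E v ≤ 2) → degSum E xs ≤ length xs + length xs
    small [] _ = z≤n
    small (x ∷ xs) h = ℕ.≤-trans (ℕ.+-mono-≤ (h (here refl)) (small xs (λ m → h (there m))))
      (ℕ.≤-reflexive (cong suc (sym (ℕ.+-suc (length xs) (length xs)))))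
    both : length E + length E ≤ degSum E A
    both = subst₂ (λ x y → length x + length y ≤ degSum E A)
      (List.filter-all (touches? A) (All.tabulate (λ m → inj₁ (ends m (inj₁ refl)))))
      (List.filter-all (inside? A) (All.tabulate (λ m → ends m (inj₁ refl) , ends m (inj₂ refl))))
      (handshake E (proper-ne W))

  -- Degrees on the cycle are at most two, plus one at each branch vertex, and the cycle supplies
  -- `length ys` inside edges. Hence deleting it lowers the excess by at most its number of branch
  -- vertices.
  cycle-bound : ∀ {a ys} → IsCycle (Joined E) a ys →
                degSum E ys ≤ length (filter (inside? ys) E) + (length ys + length (filter (λ v → 3 ℕ.≤? deg E v) ys))
  cycle-bound {a} {ys} C = ℕ.≤-trans (sum≤ ys) (ℕ.+-monoˡ-≤ _ inner)
    where
    bs = filter (λ v → 3 ℕ.≤? deg E v)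
    sum≤ : ∀ xs → degSum E xs ≤ length xs + (length xs + length (bs xs))
    sum≤ [] = z≤n
    sum≤ (x ∷ xs) = go (3 ℕ.≤? deg E x)
      where
      open ℕ.≤-Reasoning
      go : Dec (3 ≤ deg E x) → deg E x + degSum E xs ≤ suc (length xs + (suc (length xs) + length (bs (x ∷ xs))))
      go (yes p) = begin
        deg E x + degSum E xs                                      ≤⟨ ℕ.+-mono-≤ (deg≤3 x) (sum≤ xs) ⟩
        3 + (length xs + (length xs + length (bs xs)))             ≡⟨ cong (λ k → suc (suc k)) (sym (ℕ.+-suc (length xs) _)) ⟩
        2 + (length xs + suc (length xs + length (bs xs)))         ≡⟨ cong (λ k → 2 + (length xs + k)) (sym (ℕ.+-suc (length xs) _)) ⟩
        2 + (length xs + (length xs + suc (length (bs xs))))       ≡⟨ cong suc (sym (ℕ.+-suc (length xs) _)) ⟩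
        suc (length xs + (suc (length xs) + suc (length (bs xs)))) ≡⟨ cong (λ k → suc (length xs + (suc (length xs) + k))) (sym (cong length (List.filter-accept (λ v → 3 ℕ.≤? deg E v) p))) ⟩
        suc (length xs + (suc (length xs) + length (bs (x ∷ xs)))) ∎
      go (no ¬p) = begin
        deg E x + degSum E xs                                      ≤⟨ ℕ.+-mono-≤ (ℕ.≤-pred (ℕ.≰⇒> ¬p)) (sum≤ xs) ⟩
        2 + (length xs + (length xs + length (bs xs)))             ≡⟨ cong suc (sym (ℕ.+-suc (length xs) _)) ⟩
        suc (length xs + (suc (length xs) + length (bs xs)))       ≡⟨ cong (λ k → suc (length xs + (suc (length xs) + k))) (sym (cong length (List.filter-reject (λ v → 3 ℕ.≤? deg E v) ¬p))) ⟩
        suc (length xs + (suc (length xs) + length (bs (x ∷ xs)))) ∎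
    inner : length ys ≤ length (filter (inside? ys) E)
    inner = subst (_≤ _) (length-edges a ys) (unique-⊆-length (cycle-edges-unique C) λ m →
      ∈-filter⁺ (inside? ys) (on-E m) (cycle-∈ C (inc-edges m (inj₁ refl)) , cycle-∈ C (inc-edges m (inj₂ refl))))
      where
      on-E : edges a ys ⊆ E
      on-E m with edgeSplit (chain C) m
      ... | _ , _ , _ , _ , _ , _ , j , _ , refl = j

DisjointIn : ∀ {N} → ℕ → List (Fin N × Fin N) → Set
DisjointIn {N} k E = ∃ λ (cs : List (Fin N × List (Fin N))) → k ≤ length cs ×
  All (λ (a , ys) → IsCycle (Joined E) a ys) cs × AllPairs DisjointCycles cs

core-few : ∀ {r′ t} {E : List (Fin N × Fin N)} (K : Core (suc r′) t E) → 1 ≤ t → ShortCycles.FewCycle (Core.web K) (Core.min2 K)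
core-few K 1≤t = ShortCycles.fewCycle web min2 refl (proj₂ (branch-exists web (ℕ.≤-trans (ℕ.+-monoʳ-≤ (length A′) 1≤t) excess)))
  where open Core K

-- Simonovits' argument: there is always a cycle through at most 2r vertices of degree 3, and deleting it lowers
-- the excess length E − length A by at most 2r.
mutual
  simonovits : ∀ k {r′} → (let r = suc r′) → {E : List (Fin N × Fin N)} {A : List (Fin N)} → Web r E A →
               length A + (k * (r + r) + 1) ≤ length E → DisjointIn (suc k) E
  simonovits k W ex = peel k K (core-few K (ℕ.m≤n+m 1 _))
    where K = core _ ℕ.≤-refl W ex

  peel : ∀ k {r′} → (let r = suc r′) → {E : List (Fin N × Fin N)} (K : Core r (k * (r + r) + 1) E) →
         ShortCycles.FewCycle (Core.web K) (Core.min2 K) → DisjointIn (suc k) E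
  peel zero K (a , ys , C , _) = (a , ys) ∷ [] , s≤s z≤n , cycle-map C (λ j _ → Core.sub K j) ∷ [] , [] ∷ []
  peel (suc k) {r′} {E} K (a , ys , C , lb) = extend (simonovits k (delete-web web ys) excess′)
    where
    open Core K
    ys⊆ : ys ⊆ A′
    ys⊆ m with edges-vertex (chain C) m
    ... | e , e∈ , i = Web.ends web e∈ i
    excess′ : length (deleteV web ys) + (k * (suc r′ + suc r′) + 1) ≤ length (delete web ys)
    excess′ = delete-excess web (unique C) ys⊆ (ℕ.≤-trans (cycle-bound web C)
        (ℕ.+-monoʳ-≤ (length (filter (inside? ys) E′)) (ℕ.+-monoʳ-≤ (length ys) lb)))
        (subst (λ t → length A′ + t ≤ length E′) (ℕ.+-assoc (suc r′ + suc r′) _ 1) excess)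
    extend : DisjointIn (suc k) (delete web ys) → DisjointIn (suc (suc k)) E
    extend (cs , l , al , dj) = (a , ys) ∷ cs , s≤s l ,
      cycle-map C (λ j _ → sub j) ∷ All.map (λ D → cycle-map D (λ j _ → sub (delete⊆ web ys j))) al ,
      All.map (λ D {w} m m′ → let (e , e∈ , i) = edges-vertex (chain D) m′ in delete-out web ys e∈ i m) al ∷ dj

-- Packing or hitting set in a graph with a gap

module Gap {N} (Γ : GapGraph N) where
  open GapGraph Γ

  LongCycleOff : List (Fin N) → Set
  LongCycleOff S = ∃₂ λ a ys → length ys ≤ N × IsCycle R a ys × ℓ ≤ length ys × All (_∉ S) ys

  longCycleOff? : ∀ S → Dec (LongCycleOff S)
  longCycleOff? S = Fin.any? λ a → ∃-list? (λ ys → isCycle? R? a ys ×-dec ((ℓ ℕ.≤? length ys) ×-dec All.all? (λ w → ¬? (w ∈? S)) ys)) N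

  Start : ℕ → Set
  Start k = ∃ λ c → c ≤ k × Σ (State Γ 0 c) λ St → Meets Γ (State.S St)

  -- A greedy choice of disjoint long cycles, `f` of which are missing for a packing. When no
  -- further one avoids `S`, every long cycle meets it.
  start : ∀ f {c k} → c + f ≡ suc k → (St : State Γ 0 c) (cs : List (Fin N × List (Fin N))) → length cs ≡ c →
          All (GoodCycle R ℓ) cs → AllPairs DisjointCycles cs → All (λ x → proj₂ x ⊆ State.S St) cs → Packing R ℓ (suc k) ⊎ Start k
  start zero {c} {k} eq St cs l good dj _ = inj₁ (record
    { cycles = cs ; count = ℕ.≤-reflexive (sym (trans l (trans (sym (ℕ.+-identityʳ c)) eq))) ; good = good ; disjoint = dj })
  start (suc f) {c} {k} eq St cs l good dj within with longCycleOff? (State.S St)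
  ... | no none = inj₂ (c , ℕ.≤-pred (subst (suc c ≤_) (trans (sym (ℕ.+-suc c f)) eq) (s≤s (ℕ.m≤m+n c f))) , St , meets)
    where
    meets : Meets Γ (State.S St)
    meets {a} {ys} C ℓ≤ with Any.any? (_∈? State.S St) ys
    ... | yes m = m
    ... | no ¬m = ⊥-elim (none (a , ys , unique-length≤ (unique C) , C , ℓ≤ , All.¬Any⇒All¬ ys ¬m))
  ... | yes (a , ys , _ , C , ℓ≤ , off) = start f (trans (sym (ℕ.+-suc c f)) eq) (A.state) ((a , ys) ∷ cs) (cong suc l)
          ((C , ℓ≤) ∷ good) (All.map (λ s {w} m m′ → All.lookup off m (s m′)) within ∷ dj)
          ((λ {w} m → ∈-++⁺ˡ m) ∷ All.map (λ s {w} m → ∈-++⁺ʳ ys (s m)) within)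
    where
    module A = Growth.AddCycle St C ℓ≤ (All.lookup off)

  module _ {e c : ℕ} (St : State Γ e c) where
    open State St
    open Ears St

    bypass? : ∀ u os v → Dec (ShortBypass u os v)
    bypass? u os v = map′ (λ (qs , _ , b) → qs , b) (λ (qs , b@(_ , u! , _)) → qs , unique-length≤ (tail-unique u!) , b)
      (∃-list? (λ qs → chain? (joined? F) u qs v ×-dec (unique? Fin._≟_ (u ∷ qs) ×-dec (length os + length qs ℕ.<? ℓ))) N)

    openEar? : ∀ u os v → Dec (OpenEar u os v)
    openEar? u os v with chain? R? u os v ×-dec ((u ∈? S) ×-dec (¬? (u ∈? B) ×-dec ((v ∈? S) ×-dec (¬? (v ∈? B) ×-dec (¬? (u Fin.≟ v) ×-dec
        (unique? Fin._≟_ (u ∷ os) ×-dec (All.all? (λ w → (w Fin.≟ v) ⊎-dec ¬? (w ∈? S)) os ×-dec All.all? (λ f → ¬? (f ∈ₑ? F)) (edges u os))))))))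
    ... | yes (p , us , ub , vs , vb , ne , un , i , nw) = yes (record
        { path = p ; u∈S = us ; u∉B = ub ; v∈S = vs ; v∉B = vb ; u≢v = ne ; path! = un ; interior = All.lookup i ; new = All.lookup nw })
    ... | no ¬H = no λ H → let open OpenEar H in
        ¬H (path , u∈S , u∉B , v∈S , v∉B , u≢v , path! , All.tabulate interior , All.tabulate new)

    ear-or-stuck : (∃₂ λ u v → ∃ λ os → length os ≤ N × OpenEar u os v × ¬ ShortBypass u os v) ⊎ Stuck
    ear-or-stuck with Fin.any? (λ u → Fin.any? λ v → ∃-list? (λ os → openEar? u os v ×-dec ¬? (bypass? u os v)) N)
    ... | yes H = inj₁ H
    ... | no none = inj₂ λ {u} {os} {v} H → decidable-stable (bypass? u os v)
            (λ ¬b → none (u , v , os , unique-length≤ (tail-unique (OpenEar.path! H)) , H , ¬b))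

  HittingSet : ℕ → Set
  HittingSet b = ∃ λ Y → length Y ≤ b × (∀ {a ys} → IsCycle R a ys → (∀ {w} → w ∈ ys → w ∉ Y) → length ys < ℓ)

  weaken : ∀ {j k} → j ≤ k → Packing R ℓ k → Packing R ℓ j
  weaken j≤k P = record { cycles = cycles ; count = ℕ.≤-trans j≤k count ; good = good ; disjoint = disjoint }
    where open Packing P

  hitting-size : ∀ e c k → (e + e) + (((e + e + e) + c) + k) ≡ e * 5 + (c + k)
  hitting-size = solve 3 (λ e c k → (e :+ e) :+ (((e :+ e :+ e) :+ c) :+ k) := e :* con 5 :+ (c :+ k)) refl
    where open +-*-Solver

  -- With `e` ears there are `e + e` entries in `B`, at most `e + e + e + c` in `X`, and at most `k`
  -- in `Z` unless `Z` already gives a packing. This is where five vertices per ear come from.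
  stuck⇒hitting : ∀ {e c k m} (St : State Γ e c) → Meets Γ (State.S St) → Ears.Stuck St → c ≤ k → e ≤ m →
                  Packing R ℓ (suc k) ⊎ HittingSet (m * 5 + (k + k))
  stuck⇒hitting {e} {c} {k} {m} St meets stuck c≤k e≤m with Hitting.hitters St stuck meets
  ... | X , Z , X-size , P , hits with suc k ℕ.≤? length Z
  ... | yes k< = inj₁ (weaken k< P)
  ... | no k≮ = inj₂ (B ++ X ++ Z , size≤ , λ C off → hits C (λ m → (λ b → off m (∈-++⁺ˡ b)) , λ x → off m (∈-++⁺ʳ B (∈-++⁺ˡ x)))
                         (λ m z → off m (∈-++⁺ʳ B (∈-++⁺ʳ X z))))
    where
    open State St
    open ℕ.≤-Reasoning
    size≤ : length (B ++ X ++ Z) ≤ m * 5 + (k + k)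
    size≤ = begin
      length (B ++ X ++ Z)                        ≡⟨ trans (List.length-++ B) (cong (length B +_) (List.length-++ X)) ⟩
      length B + (length X + length Z)            ≤⟨ ℕ.+-mono-≤ (ℕ.≤-reflexive B-size)
                                                       (ℕ.+-mono-≤ (ℕ.≤-trans X-size Reps-size) (ℕ.≤-pred (ℕ.≰⇒> k≮))) ⟩
      (e + e) + (((e + e + e) + c) + k)           ≡⟨ hitting-size e c k ⟩
      e * 5 + (c + k)                             ≤⟨ ℕ.+-mono-≤ (ℕ.*-monoˡ-≤ 5 e≤m) (ℕ.+-monoˡ-≤ k c≤k) ⟩
      m * 5 + (k + k)                             ∎

  -- The excess of `F` is exactly its number of ears, and `noShort` makes every cycle of `F` long,
  -- so `simonovits` can be applied without regard to lengths.
  large⇒packing : ∀ {k r′ c} → (let r = suc r′ ; e = k * (r + r) + 1) → State Γ e c → e + e < 2 ^ r → Packing R ℓ (suc k)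
  large⇒packing {k} {r′} St small = lift (simonovits k {r′} web (ℕ.≤-reflexive (sym size)))
    where
    open State St
    proper : ∀ {f} → f ∈ F → ∃₂ λ u v → f ≡ edge u v × u ≢ v
    proper m with F-edges m
    ... | u , v , refl = u , v , refl , Rirr (F⊆R m)
    web : Web (suc r′) F S
    web = record { proper = proper ; ends = F-ends ; E! = F! ; A! = S! ; deg≤3 = deg≤3 ; Bs = B
                 ; branch = λ {v} d → decidable-stable (v ∈? B) (λ v∉ → ℕ.<⇒≱ d (deg≤2 v∉)) ; few = subst (_< _) (sym B-size) small }
    lift : DisjointIn (suc k) F → Packing R ℓ (suc k)
    lift (cs , l , al , dj) = record { cycles = cs ; count = l ; good = All.map (λ C → cycle-map C (λ j _ → F⊆R j) , noShort C) al ; disjoint = dj }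

  grow : ∀ f {e c k r′} → (let r = suc r′) → e + f ≡ k * (r + r) + 1 → c ≤ k → (k * (r + r) + 1) + (k * (r + r) + 1) < 2 ^ r →
         (St : State Γ e c) → Meets Γ (State.S St) → Packing R ℓ (suc k) ⊎ HittingSet ((k * (r + r)) * 5 + (k + k))
  grow zero {e} {k = k} {r′} eq c≤k small St meets =
    inj₁ (large⇒packing {k} {r′} (subst (λ e → State Γ e _) (trans (sym (ℕ.+-identityʳ e)) eq) St) small)
  grow (suc f) {e} {c} {k} {r′} eq c≤k small St meets = go (ear-or-stuck St)
    where
    eq′ : suc (e + f) ≡ k * (suc r′ + suc r′) + 1
    eq′ = trans (sym (ℕ.+-suc e f)) eq
    go : (∃₂ λ u v → ∃ λ os → length os ≤ N × Ears.OpenEar St u os v × ¬ Ears.ShortBypass St u os v) ⊎ Ears.Stuck St →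
         Packing R ℓ (suc k) ⊎ HittingSet ((k * (suc r′ + suc r′)) * 5 + (k + k))
    -- At least one ear is still missing here, so `e` is at most `k * (r + r)` without the added
    -- one.
    go (inj₂ stuck) = stuck⇒hitting St meets stuck c≤k (ℕ.≤-pred (subst (suc e ≤_) (trans eq′ (ℕ.+-comm _ 1)) (s≤s (ℕ.m≤m+n e f))))
    go (inj₁ (u , v , [] , _ , H , _)) = ⊥-elim (closed (Ears.OpenEar.path H) (Ears.OpenEar.u≢v H))
      where
      closed : ∀ {x y} → Chain R x [] y → x ≢ y → ⊥
      closed [] x≢x = x≢x refl
    go (inj₁ (u , v , y ∷ ys , _ , H , ¬b)) =
      grow f eq′ c≤k small (Growth.AddEar.state St H ¬b) (λ C ℓ≤ → Any.map (∈-++⁺ʳ (front y ys)) (meets C ℓ≤))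

  pack-or-hit : ∀ k r′ → (let r = suc r′) → (k * (r + r) + 1) + (k * (r + r) + 1) < 2 ^ r →
                Packing R ℓ (suc k) ⊎ HittingSet ((k * (r + r)) * 5 + (k + k))
  pack-or-hit k r′ small = go (start (suc k) refl Growth.emptyState [] refl [] [] [])
    where
    go : Packing R ℓ (suc k) ⊎ Start k → Packing R ℓ (suc k) ⊎ HittingSet ((k * (suc r′ + suc r′)) * 5 + (k + k))
    go (inj₁ P) = inj₁ P
    go (inj₂ (c , c≤k , St , meets)) = grow _ refl c≤k small St meets

-- Disjoint cycles of prescribed lengths

module Selection {N k : ℕ} (R₀ : Fin N → Fin N → Set) (R₀? : ∀ u v → Dec (R₀ u v)) (R₀-sym : ∀ {u v} → R₀ u v → R₀ v u)
                 (R₀-irr : ∀ {u v} → R₀ u v → u ≢ v) (len : Fin k → ℕ) (3≤len : ∀ i → 3 ≤ len i) where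

  Off : List (Fin N) → Fin N → Fin N → Set
  Off Y u v = R₀ u v × u ∉ Y × v ∉ Y

  off-avoids : ∀ {Y a ys w} → IsCycle (Off Y) a ys → w ∈ ys → w ∉ Y
  off-avoids C m with ∈⇒inc (chain C) (ℕ.≤-trans (s≤s z≤n) (long C)) (there m)
  ... | e , e∈ , inc with edgeSplit (chain C) e∈
  ... | x , y , _ , _ , _ , _ , (_ , x∉ , y∉) , _ , refl with inc-edge⁻ {u = x} {y} inc
  ... | inj₁ refl = x∉
  ... | inj₂ refl = y∉

  record Assignment (is : List (Fin k)) (Y : List (Fin N)) : Set where
    field
      verts    : Fin k → List (Fin N)
      good     : ∀ {i} → i ∈ is → ∃ λ a → IsCycle R₀ a (verts i) × len i ≤ length (verts i)
      off      : ∀ {i w} → i ∈ is → w ∈ verts i → w ∉ Y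
      disjoint : ∀ {i j w} → i ∈ is → j ∈ is → i ≢ j → w ∈ verts i → w ∉ verts j

  set : Fin k → List (Fin N) → (Fin k → List (Fin N)) → Fin k → List (Fin N)
  set i ys f j with j Fin.≟ i
  ... | yes _ = ys
  ... | no _ = f j

  set-same : ∀ i ys f → set i ys f i ≡ ys
  set-same i ys f with i Fin.≟ i
  ... | yes _ = refl
  ... | no i≢i = ⊥-elim (i≢i refl)

  set-other : ∀ {i j} ys f → j ≢ i → set i ys f j ≡ f j
  set-other {i} {j} ys f j≢i with j Fin.≟ i
  ... | yes eq = ⊥-elim (j≢i eq)
  ... | no _ = refl

  empty-assignment : ∀ {Y} → Assignment [] Y
  empty-assignment = record { verts = λ _ → [] ; good = λ () ; off = λ () ; disjoint = λ () }

  extend : ∀ {i is Y Y′ a ys} → i ∉ is → IsCycle R₀ a ys → len i ≤ length ys → (∀ {w} → w ∈ ys → w ∉ Y) →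
           Y ⊆ Y′ → (A : Assignment is Y′) → (∀ {j w} → j ∈ is → w ∈ Assignment.verts A j → w ∉ ys) → Assignment (i ∷ is) Y
  extend {i} {is} {Y} {Y′} {a} {ys} i∉ C ℓ≤ ys-off Y⊆ A apart = record
    { verts = f ; good = good′ ; off = off′ ; disjoint = disjoint′ }
    where
    open Assignment A
    f = set i ys verts
    same : f i ≡ ys
    same = set-same i ys verts
    other : ∀ {j} → j ∈ is → f j ≡ verts j
    other j∈ = set-other ys verts (λ { refl → i∉ j∈ })
    good′ : ∀ {j} → j ∈ i ∷ is → ∃ λ a → IsCycle R₀ a (f j) × len j ≤ length (f j)
    good′ (here refl) = a , subst (IsCycle R₀ a) (sym same) C , subst (λ l → len i ≤ length l) (sym same) ℓ≤
    good′ {j} (there j∈) = let (b , D , l) = good j∈ in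
      b , subst (IsCycle R₀ b) (sym (other j∈)) D , subst (λ l → len j ≤ length l) (sym (other j∈)) l
    off′ : ∀ {j w} → j ∈ i ∷ is → w ∈ f j → w ∉ Y
    off′ {w = w} (here refl) m = ys-off (subst (w ∈_) same m)
    off′ {w = w} (there j∈) m w∈Y = off j∈ (subst (w ∈_) (other j∈) m) (Y⊆ w∈Y)
    disjoint′ : ∀ {j j′ w} → j ∈ i ∷ is → j′ ∈ i ∷ is → j ≢ j′ → w ∈ f j → w ∉ f j′
    disjoint′ (here refl) (here refl) ne _ _ = ne refl
    disjoint′ {w = w} (here refl) (there j∈) _ m m′ = apart j∈ (subst (w ∈_) (other j∈) m′) (subst (w ∈_) same m)
    disjoint′ {w = w} (there j∈) (here refl) _ m m′ = apart j∈ (subst (w ∈_) (other j∈) m) (subst (w ∈_) same m′)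
    disjoint′ {w = w} (there j∈) (there j∈′) ne m m′ = disjoint j∈ j∈′ ne (subst (w ∈_) (other j∈) m) (subst (w ∈_) (other j∈′) m′)

  -- All lengths in `is` are at most `ℓ`, so any cycle of the packing suits any index. The clause
  -- with `Any` records that the chosen vertices come from `cs`, which gives disjointness from the
  -- next cycle in the recursion.
  fromPacking : ∀ {Y ℓ} is (cs : List (Fin N × List (Fin N))) → Unique is → length is ≤ length cs → All (λ i → len i ≤ ℓ) is →
                All (GoodCycle (Off Y) ℓ) cs → AllPairs DisjointCycles cs →
                ∃ λ (A : Assignment is Y) → ∀ {i w} → i ∈ is → w ∈ Assignment.verts A i → Any (λ x → w ∈ proj₂ x) cs
  fromPacking [] cs u l le good dj = empty-assignment , λ ()
  fromPacking {Y} (i ∷ is) ((a , ys) ∷ cs) u (s≤s l) (le ∷ les) ((C , ℓ≤) ∷ good) (d ∷ dj) =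
    result (fromPacking is cs (tail-unique u) l les good dj)
    where
    result : (∃ λ (A : Assignment is Y) → ∀ {i w} → i ∈ is → w ∈ Assignment.verts A i → Any (λ x → w ∈ proj₂ x) cs) →
             ∃ λ (A : Assignment (i ∷ is) Y) → ∀ {i w} → i ∈ _ → w ∈ Assignment.verts A i → Any (λ x → w ∈ proj₂ x) ((a , ys) ∷ cs)
    result (A , within) = extend (head∉ u) (cycle-map C (λ (r , _) _ → r)) (ℕ.≤-trans le ℓ≤) (off-avoids C) id A
        (λ j∈ m m′ → let (x , x∈ , w∈) = find (within j∈ m) in All.lookup d x∈ m′ w∈) ,
      λ { {w = w} (here refl) m → here (subst (w ∈_) (set-same i ys (Assignment.verts A)) m)
        ; {w = w} (there j∈) m → there (within j∈ (subst (w ∈_) (set-other ys (Assignment.verts A) (λ { refl → head∉ u j∈ })) m)) }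

  longest : ∀ i is → ∃₂ λ m ms → i ∷ is ↭ m ∷ ms × All (λ j → len j ≤ len m) ms
  longest i [] = i , [] , ↭-refl , []
  longest i (j ∷ is) with longest j is
  ... | m , ms , p , al with ℕ.≤-total (len m) (len i)
  ...   | inj₁ m≤i = i , m ∷ ms , prep i p , m≤i ∷ All.map (λ l → ℕ.≤-trans l m≤i) al
  ...   | inj₂ i≤m = m , i ∷ ms , ↭-trans (prep i p) (swap i m ↭-refl) , i≤m ∷ al

  total : List (Fin k) → ℕ
  total is = sum (map len is)

  total-↭ : ∀ {is js} → is ↭ js → total is ≡ total js
  total-↭ p = sum-↭ (Perm.map⁺ len p)

  assignment-↭ : ∀ {is js Y} → is ↭ js → Assignment is Y → Assignment js Y
  assignment-↭ p A = record { verts = verts ; good = λ m → good (q m) ; off = λ m → off (q m) ; disjoint = λ m m′ → disjoint (q m) (q m′) }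
    where
    open Assignment A
    q : ∀ {i} → i ∈ _ → i ∈ _
    q = Perm.∈-resp-↭ (↭-sym p)

  off-map : ∀ {Y a ys} → IsCycle R₀ a ys → (∀ {w} → w ∈ ys → w ∉ Y) → IsCycle (Off Y) a ys
  off-map C av = cycle-map C (λ {u} {v} r m → r , av (cycle-∈ C (inc-edges m (inc-edgeˡ {u = u} {v}))) ,
    av (cycle-∈ C (inc-edges m (inc-edgeʳ {u = u} {v}))))

  off? : ∀ Y u v → Dec (Off Y u v)
  off? Y u v = R₀? u v ×-dec (¬? (u ∈? Y) ×-dec ¬? (v ∈? Y))

  off-sym : ∀ {Y u v} → Off Y u v → Off Y v u
  off-sym (r , p , q) = R₀-sym r , q , p

  Medium : ℕ → List (Fin N) → Set
  Medium ℓ Y = ∃₂ λ a ys → length ys ≤ N × IsCycle (Off Y) a ys × ℓ ≤ length ys × length ys < ℓ + ℓ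

  medium? : ∀ ℓ Y → Dec (Medium ℓ Y)
  medium? ℓ Y = Fin.any? λ a → ∃-list? (λ ys → isCycle? (off? Y) a ys ×-dec ((ℓ ℕ.≤? length ys) ×-dec (length ys ℕ.<? ℓ + ℓ))) N

  gapGraph : ∀ ℓ Y → 3 ≤ ℓ → ¬ Medium ℓ Y → GapGraph N
  gapGraph ℓ Y 3≤ℓ none = record { R = Off Y ; R? = off? Y ; Rsym = off-sym ; Rirr = λ (r , _) → R₀-irr r ; ℓ = ℓ ; 3≤ℓ = 3≤ℓ
    ; gap = λ {a} {ys} C lt → ℕ.≰⇒> λ ℓ≤ → none (a , ys , unique-length≤ (unique C) , C , ℓ≤ , lt) }

  Bounded : ℕ → Set
  Bounded b = ∃₂ λ Y ℓ → 3 ≤ ℓ × length Y + ℓ ≤ b × (∀ {a ys} → IsCycle R₀ a ys → (∀ {w} → w ∈ ys → w ∉ Y) → length ys < ℓ)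

  module _ (k₀ r′ : ℕ)
           (small : (k₀ * (suc r′ + suc r′) + 1) + (k₀ * (suc r′ + suc r′) + 1) < 2 ^ suc r′) where

    private
      r = suc r′

    cost : ℕ
    cost = (k₀ * (r + r)) * 5 + (k₀ + k₀)

    -- Each index brings a budget of twice its length. An index with a medium cycle spends it on
    -- deleting that cycle; when a gap appears, the untouched budget of the current longest index
    -- covers the summand `ℓ` in `Bounded`.
    choose : ∀ m is Y → length is ≡ suc m → m ≤ k₀ → Unique is →
             Assignment is Y ⊎ Bounded (length Y + (total is + total is) + cost)
    choose m (i₀ ∷ is₀) Y l m≤k₀ u = go (longest i₀ is₀)
      where
      go : (∃₂ λ i is → i₀ ∷ is₀ ↭ i ∷ is × All (λ j → len j ≤ len i) is) →
           Assignment (i₀ ∷ is₀) Y ⊎ Bounded (length Y + (total (i₀ ∷ is₀) + total (i₀ ∷ is₀)) + cost)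
      go (i , is , p , les) = subst (λ t → Assignment (i₀ ∷ is₀) Y ⊎ Bounded (length Y + (t + t) + cost)) (sym (total-↭ p))
          (Sum.map₁ (assignment-↭ (↭-sym p)) (proceed (medium? ℓ Y)))
        where
        ℓ = len i
        u′ : Unique (i ∷ is)
        u′ = Unique-resp-↭ p u
        l′ : length is ≡ m
        l′ = ℕ.suc-injective (trans (sym (Perm.↭-length p)) l)
        Goal = Assignment (i ∷ is) Y ⊎ Bounded (length Y + ((ℓ + total is) + (ℓ + total is)) + cost)
        proceed : Dec (Medium ℓ Y) → Goal
        proceed (yes (a , ys , _ , C , ℓ≤ , lt)) = rest m is l′ les u′ m≤k₀
          where
          C₀ : IsCycle R₀ a ys
          C₀ = cycle-map C (λ (r , _) _ → r)
          Y′ = ys ++ Y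
          grow≤ : ∀ t → length Y′ + (t + t) + cost ≤ length Y + ((ℓ + t) + (ℓ + t)) + cost
          grow≤ t = ℕ.+-monoˡ-≤ cost (begin
            length Y′ + (t + t)                   ≡⟨ cong (_+ (t + t)) (List.length-++ ys) ⟩
            (length ys + length Y) + (t + t)      ≤⟨ ℕ.+-monoˡ-≤ (t + t) (ℕ.+-monoˡ-≤ (length Y) (ℕ.<⇒≤ lt)) ⟩
            ((ℓ + ℓ) + length Y) + (t + t)        ≡⟨ shuffle ℓ (length Y) t ⟩
            length Y + ((ℓ + t) + (ℓ + t))        ∎)
            where
            open ℕ.≤-Reasoning
            shuffle : ∀ a y t → ((a + a) + y) + (t + t) ≡ y + ((a + t) + (a + t))
            shuffle = solve 3 (λ a y t → ((a :+ a) :+ y) :+ (t :+ t) := y :+ ((a :+ t) :+ (a :+ t))) refl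
              where open +-*-Solver
          add : ∀ {is} → i ∉ is → Assignment is Y′ → Assignment (i ∷ is) Y
          add i∉ A = extend i∉ C₀ ℓ≤ (off-avoids C) (∈-++⁺ʳ ys) A (λ j∈ m m′ → Assignment.off A j∈ m (∈-++⁺ˡ m′))
          rest : ∀ m is → length is ≡ m → All (λ j → len j ≤ ℓ) is → Unique (i ∷ is) → m ≤ k₀ →
                 Assignment (i ∷ is) Y ⊎ Bounded (length Y + ((ℓ + total is) + (ℓ + total is)) + cost)
          rest zero [] _ _ u _ = inj₁ (add (head∉ u) empty-assignment)
          rest (suc m) is l _ u m≤ = Sum.map (add (head∉ u))
            (λ (Z , ℓ′ , 3≤ , le , f) → Z , ℓ′ , 3≤ , ℕ.≤-trans le (grow≤ (total is)) , f)
            (choose m is Y′ l (ℕ.≤-trans (ℕ.n≤1+n m) m≤) (tail-unique u))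
        proceed (no none) = finish (Gap.pack-or-hit (gapGraph ℓ Y (3≤len i) none) m r′ small′)
          where
          mono : m * (r + r) + 1 ≤ k₀ * (r + r) + 1
          mono = ℕ.+-monoˡ-≤ 1 (ℕ.*-monoˡ-≤ (r + r) m≤k₀)
          small′ : (m * (r + r) + 1) + (m * (r + r) + 1) < 2 ^ r
          small′ = ℕ.≤-<-trans (ℕ.+-mono-≤ mono mono) small
          finish : Packing (Off Y) ℓ (suc m) ⊎ Gap.HittingSet (gapGraph ℓ Y (3≤len i) none) ((m * (r + r)) * 5 + (m + m)) → Goal
          finish (inj₁ P) = inj₁ (proj₁ (fromPacking (i ∷ is) cycles u′ (subst (_≤ length cycles) (cong suc (sym l′)) count)
              (ℕ.≤-refl ∷ les) good disjoint))
            where open Packing P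
          finish (inj₂ (Z , Z≤ , hits)) = inj₂ (Z ++ Y , ℓ , 3≤len i , size≤ ,
              λ C av → hits (off-map C (λ m m′ → av m (∈-++⁺ʳ Z m′))) (λ m m′ → av m (∈-++⁺ˡ m′)))
            where
            open ℕ.≤-Reasoning
            Z≤cost : length Z ≤ cost
            Z≤cost = ℕ.≤-trans Z≤ (ℕ.+-mono-≤ (ℕ.*-monoˡ-≤ 5 (ℕ.*-monoˡ-≤ (r + r) m≤k₀)) (ℕ.+-mono-≤ m≤k₀ m≤k₀))
            size≤ : length (Z ++ Y) + ℓ ≤ length Y + ((ℓ + total is) + (ℓ + total is)) + cost
            size≤ = begin
              length (Z ++ Y) + ℓ                                        ≡⟨ cong (_+ ℓ) (List.length-++ Z) ⟩
              length Z + length Y + ℓ                                    ≡⟨ ℕ.+-assoc (length Z) (length Y) ℓ ⟩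
              length Z + (length Y + ℓ)                                  ≤⟨ ℕ.+-mono-≤ Z≤cost (ℕ.+-monoʳ-≤ (length Y) (ℕ.≤-trans (ℕ.m≤m+n ℓ (total is)) (ℕ.m≤m+n (ℓ + total is) (ℓ + total is)))) ⟩
              cost + (length Y + ((ℓ + total is) + (ℓ + total is)))      ≡⟨ ℕ.+-comm cost _ ⟩
              length Y + ((ℓ + total is) + (ℓ + total is)) + cost        ∎

-- Subsets from lists, and trees grown by leaves

fromList : List (Fin N) → Subset N
fromList [] = ⊥ₛ
fromList (x ∷ xs) = fromList xs [ x ]≔ true

∈-fromList⁺ : ∀ {xs} {v : Fin N} → v ∈ xs → v ∈ₛ fromList xs
∈-fromList⁺ {xs = x ∷ xs} (here refl) = Vec.[]≔-updates (fromList xs) x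
∈-fromList⁺ {xs = x ∷ xs} {v} (there m) with v Fin.≟ x
... | yes refl = Vec.[]≔-updates (fromList xs) v
... | no v≢x = Vec.[]≔-minimal (fromList xs) v x v≢x (∈-fromList⁺ m)

∈-fromList⁻ : ∀ {xs} {v : Fin N} → v ∈ₛ fromList xs → v ∈ xs
∈-fromList⁻ {xs = []} m = ⊥-elim (Subset.∉⊥ m)
∈-fromList⁻ {xs = x ∷ xs} {v} m with v Fin.≟ x
... | yes refl = here refl
... | no v≢x = there (∈-fromList⁻ (Vec.lookup⇒[]= v (fromList xs)
        (trans (sym (Vec.lookup∘update′ v≢x (fromList xs) true)) (Vec.[]=⇒lookup m))))

∣fromList∣≤ : (xs : List (Fin N)) → ∣ fromList xs ∣ ≤ length xs
∣fromList∣≤ {N} [] = ℕ.≤-reflexive (Subset.∣⊥∣≡0 N)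
∣fromList∣≤ (x ∷ xs) = ℕ.≤-trans (insert≤ (fromList xs) x) (s≤s (∣fromList∣≤ xs))
  where
  insert≤ : ∀ {N} (p : Subset N) x → ∣ p [ x ]≔ true ∣ ≤ suc ∣ p ∣
  insert≤ (true Vec.∷ p) zero = ℕ.n≤1+n _
  insert≤ (false Vec.∷ p) zero = ℕ.≤-refl
  insert≤ (true Vec.∷ p) (suc x) = s≤s (insert≤ p x)
  insert≤ (false Vec.∷ p) (suc x) = insert≤ p x

top-cases : ∀ {k} (i : Fin (suc k)) → i ≡ fromℕ k ⊎ ∃ λ j → i ≡ inject₁ j
top-cases i with Top.view i
... | Top.‵fromℕ = inj₁ refl
... | Top.‵inject₁ j = inj₂ (j , refl)

-- The newest of the m + 1 nodes is 0, and attaching a leaf shifts the others by one.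
data Tree (X : Set) : ℕ → Set where
  root   : X → Tree X 0
  attach : ∀ {m} → Tree X m → X → Fin (suc m) → Tree X (suc m)

module _ {X : Set} where

  label : ∀ {m} → Tree X m → Fin (suc m) → X
  label (root x) _ = x
  label (attach t x p) zero = x
  label (attach t x p) (suc i) = label t i

  adjᵗ : ∀ {m} → Tree X m → Fin (suc m) → Fin (suc m) → Bool
  adjᵗ (root x) _ _ = false
  adjᵗ (attach t x p) zero zero = false
  adjᵗ (attach t x p) zero (suc j) = does (j Fin.≟ p)
  adjᵗ (attach t x p) (suc i) zero = does (i Fin.≟ p)
  adjᵗ (attach t x p) (suc i) (suc j) = adjᵗ t i j

  adjᵗ-sym : ∀ {m} (t : Tree X m) i j → adjᵗ t i j ≡ adjᵗ t j i
  adjᵗ-sym (root x) i j = refl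
  adjᵗ-sym (attach t x p) zero zero = refl
  adjᵗ-sym (attach t x p) zero (suc j) = refl
  adjᵗ-sym (attach t x p) (suc i) zero = refl
  adjᵗ-sym (attach t x p) (suc i) (suc j) = adjᵗ-sym t i j

  adjᵗ-irrefl : ∀ {m} (t : Tree X m) i → adjᵗ t i i ≡ false
  adjᵗ-irrefl (root x) i = refl
  adjᵗ-irrefl (attach t x p) zero = refl
  adjᵗ-irrefl (attach t x p) (suc i) = adjᵗ-irrefl t i

  treeGraph : ∀ {m} → Tree X m → Graph
  treeGraph {m} t = record { n = suc m ; adj = adjᵗ t ; sym = adjᵗ-sym t ; irrefl = adjᵗ-irrefl t }

  private
    parent-adj : ∀ {m} (t : Tree X m) x p → adjᵗ (attach t x p) (suc p) zero ≡ true
    parent-adj t x p with p Fin.≟ p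
    ... | yes _ = refl
    ... | no p≢p = ⊥-elim (p≢p refl)

    leaf-parent : ∀ {m} (t : Tree X m) x p j → adjᵗ (attach t x p) zero j ≡ true → j ≡ suc p
    leaf-parent t x p (suc j) eq with j Fin.≟ p
    ... | yes refl = refl

  reach-trans : ∀ {G P u v w} → Reach G P u v → Reach G P v w → Reach G P u w
  reach-trans r (here _) = r
  reach-trans r (step s e p) = step (reach-trans r s) e p

  reach-old : ∀ {m} {t : Tree X m} {x p P Q u v} → (∀ {i} → P i → Q (suc i)) → Reach (treeGraph t) P u v →
              Reach (treeGraph (attach t x p)) Q (suc u) (suc v)
  reach-old f (here p) = here (f p)
  reach-old f (step r e p) = step (reach-old f r) e (f p)

  -- Serves both the connectivity of the tree and the subtree property of decompositions: a new leaf
  -- keeps the nodes with `P` connected as soon as `P` at the leaf and at some old node implies `P`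
  -- at the parent.
  reach-attach : ∀ {m} {t : Tree X m} {x p} {P : Fin (suc (suc m)) → Set} →
                 (P zero → ∀ {i} → P (suc i) → P (suc p)) →
                 (∀ i j → P (suc i) → P (suc j) → Reach (treeGraph t) (P ∘ suc) i j) →
                 ∀ i j → P i → P j → Reach (treeGraph (attach t x p)) P i j
  reach-attach f r zero zero a b = here a
  reach-attach {t = t} {x} {p} f r zero (suc j) a b =
    reach-trans (step (here a) (trans (adjᵗ-sym (attach t x p) zero (suc p)) (parent-adj t x p)) (f a b)) (reach-old id (r p j (f a b) b))
  reach-attach {t = t} {x} {p} f r (suc i) zero a b = step (reach-old id (r i p a (f b a))) (parent-adj t x p) b
  reach-attach f r (suc i) (suc j) a b = reach-old id (r i j a b)

  connected : ∀ {m} (t : Tree X m) → Connected (treeGraph t)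
  connected (root x) zero zero = here tt
  connected (attach t x p) i j = reach-attach (λ _ _ → tt) (λ i j _ _ → connected t i j) i j tt tt

  -- A vertex on a cycle has two neighbours there, and a leaf has only its parent. So a cycle avoids
  -- the newest leaf and lies in the smaller tree.
  acyclic : ∀ {m} (t : Tree X m) → ¬ Cycle (treeGraph t)
  acyclic (root x) C with Cycle.m C | Cycle.close C
  ... | _ | ()
  acyclic (attach t x p) C with Fin.any? (λ i → vtx C i Fin.≟ zero)
  ... | no none = acyclic t (record { m = Cycle.m C ; len≥3 = len≥3 C ; vtx = λ i → proj₁ (down i)
        ; inj = λ i j eq → inj C i j (trans (proj₂ (down i)) (trans (cong suc eq) (sym (proj₂ (down j)))))
        ; consec = λ i → subst₂ (λ a b → adjᵗ (attach t x p) a b ≡ true) (proj₂ (down (inject₁ i))) (proj₂ (down (suc i))) (consec C i)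
        ; close = subst₂ (λ a b → adjᵗ (attach t x p) a b ≡ true) (proj₂ (down (fromℕ (Cycle.m C)))) (proj₂ (down zero)) (close C) })
    where
    pred : ∀ {k} (v : Fin (suc k)) → v ≢ zero → ∃ λ w → v ≡ suc w
    pred zero v≢ = ⊥-elim (v≢ refl)
    pred (suc w) _ = w , refl
    down : ∀ i → ∃ λ w → vtx C i ≡ suc w
    down i = pred (vtx C i) (λ eq → none (i , eq))
  ... | yes (i , eq) = two-neighbours (Cycle.m C) (len≥3 C) (vtx C) (inj C) (consec C) (close C) i eq
    where
    Adj : Fin _ → Fin _ → Set
    Adj a b = adjᵗ (attach t x p) a b ≡ true
    same : ∀ {a} b c → a ≡ zero → Adj a b → Adj a c → b ≡ c
    same b c refl e f = trans (leaf-parent t x p _ e) (sym (leaf-parent t x p _ f))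
    flip-adj : ∀ a b → Adj a b → Adj b a
    flip-adj a b e = trans (adjᵗ-sym (attach t x p) b a) e
    two-neighbours : ∀ k → 2 ≤ k → (f : Fin (suc k) → Fin _) → (∀ i j → f i ≡ f j → i ≡ j) →
                     (∀ (i : Fin k) → Adj (f (inject₁ i)) (f (suc i))) → Adj (f (fromℕ k)) (f zero) → ∀ i → f i ≡ zero → ⊥
    two-neighbours (suc (suc k)) (s≤s (s≤s _)) f f-inj cs cl zero eq with f-inj _ _ (same (f (suc zero)) (f (fromℕ _)) eq (cs zero) (flip-adj (f (fromℕ _)) (f zero) cl))
    ... | ()
    two-neighbours (suc (suc k)) (s≤s (s≤s _)) f f-inj cs cl (suc i) eq with top-cases (suc i)
    ... | inj₁ eq′ with f-inj _ _ (same (f (inject₁ i)) (f zero) eq (flip-adj (f (inject₁ i)) (f (suc i)) (cs i)) (subst (λ j → Adj (f j) (f zero)) (sym eq′) cl))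
    ...   | i≡0 = case trans (cong suc (sym (inject₁-zero i≡0))) eq′ of λ ()
      where
      inject₁-zero : ∀ {k} {i : Fin (suc k)} → inject₁ i ≡ zero → i ≡ zero
      inject₁-zero {i = zero} _ = refl
    two-neighbours (suc (suc k)) (s≤s (s≤s _)) f f-inj cs cl (suc i) eq | inj₂ (j , eq′) =
      ℕ.<-irrefl (trans (sym (Fin.toℕ-inject₁ i)) (trans (cong Fin.toℕ back)
          (cong suc (trans (sym (Fin.toℕ-inject₁ j)) (cong Fin.toℕ (sym eq′))))))
        (ℕ.m<n⇒m<1+n (ℕ.n<1+n (Fin.toℕ i)))
      where
      back : inject₁ i ≡ suc j
      back = f-inj _ _ (same (f (inject₁ i)) (f (suc j)) eq (flip-adj (f (inject₁ i)) (f (suc i)) (cs i)) (subst (λ x → Adj (f x) (f (suc j))) (sym eq′) (cs j)))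

-- Tree decompositions by depth-first search

take-⊆ : ∀ k (xs : List A) → take k xs ⊆ xs
take-⊆ (suc k) (x ∷ xs) (here eq) = here eq
take-⊆ (suc k) (x ∷ xs) (there m) = there (take-⊆ k xs m)

take-mono : ∀ {j k} (xs : List A) → j ≤ k → take j xs ⊆ take k xs
take-mono (x ∷ xs) (s≤s le) (here eq) = here eq
take-mono (x ∷ xs) (s≤s le) (there m) = there (take-mono xs le m)

length-take≤ : ∀ k (xs : List A) → length (take k xs) ≤ k
length-take≤ zero xs = z≤n
length-take≤ (suc k) [] = z≤n
length-take≤ (suc k) (x ∷ xs) = s≤s (length-take≤ k xs)

take-∷ : ∀ {ℓ} → 3 ≤ ℓ → (x : A) (xs : List A) → take (ℓ ∸ 1) (x ∷ xs) ≡ x ∷ take (ℓ ∸ 2) xs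
take-∷ (s≤s (s≤s _)) x xs = refl

-- Depth-first search: π is the path from the current vertex up to its root; without long cycles, every edge
-- goes from a vertex to one of its nearest ℓ − 2 ancestors, so these ancestors make a bag.
module DepthFirst (G : Graph) (Y : List (Fin (Graph.n G))) (ℓ : ℕ) (3≤ℓ : 3 ≤ ℓ)
  (bounded : ∀ {a ys} → IsCycle (λ u v → Graph.adj G u v ≡ true) a ys → (∀ {w} → w ∈ ys → w ∉ Y) → length ys < ℓ) where

  V : Set
  V = Fin (Graph.n G)

  R : V → V → Set
  R u v = Graph.adj G u v ≡ true

  R-sym : ∀ {u v} → R u v → R v u
  R-sym {u} {v} r = trans (Graph.sym G v u) r

  R-irr : ∀ {u v} → R u v → u ≢ v
  R-irr {u} r refl = case trans (sym r) (Graph.irrefl G u) of λ ()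

  bagOf : List V → List V
  bagOf π = Y ++ take (ℓ ∸ 1) π

  -- Every vertex on the current path keeps a node whose bag contains its own bag, so that later
  -- children can be attached there.
  data Placed {m} (t : Tree (List V) m) : List V → Set where
    []  : Placed t []
    _∷_ : ∀ {v π} → (∃ λ s → bagOf (v ∷ π) ⊆ label t s) → Placed t π → Placed t (v ∷ π)

  data Path : List V → Set where
    []  : Path []
    _∷_ : ∀ {v π} → (∃ λ b → Chain R v π b) → Path π → Path (v ∷ π)

  -- `vis` lists the visited vertices. By `finished`, a visited vertex that has left the path `π`
  -- has no unvisited neighbour outside `Y`; therefore the visited neighbours of a new vertex all
  -- lie on `π`.
  record Search (vis π : List V) : Set where
    field
      {m}      : ℕ
      t        : Tree (List V) m
      vis!     : Unique vis
      vis∉Y    : ∀ {v} → v ∈ vis → v ∉ Y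
      π⊆vis    : π ⊆ vis
      π!       : Unique π
      path     : Path π
      placed   : Placed t π
      seen     : ∀ {v} s → v ∈ label t s → v ∈ vis ⊎ v ∈ Y
      Y⊆       : ∀ s → Y ⊆ label t s
      width    : ∀ s → length (label t s) ≤ length Y + (ℓ ∸ 1)
      finished : ∀ {u v} → u ∈ vis → u ∉ π → R u v → v ∈ vis ⊎ v ∈ Y
      covered  : ∀ {v} → v ∈ vis → ∃ λ s → v ∈ label t s
      joined   : ∀ {u v} → u ∈ vis → v ∈ vis → R u v → ∃ λ s → u ∈ label t s × v ∈ label t s
      subtree  : ∀ v i j → v ∈ label t i → v ∈ label t j → Reach (treeGraph t) (λ r → v ∈ label t r) i j

  placed-old : ∀ {m t x p π} → Placed {m} t π → Placed (attach t x p) π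
  placed-old [] = []
  placed-old ((s , sub) ∷ P) = (suc s , sub) ∷ placed-old P

  module Visit {vis π} (S : Search vis π) (w : V) (w∉vis : w ∉ vis) (w∉Y : w ∉ Y)
               (path′ : Path (w ∷ π))
               (p : Fin (suc (Search.m S))) (p-bag : take (ℓ ∸ 2) π ⊆ label (Search.t S) p)
               (near : ∀ {u} → u ∈ vis → R w u → u ∈ take (ℓ ∸ 2) π) where
    open Search S

    x : List V
    x = bagOf (w ∷ π)

    t′ = attach t x p

    x-cases : ∀ {v} → v ∈ x → v ∈ Y ⊎ v ≡ w ⊎ v ∈ take (ℓ ∸ 2) π
    x-cases {v} m with ∈-++⁻ Y m
    ... | inj₁ m₁ = inj₁ m₁
    ... | inj₂ m₂ with subst (v ∈_) (take-∷ 3≤ℓ w π) m₂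
    ...   | here eq = inj₂ (inj₁ eq)
    ...   | there m₃ = inj₂ (inj₂ m₃)

    w∈x : w ∈ x
    w∈x = ∈-++⁺ʳ Y (subst (w ∈_) (sym (take-∷ 3≤ℓ w π)) (here refl))

    near∈x : ∀ {u} → u ∈ take (ℓ ∸ 2) π → u ∈ x
    near∈x {u} m = ∈-++⁺ʳ Y (subst (u ∈_) (sym (take-∷ 3≤ℓ w π)) (there m))

    -- The vertex `w` is fresh, so what the new bag shares with older ones lies in `Y` or among the
    -- near ancestors, and the bag of the parent contains both. This is the condition in
    -- `reach-attach`.
    inherit : ∀ {v s} → v ∈ x → v ∈ label t s → v ∈ label t p
    inherit {v} {s} m m′ with x-cases m
    ... | inj₁ v∈Y = Y⊆ p v∈Y
    ... | inj₂ (inj₂ v∈π) = p-bag v∈π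
    ... | inj₂ (inj₁ refl) with seen s m′
    ...   | inj₁ a = ⊥-elim (w∉vis a)
    ...   | inj₂ b = ⊥-elim (w∉Y b)

    visited : Search (w ∷ vis) (w ∷ π)
    visited = record
      { t = t′ ; vis! = cons-unique w∉vis vis! ; vis∉Y = λ { (here refl) → w∉Y ; (there m) → vis∉Y m }
      ; π⊆vis = λ { (here eq) → here eq ; (there m) → there (π⊆vis m) }
      ; π! = cons-unique (λ m → w∉vis (π⊆vis m)) π! ; path = path′ ; placed = (zero , id) ∷ placed-old placed
      ; seen = seen′ ; Y⊆ = λ { zero → ∈-++⁺ˡ ; (suc s) → Y⊆ s } ; width = width′ ; finished = finished′
      ; covered = λ { (here refl) → zero , w∈x ; (there m) → let (s , h) = covered m in suc s , h }
      ; joined = joined′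
      ; subtree = λ v → reach-attach (λ a {s} b → inherit {s = s} a b) (subtree v) }
      where
      seen′ : ∀ {v} s → v ∈ label t′ s → v ∈ w ∷ vis ⊎ v ∈ Y
      seen′ zero m with x-cases m
      ... | inj₁ v∈Y = inj₂ v∈Y
      ... | inj₂ (inj₁ refl) = inj₁ (here refl)
      ... | inj₂ (inj₂ m′) = inj₁ (there (π⊆vis (take-⊆ (ℓ ∸ 2) π m′)))
      seen′ (suc s) m = Sum.map₁ there (seen s m)
      width′ : ∀ s → length (label t′ s) ≤ length Y + (ℓ ∸ 1)
      width′ zero = subst (_≤ length Y + (ℓ ∸ 1)) (sym (List.length-++ Y)) (ℕ.+-monoʳ-≤ (length Y) (length-take≤ (ℓ ∸ 1) (w ∷ π)))
      width′ (suc s) = width s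
      finished′ : ∀ {u v} → u ∈ w ∷ vis → u ∉ w ∷ π → R u v → v ∈ w ∷ vis ⊎ v ∈ Y
      finished′ (here refl) u∉ r = ⊥-elim (u∉ (here refl))
      finished′ (there m) u∉ r = Sum.map₁ there (finished m (λ m′ → u∉ (there m′)) r)
      joined′ : ∀ {u v} → u ∈ w ∷ vis → v ∈ w ∷ vis → R u v → ∃ λ s → u ∈ label t′ s × v ∈ label t′ s
      joined′ (here refl) (here refl) r = ⊥-elim (R-irr r refl)
      joined′ (here refl) (there m) r = zero , w∈x , near∈x (near m r)
      joined′ (there m) (here refl) r = zero , near∈x (near m (R-sym r)) , w∈x
      joined′ (there m) (there m′) r = let (s , h) = joined m m′ r in suc s , h

  finish-top : ∀ {vis v π} → Search vis (v ∷ π) → (∀ {w} → R v w → w ∈ vis ⊎ w ∈ Y) → Search vis π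
  finish-top {vis} {v} {π} S done = record
    { t = t ; vis! = vis! ; vis∉Y = vis∉Y ; π⊆vis = λ m → π⊆vis (there m) ; π! = tail-unique π!
    ; path = tailᵖ path ; placed = tailˡ placed ; seen = seen ; Y⊆ = Y⊆ ; width = width ; finished = finished′
    ; covered = covered ; joined = joined ; subtree = subtree }
    where
    open Search S
    tailᵖ : ∀ {v π} → Path (v ∷ π) → Path π
    tailᵖ (_ ∷ P) = P
    tailˡ : ∀ {v π} → Placed t (v ∷ π) → Placed t π
    tailˡ (_ ∷ P) = P
    finished′ : ∀ {u w} → u ∈ vis → u ∉ π → R u w → w ∈ vis ⊎ w ∈ Y
    finished′ {u} m u∉ r with u Fin.≟ v
    ... | yes refl = done r
    ... | no u≢v = finished m (λ { (here eq) → u≢v eq ; (there m′) → u∉ m′ }) r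

  Done : Set
  Done = ∃ λ vis → Search vis [] × (∀ v → v ∈ vis ⊎ v ∈ Y)

  unseen? : ∀ vis v → Dec (v ∉ vis × v ∉ Y)
  unseen? vis v = ¬? (v ∈? vis) ×-dec ¬? (v ∈? Y)

  seen-or : ∀ {vis v} → ¬ (v ∉ vis × v ∉ Y) → v ∈ vis ⊎ v ∈ Y
  seen-or {vis} {v} h with v ∈? vis | v ∈? Y
  ... | yes a | _ = inj₁ a
  ... | no _ | yes b = inj₂ b
  ... | no a | no b = ⊥-elim (h (a , b))

  -- The first bag of a new search tree shares only `Y` with the earlier bags, so any node can be
  -- its parent; the newest one, `zero`, is taken.
  visit-root : ∀ {vis w} → Search vis [] → w ∉ vis → w ∉ Y → Search (w ∷ vis) (w ∷ [])
  visit-root {w = w} S w∉vis w∉Y = Visit.visited S w w∉vis w∉Y ((w , []) ∷ []) zero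
      (λ m → case take-⊆ (ℓ ∸ 2) [] m of λ ()) λ u∈ r → ⊥-elim ([ w∉vis , w∉Y ]′ (Search.finished S u∈ (λ ()) (R-sym r)))

  visit-next : ∀ {vis v π w} → Search vis (v ∷ π) → R v w → w ∉ vis → w ∉ Y → Search (w ∷ vis) (w ∷ v ∷ π)
  visit-next {vis} {v} {π} {w} S r w∉vis w∉Y = go (Search.path S) (Search.placed S)
    where
    open Search S
    go : Path (v ∷ π) → Placed t (v ∷ π) → Search (w ∷ vis) (w ∷ v ∷ π)
    go P@((b , ch) ∷ _) ((s , sub) ∷ _) = Visit.visited S w w∉vis w∉Y ((b , R-sym r ∷ ch) ∷ P) s
        (λ m → sub (∈-++⁺ʳ Y (take-mono (v ∷ π) (ℕ.∸-monoʳ-≤ ℓ (s≤s z≤n)) m))) near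
      where
      prefix∈ : ∀ {u} pre post → Chain R v pre u → u ∈ take (suc (length pre)) (v ∷ pre ++ post)
      prefix∈ pre post [] = here refl
      prefix∈ {u} (y ∷ pre) post (_ ∷ c) = there (lift pre c)
        where
        lift : ∀ {y} pre → Chain R y pre u → u ∈ take (suc (length pre)) (y ∷ pre ++ post)
        lift [] [] = here refl
        lift (y′ ∷ pre) (_ ∷ c) = there (lift pre c)
      near : ∀ {u} → u ∈ vis → R w u → u ∈ take (ℓ ∸ 2) (v ∷ π)
      near {u} u∈ rwu with u ∈? (v ∷ π)
      ... | no u∉ = ⊥-elim ([ w∉vis , w∉Y ]′ (finished u∈ u∉ (R-sym rwu)))
      ... | yes u∈π with split∈ ch u∈π
      ...   | pre , post , refl , c₁ , c₂ = take-mono (v ∷ pre ++ post) (dist pre c₁ u! av) (prefix∈ pre post c₁)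
        where
        u! : Unique (v ∷ pre)
        u! = unique-++⁻ˡ (v ∷ pre) π!
        av : ∀ {x} → x ∈ v ∷ pre → x ∈ vis
        av m = π⊆vis (∈-++⁺ˡ m)
        dist : ∀ pre → Chain R v pre u → Unique (v ∷ pre) → (∀ {x} → x ∈ v ∷ pre → x ∈ vis) → suc (length pre) ≤ ℓ ∸ 2
        -- Here `u` is `v` itself and no cycle closes; `3≤ℓ` makes room for the parent in the bag.
        dist [] _ _ _ = ℕ.∸-monoˡ-≤ 2 3≤ℓ
        -- The path from `v` to `u` and the two edges at `w` form a cycle on `length pre + 2`
        -- vertices off `Y`; being shorter than `ℓ`, it puts `u` within reach.
        dist pre@(_ ∷ _) c₁ u! av = ℕ.∸-monoˡ-≤ 2 (subst (_< ℓ) len (bounded C off))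
          where
          len : length (v ∷ pre ++ [ w ]) ≡ suc (suc (length pre))
          len = cong suc (trans (List.length-++ pre) (ℕ.+-comm (length pre) 1))
          C : IsCycle R w (v ∷ pre ++ [ w ])
          C = cycle (R-sym r ∷ snoc c₁ (R-sym rwu)) (unique-++⁺ u! ([] ∷ []) (λ { m (here refl) → w∉vis (av m) }))
                (subst (3 ≤_) (sym len) (s≤s (s≤s (s≤s z≤n))))
          off : ∀ {x} → x ∈ v ∷ pre ++ [ w ] → x ∉ Y
          off m with ∈-++⁻ (v ∷ pre) m
          ... | inj₁ m₁ = vis∉Y (av m₁)
          ... | inj₂ (here refl) = w∉Y

  budget : ∀ f v → suc (suc f + (v + v)) ≡ f + (suc v + suc v)
  budget f v = sym (trans (cong (f +_) (cong suc (ℕ.+-suc v v))) (trans (ℕ.+-suc f (suc (v + v))) (cong suc (ℕ.+-suc f (v + v)))))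

  -- The measure is `length π` plus twice the number of vertices not in `vis`. A visit adds one to
  -- the first summand and takes two from the second; a retreat takes one from the first.
  run-search : ∀ f {vis π} → Search vis π → (length π + (Graph.n G + Graph.n G)) ≤ f + (length vis + length vis) → Done
  run-search f {vis} {[]} S h with Fin.any? (unseen? vis)
  ... | no none = vis , S , λ v → seen-or (λ h → none (v , h))
  run-search zero {vis} {[]} S h | yes (w , w∉vis , w∉Y) = ⊥-elim (ℕ.<⇒≱ (ℕ.+-mono-< more more) h)
    where
    more : length vis < Graph.n G
    more = unique-length≤ (cons-unique w∉vis (Search.vis! S))
  run-search (suc f) {vis} {[]} S h | yes (w , w∉vis , w∉Y) = run-search f (visit-root S w∉vis w∉Y)
    (ℕ.≤-trans (s≤s h) (ℕ.≤-reflexive (budget f (length vis))))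
  run-search zero {vis} {v ∷ π} S h = ⊥-elim (ℕ.<⇒≱ (s≤s (ℕ.≤-trans (ℕ.+-mono-≤ le le) (ℕ.m≤n+m _ (length π)))) h)
    where
    le : length vis ≤ Graph.n G
    le = unique-length≤ (Search.vis! S)
  run-search (suc f) {vis} {v ∷ π} S h with Fin.any? (λ w → (Graph.adj G v w Bool.≟ true) ×-dec unseen? vis w)
  ... | yes (w , r , w∉vis , w∉Y) = run-search f (visit-next S r w∉vis w∉Y)
    (ℕ.≤-trans (s≤s h) (ℕ.≤-reflexive (budget f (length vis))))
  ... | no none = run-search f (finish-top S (λ {w} r → seen-or (λ h → none (w , r , h)))) (ℕ.≤-pred h)

  start-search : Search [] []
  start-search = record
    { t = root Y ; vis! = [] ; vis∉Y = λ () ; π⊆vis = λ () ; π! = [] ; path = [] ; placed = [] ; seen = λ _ m → inj₂ m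
    ; Y⊆ = λ _ m → m ; width = λ _ → ℕ.m≤m+n _ _ ; finished = λ () ; covered = λ () ; joined = λ ()
    ; subtree = λ { v zero zero a b → here a } }

  done⇒decomposition : Done → TreewidthAtMost G (length Y + (ℓ ∸ 2))
  done⇒decomposition (vis , S , all) = record
      { T = treeGraph t ; isTree = s≤s z≤n , connected t , acyclic t ; bag = λ s → fromList (label t s)
      ; cover = λ v → cover′ v (all v) ; edgeIn = λ u v r → edgeIn′ u v r (all u) (all v)
      ; interp = λ v i j a b → widen (subtree v i j (∈-fromList⁻ a) (∈-fromList⁻ b)) } ,
    λ s → ℕ.≤-trans (∣fromList∣≤ (label t s)) (ℕ.≤-trans (width s) (ℕ.≤-reflexive size))
    where
    open Search S
    cover′ : ∀ v → v ∈ vis ⊎ v ∈ Y → ∃ λ s → v ∈ₛ fromList (label t s)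
    cover′ v (inj₁ m) = let (s , h) = covered m in s , ∈-fromList⁺ h
    cover′ v (inj₂ m) = zero , ∈-fromList⁺ (Y⊆ zero m)
    edgeIn′ : ∀ u v → R u v → u ∈ vis ⊎ u ∈ Y → v ∈ vis ⊎ v ∈ Y → ∃ λ s → u ∈ₛ fromList (label t s) × v ∈ₛ fromList (label t s)
    edgeIn′ u v r (inj₁ a) (inj₁ b) = let (s , h , h′) = joined a b r in s , ∈-fromList⁺ h , ∈-fromList⁺ h′
    edgeIn′ u v r (inj₁ a) (inj₂ b) = let (s , h) = covered a in s , ∈-fromList⁺ h , ∈-fromList⁺ (Y⊆ s b)
    edgeIn′ u v r (inj₂ a) b = let (s , h) = cover′ v b in s , ∈-fromList⁺ (Y⊆ s a) , h
    widen : ∀ {v i j} → Reach (treeGraph t) (λ r → v ∈ label t r) i j → Reach (treeGraph t) (λ r → v ∈ₛ fromList (label t r)) i j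
    widen (here a) = here (∈-fromList⁺ a)
    widen (step r e a) = step (widen r) e (∈-fromList⁺ a)
    size : length Y + (ℓ ∸ 1) ≡ suc (length Y + (ℓ ∸ 2))
    size = form 3≤ℓ
      where
      form : ∀ {ℓ} → 3 ≤ ℓ → length Y + (ℓ ∸ 1) ≡ suc (length Y + (ℓ ∸ 2))
      form (s≤s (s≤s _)) = ℕ.+-suc (length Y) _

  decomposition : TreewidthAtMost G (length Y + (ℓ ∸ 2))
  decomposition = done⇒decomposition (run-search (Graph.n G + Graph.n G) start-search (ℕ.≤-reflexive (sym (ℕ.+-identityʳ _))))

-- The position of v in ys, cut off at m: it contracts a cycle onto one of length m + 1.
cap : ∀ {N} (m : ℕ) {v : Fin N} {ys : List (Fin N)} → v ∈ ys → Fin (suc m)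
cap zero _ = zero
cap (suc m) (here _) = zero
cap (suc m) (there p) = suc (cap m p)

cap-here : ∀ m {v : Fin N} {ys : List (Fin N)} {x} (eq : v ≡ x) → cap m {ys = x ∷ ys} (here eq) ≡ zero
cap-here zero eq = refl
cap-here (suc m) eq = refl

cap-unique : ∀ m {v : Fin N} {ys} → Unique ys → (p q : v ∈ ys) → cap m p ≡ cap m q
cap-unique zero u p q = refl
cap-unique (suc m) u (here _) (here _) = refl
cap-unique (suc m) u (here refl) (there q) = ⊥-elim (head∉ u q)
cap-unique (suc m) u (there p) (here refl) = ⊥-elim (head∉ u p)
cap-unique (suc m) u (there p) (there q) = cong suc (cap-unique m (tail-unique u) p q)

cap-onto : ∀ m (ys : List (Fin N)) → suc m ≤ length ys → (j : Fin (suc m)) → ∃ λ v → Σ (v ∈ ys) λ p → cap m p ≡ j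
cap-onto m (y ∷ ys) l zero = y , here refl , cap-here m {ys = ys} refl
cap-onto (suc m) (y ∷ ys) (s≤s l) (suc j) with cap-onto m ys l j
... | v , p , eq = v , there p , cong suc eq

-- Minor models from disjoint cycles

module Contract (G : Graph) where
  R : Fin (Graph.n G) → Fin (Graph.n G) → Set
  R u v = Graph.adj G u v ≡ true

  reach-mono : ∀ {P Q u v} → (∀ {w} → P w → Q w) → Reach G P u v → Reach G Q u v
  reach-mono f (here p) = here (f p)
  reach-mono f (step r e p) = step (reach-mono f r) e (f p)

  reach-sym : ∀ {P u v} → Reach G P u v → Reach G P v u
  reach-sym (here p) = here p
  reach-sym {P} (step {w = w} {v} r e p) =
    reach-trans {X = ⊤} (step (here p) (trans (Graph.sym G v w) e) (end r)) (reach-sym r)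
    where
    end : ∀ {u v} → Reach G P u v → P v
    end (here p) = p
    end (step _ _ p) = p

  chain-reach : ∀ {y ys z w} → Chain R y ys z → w ∈ y ∷ ys → Reach G (_∈ y ∷ ys) y w
  chain-reach c (here refl) = here (here refl)
  chain-reach (r ∷ c) (there m) = reach-trans {X = ⊤} (step (here (here refl)) r (there (here refl))) (reach-mono there (chain-reach c m))

  -- Below the cut-off a position belongs to a single vertex; the last position collects the whole
  -- rest of the walk, which is connected.
  cap-reach : ∀ m {y ys z u v} → Chain R y ys z → (p : u ∈ y ∷ ys) (q : v ∈ y ∷ ys) → cap m p ≡ cap m q →
              Reach G (λ w → Σ (w ∈ y ∷ ys) λ r → cap m r ≡ cap m p) u v
  cap-reach zero c p q eq = reach-mono (λ m → m , refl) (reach-trans {X = ⊤} (reach-sym (chain-reach c p)) (chain-reach c q))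
  cap-reach (suc m) c (here refl) (here refl) eq = here (here refl , refl)
  cap-reach (suc m) (r ∷ c) (there p) (there q) eq = reach-mono (λ (m , e) → there m , cong suc e) (cap-reach m c p q (Fin.suc-injective eq))

  cap-step : ∀ m {y ys z} → Chain R y ys z → suc m ≤ length (y ∷ ys) → (j : Fin m) →
             ∃₂ λ u v → Σ (u ∈ y ∷ ys) λ p → Σ (v ∈ y ∷ ys) λ q → cap m p ≡ inject₁ j × cap m q ≡ suc j × R u v
  cap-step (suc m) {y} {y′ ∷ ys} (r ∷ c) l zero = y , y′ , here refl , there (here refl) , refl , cong suc (cap-here m {ys = ys} refl) , r
  cap-step (suc m) {y} {y′ ∷ ys} (r ∷ c) (s≤s l) (suc j) with cap-step m c l j
  ... | u , v , p , q , e , e′ , ruv = u , v , there p , there q , cong suc e , cong suc e′ , ruv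
  cap-step (suc m) {ys = []} c (s≤s ()) j

  cap-end : ∀ m {y ys z} (c : Chain R y ys z) → suc m ≤ length (y ∷ ys) → cap m (end∈ c) ≡ fromℕ m
  cap-end zero c l = refl
  cap-end (suc m) (r ∷ c) (s≤s l) = cong suc (cap-end m c l)
  cap-end (suc m) [] (s≤s ())

module _ {k : ℕ} {H : Graph} (cyc : Fin k → Cycle H)
         (cover : ∀ v → ∃[ i ] ∃[ j ] vtx (cyc i) j ≡ v)
         (apart : ∀ i i′ j j′ → vtx (cyc i) j ≡ vtx (cyc i′) j′ → i ≡ i′)
         (edges⇔ : ∀ u v → (Graph.adj H u v ≡ true) ⇔ (∃[ i ] CycleEdge (cyc i) u v)) where

  size : Fin k → ℕ
  size i = suc (Cycle.m (cyc i))

  listing : List (Fin k) → List (Fin (Graph.n H))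
  listing [] = []
  listing (i ∷ is) = tabulate (vtx (cyc i)) ++ listing is

  listing-unique : ∀ {is} → Unique is → Unique (listing is)
  listing-unique {[]} u = []
  listing-unique {i ∷ is} u = unique-++⁺ (Unique.tabulate⁺ (λ {a} {b} → inj (cyc i) a b)) (listing-unique (tail-unique u)) disj
    where
    which : ∀ is {v} → v ∈ listing is → ∃₂ λ i j → i ∈ is × v ≡ vtx (cyc i) j
    which (i ∷ is) m with ∈-++⁻ (tabulate (vtx (cyc i))) m
    ... | inj₁ m₁ = let (j , eq) = ∈-tabulate⁻ {f = vtx (cyc i)} m₁ in i , j , here refl , eq
    ... | inj₂ m₂ = let (i′ , j , i∈ , eq) = which is m₂ in i′ , j , there i∈ , eq
    disj : ∀ {v} → v ∈ tabulate (vtx (cyc i)) → v ∉ listing is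
    disj m m′ with ∈-tabulate⁻ {f = vtx (cyc i)} m | which is m′
    ... | j , eq | i′ , j′ , i∈ , eq′ = head∉ u (subst (_∈ is) (sym (apart i i′ j j′ (trans (sym eq) eq′))) i∈)

  length-listing : ∀ is → length (listing is) ≡ sum (map size is)
  length-listing [] = refl
  length-listing (i ∷ is) = trans (List.length-++ (tabulate (vtx (cyc i)))) (cong₂ _+_ (List.length-tabulate (vtx (cyc i))) (length-listing is))

  -- The cycles of `H` are disjoint, so listing all their vertices produces no repetition.
  total≤ : sum (map size (allFin k)) ≤ Graph.n H
  total≤ = subst (_≤ Graph.n H) (length-listing (allFin k)) (unique-length≤ (listing-unique (Unique.allFin⁺ k)))

  3*≤total : ∀ is → length is * 3 ≤ sum (map size is)
  3*≤total [] = z≤n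
  3*≤total (i ∷ is) = ℕ.+-mono-≤ (s≤s (len≥3 (cyc i))) (3*≤total is)

  module _ {G : Graph} (verts : Fin k → List (Fin (Graph.n G)))
           (good : ∀ i → ∃ λ a → IsCycle (λ u v → Graph.adj G u v ≡ true) a (verts i) × size i ≤ length (verts i))
           (disjoint : ∀ {i j w} → i ≢ j → w ∈ verts i → w ∉ verts j) where
    open Contract G

    place : ∀ {i v} → v ∈ verts i → Fin (Graph.n H)
    place {i} p = vtx (cyc i) (cap (Cycle.m (cyc i)) p)

    β : Fin (Graph.n G) → Maybe (Fin (Graph.n H))
    β v = pick (Fin.any? (λ i → v ∈? verts i))
      where
      pick : Dec (∃ λ i → v ∈ verts i) → Maybe (Fin (Graph.n H))
      pick (yes (i , p)) = just (place p)
      pick (no _) = nothing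

    same-place : ∀ {i j v} (p : v ∈ verts i) (q : v ∈ verts j) → place p ≡ place q
    same-place {i} {j} p q with i Fin.≟ j
    ... | no i≢j = ⊥-elim (disjoint i≢j p q)
    ... | yes refl = cong (vtx (cyc i)) (cap-unique _ (unique (proj₁ (proj₂ (good i)))) p q)

    β-on : ∀ {i v} (p : v ∈ verts i) → β v ≡ just (place p)
    β-on {i} {v} p with Fin.any? (λ i → v ∈? verts i)
    ... | yes (j , q) = cong just (same-place q p)
    ... | no none = ⊥-elim (none (i , p))

    β-inv : ∀ {v h} → β v ≡ just h → ∃ λ i → Σ (v ∈ verts i) λ p → place p ≡ h
    β-inv {v} eq with Fin.any? (λ i → v ∈? verts i)
    β-inv refl | yes (i , p) = i , p , refl

    minor : H ≼ G
    minor = record { β = β ; nonempty = nonempty ; connected = connected′ ; edges = edges′ }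
      where
      nonempty : ∀ h → ∃[ v ] β v ≡ just h
      nonempty h with cover h
      ... | i , j , refl with cap-onto _ (verts i) (proj₂ (proj₂ (good i))) j
      ...   | v , p , refl = v , β-on p

      connected′ : ∀ h u v → β u ≡ just h → β v ≡ just h → Reach G (λ w → β w ≡ just h) u v
      connected′ h u v eu ev with β-inv {u} eu | β-inv {v} ev
      ... | i , p , refl | j , q , eq = go (apart j i _ _ eq) q eq
        where
        along : ∀ {u v} ys → (∃ λ a → IsCycle R a ys × size i ≤ length ys) →
                (∀ {w} (r : w ∈ ys) → β w ≡ just (vtx (cyc i) (cap (Cycle.m (cyc i)) r))) → (p : u ∈ ys) (q : v ∈ ys) →
                vtx (cyc i) (cap (Cycle.m (cyc i)) q) ≡ vtx (cyc i) (cap (Cycle.m (cyc i)) p) →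
                Reach G (λ w → β w ≡ just (vtx (cyc i) (cap (Cycle.m (cyc i)) p))) u v
        along (y ∷ ys) (a , cycle (_ ∷ c) _ _ , _) on p q eq =
          reach-mono (λ (r , e) → trans (on r) (cong (λ c → just (vtx (cyc i) c)) e)) (cap-reach _ c p q (sym (inj (cyc i) _ _ eq)))
        go : j ≡ i → (q : v ∈ verts j) → place q ≡ place p → Reach G (λ w → β w ≡ just (place p)) u v
        go refl q eq = along (verts i) (good i) β-on p q eq

      edges′ : ∀ x y → Graph.adj H x y ≡ true → ∃[ u ] ∃[ v ] (β u ≡ just x × β v ≡ just y × Graph.adj G u v ≡ true)
      edges′ x y e with Equivalence.to (edges⇔ x y) e
      ... | i , ce with verts i | good i | β-on {i}
      ... | z ∷ zs | a , cycle (r ∷ c) _ _ , l | on = go ce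
        where
        M = Cycle.m (cyc i)
        at : ∀ {v j} (p : v ∈ z ∷ zs) → cap M p ≡ j → β v ≡ just (vtx (cyc i) j)
        at p eq = trans (on p) (cong (λ c → just (vtx (cyc i) c)) eq)
        swap-ends : ∀ {x y} → ∃[ u ] ∃[ v ] (β u ≡ just x × β v ≡ just y × Graph.adj G u v ≡ true) →
                    ∃[ u ] ∃[ v ] (β u ≡ just y × β v ≡ just x × Graph.adj G u v ≡ true)
        swap-ends (u , v , a , b , e) = v , u , b , a , trans (Graph.sym G v u) e
        forward : ∀ j → ∃[ u ] ∃[ v ] (β u ≡ just (vtx (cyc i) (inject₁ j)) × β v ≡ just (vtx (cyc i) (suc j)) × Graph.adj G u v ≡ true)
        forward j with cap-step M c l j
        ... | u , v , p , q , e , e′ , r = u , v , at p e , at q e′ , r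
        closing : ∃[ u ] ∃[ v ] (β u ≡ just (vtx (cyc i) (fromℕ M)) × β v ≡ just (vtx (cyc i) zero) × Graph.adj G u v ≡ true)
        -- The base `a` is the last entry of `z ∷ zs`, at the cut-off position `M`, and `z` is the
        -- first. So the first step `r` of the cycle realises the closing edge.
        closing = a , z , at (end∈ c) (cap-end M c l) , at (here refl) (cap-here M {ys = zs} refl) , r
        go : ∀ {x y} → CycleEdge (cyc i) x y → ∃[ u ] ∃[ v ] (β u ≡ just x × β v ≡ just y × Graph.adj G u v ≡ true)
        go (fwd j) = forward j
        go (bwd j) = swap-ends (forward j)
        go clf = closing
        go clb = swap-ends closing

-- Logarithms and the final bound

log₂ : ∀ k → 1 ≤ k → ∃ λ a → 2 ^ a ≤ k × k < 2 ^ suc a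
log₂ (suc zero) _ = 0 , s≤s z≤n , s≤s (s≤s z≤n)
log₂ (suc k@(suc _)) _ with log₂ k (s≤s z≤n)
... | a , lo , hi with suc k ℕ.<? 2 ^ suc a
... | yes lt = a , ℕ.m≤n⇒m≤1+n lo , lt
... | no ¬lt = suc a , ℕ.≮⇒≥ ¬lt , ℕ.≤-<-trans hi (ℕ.^-monoʳ-< 2 (s≤s (s≤s z≤n)) (ℕ.n<1+n (suc a)))

log₂≥ : ∀ {k a b} → 2 ^ b ≤ k → k < 2 ^ suc a → b ≤ a
log₂≥ {k} {a} {b} lo hi = ℕ.≮⇒≥ λ a<b → ℕ.<⇒≱ (ℕ.<-≤-trans hi (ℕ.^-monoʳ-≤ 2 a<b)) lo

-- The `k₀ * (r + r) + 1` ears at which growth stops have twice as many ends, and these must be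
-- fewer than `2 ^ r` for the pigeonhole argument on walks.
Short : ℕ → ℕ → Set
Short k₀ r = (k₀ * (r + r) + 1) + (k₀ * (r + r) + 1) < 2 ^ r

short-mono : ∀ {j k r} → j ≤ k → Short k r → Short j r
short-mono {r = r} j≤k s = ℕ.≤-<-trans (ℕ.+-mono-≤ le le) s
  where le = ℕ.+-monoˡ-≤ 1 (ℕ.*-monoˡ-≤ (r + r) j≤k)

-- It suffices that `suc k₀ * (4 * r) ≤ 2 ^ r`. Here `suc k₀` is at most `2 ^ suc a`, and `r` is at
-- most `2 ^ (2 + b)` once `b + 4 ≤ 2 ^ suc b`, which first holds at `b = 2`; with the factor 4 the
-- exponents add up to `r`.
short-large : ∀ {k₀ a b} → suc k₀ < 2 ^ suc a → a < 2 ^ suc b → 2 ≤ b → Short k₀ (suc (4 + (a + b)))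
short-large {k₀} {a} {b} k< a< 2≤b = begin-strict
  (k₀ * (r + r) + 1) + (k₀ * (r + r) + 1)                    ≡⟨ expand k₀ r ⟩
  k₀ * (4 * r) + 2                                           <⟨ ℕ.+-monoʳ-< (k₀ * (4 * r)) (s≤s (s≤s (s≤s z≤n))) ⟩
  k₀ * (4 * r) + 4 * r                                       ≡⟨ collect k₀ r ⟩
  suc k₀ * (4 * r)                                           ≤⟨ ℕ.*-mono-≤ (ℕ.<⇒≤ k<) (ℕ.*-monoʳ-≤ 4 r≤) ⟩
  2 ^ suc a * (4 * 2 ^ (2 + b))                              ≡⟨ cong (2 ^ suc a *_) (sym (ℕ.^-distribˡ-+-* 2 2 (2 + b))) ⟩
  2 ^ suc a * 2 ^ (4 + b)                                    ≡⟨ sym (ℕ.^-distribˡ-+-* 2 (suc a) (4 + b)) ⟩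
  2 ^ (suc a + (4 + b))                                      ≡⟨ cong (2 ^_) (cong suc (exchange a b)) ⟩
  2 ^ r                                                      ∎
  where
  open ℕ.≤-Reasoning
  open +-*-Solver
  r = suc (4 + (a + b))
  expand : ∀ k r → (k * (r + r) + 1) + (k * (r + r) + 1) ≡ k * (4 * r) + 2
  expand = solve 2 (λ k r → (k :* (r :+ r) :+ con 1) :+ (k :* (r :+ r) :+ con 1) := k :* (con 4 :* r) :+ con 2) refl
  collect : ∀ k r → k * (4 * r) + 4 * r ≡ suc k * (4 * r)
  collect = solve 2 (λ k r → k :* (con 4 :* r) :+ con 4 :* r := (con 1 :+ k) :* (con 4 :* r)) refl
  exchange : ∀ a b → a + (4 + b) ≡ 4 + (a + b)
  exchange = solve 2 (λ a b → a :+ (con 4 :+ b) := con 4 :+ (a :+ b)) refl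
  b≤ : ∀ c → (2 + c) + 4 ≤ 2 ^ suc (2 + c)
  b≤ zero = s≤s (s≤s (s≤s (s≤s (s≤s (s≤s z≤n)))))
  b≤ (suc c) = ℕ.≤-trans (ℕ.+-monoʳ-≤ 1 (b≤ c)) (ℕ.≤-trans (ℕ.+-monoˡ-≤ (2 ^ suc (2 + c)) (ℕ.≤-trans (s≤s z≤n) (b≤ c)))
    (ℕ.+-monoʳ-≤ (2 ^ suc (2 + c)) (ℕ.m≤m+n _ 0)))
  b+4≤ : ∀ {b} → 2 ≤ b → b + 4 ≤ 2 ^ suc b
  b+4≤ (s≤s (s≤s {n = c} _)) = b≤ c
  r≤ : r ≤ 2 ^ (2 + b)
  r≤ = begin
    suc (4 + (a + b))              ≡⟨ regroup a b ⟩
    suc a + (b + 4)                ≤⟨ ℕ.+-mono-≤ a< (b+4≤ 2≤b) ⟩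
    2 ^ suc b + 2 ^ suc b          ≡⟨ cong (2 ^ suc b +_) (sym (ℕ.+-identityʳ (2 ^ suc b))) ⟩
    2 ^ (2 + b)                    ∎
    where
    regroup : ∀ a b → suc (4 + (a + b)) ≡ suc a + (b + 4)
    regroup = solve 2 (λ a b → con 1 :+ (con 4 :+ (a :+ b)) := (con 1 :+ a) :+ (b :+ con 4)) refl

-- a and b are the integer parts of log k and log a.
logs : ∀ k₀ → 1 ≤ k₀ → ∃₂ λ a b → 2 ^ a ≤ suc k₀ × 2 ^ b ≤ a × Short k₀ (suc (4 + (a + b)))
logs k₀ 1≤k₀ with k₀ ℕ.≤? 2 | k₀ ℕ.≤? 6 | k₀ ℕ.≤? 14
-- For `k₀` up to 14, `b` is below 2 and `short-large` does not apply. On 1 to 2, 3 to 6 and 7 to 14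
-- the pair `a , b` is constant, so the largest `k₀` decides: 50 < 64, 194 < 256 and 506 < 512.
... | yes k≤2 | _ | _ = 1 , 0 , s≤s 1≤k₀ , s≤s z≤n , short-mono {r = 6} k≤2 (toWitness {a? = 51 ℕ.≤? 64} tt)
... | no k≰2 | yes k≤6 | _ = 2 , 1 , s≤s (ℕ.≰⇒> k≰2) , s≤s (s≤s z≤n) , short-mono {r = 8} k≤6 (toWitness {a? = 195 ℕ.≤? 256} tt)
... | no _ | no k≰6 | yes k≤14 = 3 , 1 , s≤s (ℕ.≰⇒> k≰6) , s≤s (s≤s z≤n) , short-mono {r = 9} k≤14 (toWitness {a? = 507 ℕ.≤? 512} tt)
... | no _ | no _ | no k≰14 with log₂ (suc k₀) (s≤s z≤n)
... | a , lo , hi with log₂≥ {a = a} {b = 4} (s≤s (ℕ.≰⇒> k≰14)) hi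
... | 4≤a with log₂ a (ℕ.≤-trans (s≤s z≤n) 4≤a)
... | b , lo′ , hi′ = a , b , lo , lo′ , short-large {k₀} {a} {b} hi hi′ (log₂≥ {a = b} {b = 2} 4≤a hi′)

^-distribʳ-* : ∀ m n o → (m * n) ^ o ≡ m ^ o * n ^ o
^-distribʳ-* m n zero = refl
^-distribʳ-* m n (suc o) = trans (cong (m * n *_) (^-distribʳ-* m n o)) (interchange m n (m ^ o) (n ^ o))
  where
  open +-*-Solver
  interchange : ∀ a b c d → (a * b) * (c * d) ≡ (a * c) * (b * d)
  interchange = solve 4 (λ a b c d → (a :* b) :* (c :* d) := (a :* c) :* (b :* d)) refl

-- From `2 ^ (a * q) ≤ k ^ q ≤ 2 ^ p` follows `a * q ≤ p`. Hence
-- `2 ^ (a + b) * q ≤ k * a * q ≤ k * p`, and the claim is this inequality raised to the power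
-- `10 * k`.
log-bound : ∀ {k a b} → 2 ^ a ≤ k → 2 ^ b ≤ a → LeTenKLogKLogK k ((a + b) * (10 * k))
log-bound {k} {a} {b} 2^a≤k 2^b≤a p q 1≤q k^q≤2^p = begin
  2 ^ ((a + b) * (10 * k)) * q ^ (10 * k)       ≡⟨ cong (_* q ^ (10 * k)) (sym (ℕ.^-*-assoc 2 (a + b) (10 * k))) ⟩
  (2 ^ (a + b)) ^ (10 * k) * q ^ (10 * k)       ≡⟨ sym (^-distribʳ-* (2 ^ (a + b)) q (10 * k)) ⟩
  (2 ^ (a + b) * q) ^ (10 * k)                  ≤⟨ ℕ.^-monoˡ-≤ (10 * k) base ⟩
  (k * p) ^ (10 * k)                            ∎
  where
  open ℕ.≤-Reasoning
  aq≤p : a * q ≤ p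
  aq≤p = ℕ.≮⇒≥ λ p<aq → ℕ.<⇒≱ (ℕ.^-monoʳ-< 2 (s≤s (s≤s z≤n)) p<aq)
    (ℕ.≤-trans (ℕ.≤-reflexive (sym (ℕ.^-*-assoc 2 a q))) (ℕ.≤-trans (ℕ.^-monoˡ-≤ q 2^a≤k) k^q≤2^p))
  base : 2 ^ (a + b) * q ≤ k * p
  base = begin
    2 ^ (a + b) * q          ≡⟨ cong (_* q) (ℕ.^-distribˡ-+-* 2 a b) ⟩
    2 ^ a * 2 ^ b * q        ≡⟨ ℕ.*-assoc (2 ^ a) (2 ^ b) q ⟩
    2 ^ a * (2 ^ b * q)      ≤⟨ ℕ.*-mono-≤ 2^a≤k (ℕ.≤-trans (ℕ.*-monoˡ-≤ q 2^b≤a) aq≤p) ⟩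
    k * p                    ∎

-- With `r = a + b + 5` the hitting set costs `10 * k₀ * (a + b) + 52 * k₀`. Of the 52, 40 fit the
-- stated term; the other 12 are four times 3 and go into `4 * M`, because each cycle of `H` has at
-- least three vertices. Deletions and `ℓ` bring `2 * M`, which makes `6 * M`.
parameters : ∀ k₀ → ∃ λ r′ → Short k₀ (suc r′) × (∀ {M T w} → T ≤ M → suc k₀ * 3 ≤ T →
             w ≤ (T + T) + ((k₀ * (suc r′ + suc r′)) * 5 + (k₀ + k₀)) → WithinBound M (suc k₀) w)
-- For one cycle, `r = 2` is the least value with `2 < 2 ^ r`, and the cost of hitting vanishes with
-- `k₀`.
parameters zero = 1 , s≤s (s≤s (s≤s z≤n)) , λ {M} {T} {w} T≤M _ w≤ → begin
    w                    ≤⟨ w≤ ⟩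
    (T + T) + 0          ≡⟨ ℕ.+-identityʳ (T + T) ⟩
    T + T                ≤⟨ ℕ.+-mono-≤ T≤M T≤M ⟩
    M + M                ≤⟨ ℕ.+-monoʳ-≤ M (ℕ.m≤m+n M (4 * M)) ⟩
    6 * M                ≤⟨ ℕ.m≤m+n (6 * M) 40 ⟩
    6 * M + 40           ∎
  where open ℕ.≤-Reasoning
parameters k₀@(suc k₁) with logs k₀ (s≤s z≤n)
... | a , b , 2^a≤k , 2^b≤a , sh = 4 + (a + b) , sh , λ {M} {T} {w} T≤M 3k≤T w≤ →
      (a + b) * (10 * suc k₀) , (begin
    w                                                                       ≤⟨ w≤ ⟩
    (T + T) + ((k₀ * (suc (4 + (a + b)) + suc (4 + (a + b)))) * 5 + (k₀ + k₀)) ≡⟨ expand T k₀ (a + b) ⟩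
    (T + T) + ((a + b) * (10 * k₀) + 52 * k₀)                               ≤⟨ ℕ.+-monoʳ-≤ (T + T) (ℕ.+-mono-≤
                                                                                 (ℕ.*-monoʳ-≤ (a + b) (ℕ.*-monoʳ-≤ 10 (ℕ.n≤1+n k₀)))
                                                                                 (ℕ.*-monoʳ-≤ 52 (ℕ.n≤1+n k₀))) ⟩
    (T + T) + ((a + b) * (10 * suc k₀) + 52 * suc k₀)                       ≡⟨ split52 T (suc k₀) ((a + b) * (10 * suc k₀)) ⟩
    (T + T) + 4 * (suc k₀ * 3) + 40 * suc k₀ + (a + b) * (10 * suc k₀)      ≤⟨ ℕ.+-monoˡ-≤ ((a + b) * (10 * suc k₀)) (ℕ.+-monoˡ-≤ (40 * suc k₀)
                                                                                 (ℕ.+-mono-≤ (ℕ.+-mono-≤ T≤M T≤M) (ℕ.*-monoʳ-≤ 4 (ℕ.≤-trans 3k≤T T≤M)))) ⟩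
    (M + M) + 4 * M + 40 * suc k₀ + (a + b) * (10 * suc k₀)                 ≡⟨ cong (λ x → x + 40 * suc k₀ + (a + b) * (10 * suc k₀)) (six M) ⟩
    6 * M + 40 * suc k₀ + (a + b) * (10 * suc k₀)                           ∎) ,
    log-bound {suc k₀} {a} {b} 2^a≤k 2^b≤a
  where
  open ℕ.≤-Reasoning
  open +-*-Solver
  expand : ∀ T k s → (T + T) + ((k * (suc (4 + s) + suc (4 + s))) * 5 + (k + k)) ≡ (T + T) + (s * (10 * k) + 52 * k)
  expand = solve 3 (λ T k s → (T :+ T) :+ ((k :* ((con 5 :+ s) :+ (con 5 :+ s))) :* con 5 :+ (k :+ k)) :=
             (T :+ T) :+ (s :* (con 10 :* k) :+ con 52 :* k)) refl
  split52 : ∀ T k x → (T + T) + (x + 52 * k) ≡ (T + T) + 4 * (k * 3) + 40 * k + x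
  split52 = solve 3 (λ T k x → (T :+ T) :+ (x :+ con 52 :* k) := (T :+ T) :+ con 4 :* (k :* con 3) :+ con 40 :* k :+ x) refl
  six : ∀ M → (M + M) + 4 * M ≡ 6 * M
  six = solve 1 (λ M → (M :+ M) :+ con 4 :* M := con 6 :* M) refl

theorem1 : ∀ (k : ℕ) → 1 ≤ k → (H : Graph) → IsDisjointUnionOfCycles k H →
    (G : Graph) → ¬ (H ≼ G) →
    Σ ℕ λ w → TreewidthAtMost G w × WithinBound (n H) k w
theorem1 (suc k₀) _ H (cyc , cover , apart , edges⇔) G ¬minor = conclude (parameters k₀)
  where
  len : Fin (suc k₀) → ℕ
  len = size cyc cover apart edges⇔

  all : List (Fin (suc k₀))
  all = allFin (suc k₀)

  R : Fin (n G) → Fin (n G) → Set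
  R u v = adj G u v ≡ true

  R-irr : ∀ {u v} → R u v → u ≢ v
  R-irr {u} r refl = case trans (sym r) (irrefl G u) of λ ()

  module S = Selection R (λ u v → adj G u v Bool.≟ true) (λ {u} {v} r → trans (Graph.sym G v u) r) R-irr len (λ i → s≤s (len≥3 (cyc i)))

  conclude : (∃ λ r′ → Short k₀ (suc r′) × (∀ {M T w} → T ≤ M → suc k₀ * 3 ≤ T →
               w ≤ (T + T) + ((k₀ * (suc r′ + suc r′)) * 5 + (k₀ + k₀)) → WithinBound M (suc k₀) w)) →
             Σ ℕ λ w → TreewidthAtMost G w × WithinBound (n H) (suc k₀) w
  conclude (r′ , small , within) = finish (S.choose k₀ r′ small k₀ all [] (List.length-tabulate {n = suc k₀} id) ℕ.≤-refl (Unique.allFin⁺ (suc k₀)))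
    where
    finish : S.Assignment all [] ⊎ S.Bounded ((S.total all + S.total all) + ((k₀ * (suc r′ + suc r′)) * 5 + (k₀ + k₀))) →
             Σ ℕ λ w → TreewidthAtMost G w × WithinBound (n H) (suc k₀) w
    finish (inj₁ A) = ⊥-elim (¬minor (minor cyc cover apart edges⇔ {G} verts (λ i → good (∈-allFin i))
                        (λ i≢j → disjoint (∈-allFin _) (∈-allFin _) i≢j)))
      where open S.Assignment A
    finish (inj₂ (Y , ℓ , 3≤ℓ , size≤ , hits)) = length Y + (ℓ ∸ 2) , DepthFirst.decomposition G Y ℓ 3≤ℓ hits ,
      within (total≤ cyc cover apart edges⇔) (subst (λ l → l * 3 ≤ S.total all) (List.length-tabulate {n = suc k₀} id) (3*≤total cyc cover apart edges⇔ all))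
        (ℕ.≤-trans (ℕ.+-monoʳ-≤ (length Y) (ℕ.m∸n≤m ℓ 2)) size≤)
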